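{- Let $\alpha>0$ be a fixed real number. Let $k=k(n)$ and $m=m(n)$ be functions of $n$ such that $k\geq 2$ and $m=\lfloor n^\alpha\rfloor$. (i) If $\liminf_{n\rightarrow\infty} \frac{k^2n}{m\log n}>1$, then asymptotically almost surely $G(n,m,k)$ is connected. (ii) If $\limsup_{n\rightarrow\infty} \frac{k^2n}{m\log n}<1$, then asymptotically almost surely $G(n,m,k)$ is not connected.
   Context: The uniform random intersection graph $G(n,m,k)$ (for positive integers $k\le m$) is the random graph on a set $V$ of $n$ nodes defined as follows: fix a set $M$ of $m$ colours; to each node $v\in V$ assign a subset $F_v\subseteq M$ of exactly $k$ distinct colours, chosen uniformly at random among all $k$-subsets of $M$, independently for different nodes; distinct nodes $u,v$ are joined by an edge if and only if $F_u\cap F_v\neq\emptyset$. An event holds asymptotically almost surely if its probability tends to $1$ as $n\rightarrow\infty$. Here $\log$ denotes the natural logarithm. -}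

module Defs where

open import Algebra.Bundles using (RawRing)
open import Data.Fin.Base using (Fin)
open import Data.Fin.Properties using (_≟_)
open import Data.Fin.Subset using (Subset; inside; outside; Nonempty; _∩_; ∣_∣)
open import Data.Fin.Subset.Properties using (nonempty?)
import Data.Fin.Properties as Fin
open import Data.Integer.Base using (+_)
open import Data.List.Base using (List; []; _∷_; _++_; map; filter; length; allFin; cartesianProductWith)
open import Data.List.Membership.Propositional using (_∈_)
open import Data.List.Membership.Propositional.Properties using (∈-allFin)
open import Data.List.Relation.Unary.Any using (here; there)
open import Data.Nat.Base as ℕ using (ℕ; zero; suc; _!)
open import Data.Nat.Properties as ℕ using (_!≢0)
open import Data.Product.Base using (∃; ∃₂; _×_; _,_; proj₁; proj₂)
open import Data.Rational.Base using (ℚ; 0ℚ; 1ℚ; _+_; _-_; _*_; _/_; _<_; _≤_; +-*-rawRing) renaming (∣_∣ to abs)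
open import Data.Sum.Base using (_⊎_; inj₁; inj₂)
open import Data.Vec.Base using (Vec; []; _∷_; lookup)
open import Level using (0ℓ)
open import Relation.Binary.Construct.Closure.ReflexiveTransitive using (Star; ε; _◅_; _◅◅_)
open import Relation.Binary.Core using (Rel)
open import Relation.Binary.Definitions using (Decidable)
open import Relation.Binary.PropositionalEquality using (_≡_; _≢_; refl)
open import Relation.Nullary using (¬_)
open import Relation.Nullary.Decidable using (Dec; map′; ¬?; _×-dec_; _⊎-dec_)
import Relation.Unary as Unary

open import Algebra.Definitions.RawSemiring
  (RawRing.rawSemiring +-*-rawRing) using (_^_) public

fromℕ : ℕ → ℚ
fromℕ n = + n / 1

Eventually : (ℕ → Set) → Set
Eventually P = ∃ λ N → ∀ n → N ℕ.≤ n → P n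

------------------------------------------------------------------------
-- Real numbers as Dedekind cuts

-- A number x is given by the rationals q with q < x and those with x < q.
-- The operations below yield such pairs of predicates; that a pair really
-- is a real number is the separate condition IsReal.

record Cut : Set₁ where
  field
    below : ℚ → Set
    above : ℚ → Set

infix 4 _<ᶜ_ _ᶜ<_

_<ᶜ_ : ℚ → Cut → Set
q <ᶜ x = Cut.below x q

_ᶜ<_ : Cut → ℚ → Set
x ᶜ< q = Cut.above x q

record IsReal (x : Cut) : Set where
  field
    inhabitedˡ : ∃ λ q → q <ᶜ x
    inhabitedʳ : ∃ λ q → x ᶜ< q
    closedˡ    : ∀ {p q} → p < q → q <ᶜ x → p <ᶜ x
    closedʳ    : ∀ {p q} → p < q → x ᶜ< p → x ᶜ< q
    openˡ      : ∀ {p} → p <ᶜ x → ∃ λ q → p < q × q <ᶜ x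
    openʳ      : ∀ {q} → x ᶜ< q → ∃ λ p → p < q × x ᶜ< p
    disjoint   : ∀ {q} → ¬ (q <ᶜ x × x ᶜ< q)
    located    : ∀ {p q} → p < q → p <ᶜ x ⊎ x ᶜ< q

record ℝ : Set₁ where
  field
    cut    : Cut
    isReal : IsReal cut
  open Cut cut public
  open IsReal isReal public

fromℚ : ℚ → Cut
fromℚ p = record { below = λ q → q < p ; above = λ q → p < q }

-- m ≤ x < m + 1, where m ≤ x is the negation of x < m.
IsFloor : ℕ → Cut → Set
IsFloor m x = ¬ (x ᶜ< fromℕ m) × x ᶜ< fromℕ (suc m)

-- m · x, for m positive.
infixr 7 _·_
_·_ : ℕ → Cut → Cut
m · x = record
  { below = λ q → ∃ λ l → l <ᶜ x × q < fromℕ m * l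
  ; above = λ q → ∃ λ u → x ᶜ< u × fromℕ m * u < q
  }

-- a / x, for a and x positive.  In the upper part l must be nonnegative:
-- a negative l below x would put negative q above the quotient.
infixl 6 _÷_
_÷_ : ℕ → Cut → Cut
a ÷ x = record
  { below = λ q → ∃ λ u → x ᶜ< u × q * u < fromℕ a
  ; above = λ q → ∃ λ l → l <ᶜ x × 0ℚ ≤ l × fromℕ a < q * l
  }

------------------------------------------------------------------------
-- Limits

-- The lower limit sup_N inf_{n ≥ N} x n may be infinite, and need not have
-- a located cut; it is described by the rationals strictly below it.  Dually
-- for the upper limit.

infix 4 _<liminf_ limsup_<_

_<liminf_ : ℚ → (ℕ → Cut) → Set
q <liminf x = ∃ λ c → q < c × Eventually (λ n → c <ᶜ x n)

limsup_<_ : (ℕ → Cut) → ℚ → Set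
limsup x < q = ∃ λ c → c < q × Eventually (λ n → x n ᶜ< c)

lim : (ℕ → Cut) → Cut
lim x = record { below = λ q → q <liminf x ; above = λ q → limsup x < q }

_⟶_ : (ℕ → ℚ) → ℚ → Set
p ⟶ l = ∀ δ → 0ℚ < δ → Eventually (λ n → abs (p n - l) < δ)

------------------------------------------------------------------------
-- Exponential, logarithm, real powers

sumBelow : ℕ → (ℕ → ℚ) → ℚ
sumBelow zero    f = 0ℚ
sumBelow (suc N) f = sumBelow N f + f N

exp : ℚ → Cut
exp q = lim λ N → fromℚ (sumBelow N λ i → q ^ i * (_/_ (+ 1) (i !) {{i !≢0}}))

-- The inverse of exp, for n positive: q < log n iff exp q < n.
log : ℕ → Cut
log n = record
  { below = λ q → exp q ᶜ< fromℕ n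
  ; above = λ q → fromℕ n <ᶜ exp q
  }

-- n to the power α, for α positive, by approximating α with positive
-- rationals i / j and comparing q with n ^ (i / j) as q ^ j with n ^ i.
_^ʳ_ : ℕ → Cut → Cut
n ^ʳ α = record
  { below = λ q → q < 0ℚ ⊎ ∃₂ λ i j →
      (+ suc i / suc j) <ᶜ α × q ^ suc j < fromℕ n ^ suc i
  ; above = λ q → 0ℚ ≤ q × ∃₂ λ i j →
      α ᶜ< (+ suc i / suc j) × fromℕ n ^ suc i < q ^ suc j
  }

------------------------------------------------------------------------
-- Graphs

Graph : ℕ → Set₁
Graph n = Rel (Fin n) 0ℓ

Connected : ∀ {n} → Graph n → Set
Connected E = ∀ u v → Star E u v

module _ {n : ℕ} {E : Graph n} where

  -- Walks whose inner vertices are restricted to a list (Warshall).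
  private
    Via : List (Fin n) → Graph n
    Via []       u v = u ≡ v ⊎ E u v
    Via (w ∷ ws) u v = Via ws u v ⊎ (Via ws u w × Via ws w v)

    via? : Decidable E → ∀ ws → Decidable (Via ws)
    via? E? []       u v = (u ≟ v) ⊎-dec E? u v
    via? E? (w ∷ ws) u v = via? E? ws u v ⊎-dec (via? E? ws u w ×-dec via? E? ws w v)

    via⇒star : ∀ ws {u v} → Via ws u v → Star E u v
    via⇒star []       (inj₁ refl)    = ε
    via⇒star []       (inj₂ e)       = e ◅ ε
    via⇒star (w ∷ ws) (inj₁ p)       = via⇒star ws p
    via⇒star (w ∷ ws) (inj₂ (p , q)) = via⇒star ws p ◅◅ via⇒star ws q

    base : ∀ ws {u v} → Via [] u v → Via ws u v
    base []       p = p
    base (w ∷ ws) p = inj₁ (base ws p)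

    join : ∀ ws {u w v} → w ∈ ws → Via ws u w → Via ws w v → Via ws u v
    join (x ∷ ws) (here refl) p q = inj₂ (to p , from q)
      where
      to : ∀ {u} → Via (x ∷ ws) u x → Via ws u x
      to (inj₁ p)       = p
      to (inj₂ (p , _)) = p
      from : ∀ {v} → Via (x ∷ ws) x v → Via ws x v
      from (inj₁ q)       = q
      from (inj₂ (_ , q)) = q
    join (x ∷ ws) (there i) (inj₁ p)       (inj₁ q)       = inj₁ (join ws i p q)
    join (x ∷ ws) (there i) (inj₁ p)       (inj₂ (q , r)) = inj₂ (join ws i p q , r)
    join (x ∷ ws) (there i) (inj₂ (p , q)) (inj₁ r)       = inj₂ (p , join ws i q r)
    join (x ∷ ws) (there i) (inj₂ (p , _)) (inj₂ (_ , r)) = inj₂ (p , r)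

    star⇒via : ∀ {u v} → Star E u v → Via (allFin n) u v
    star⇒via ε                 = base (allFin n) (inj₁ refl)
    star⇒via (_◅_ {j = w} e p) =
      join (allFin n) (∈-allFin w) (base (allFin n) (inj₂ e)) (star⇒via p)

  connected? : Decidable E → Dec (Connected E)
  connected? E? = Fin.all? λ u → Fin.all? λ v →
    map′ (via⇒star (allFin n)) star⇒via (via? E? (allFin n) u v)

------------------------------------------------------------------------
-- The uniform random intersection graph

subsets : ∀ m → List (Subset m)
subsets zero    = [] ∷ []
subsets (suc m) = map (outside ∷_) (subsets m) ++ map (inside ∷_) (subsets m)

subsetsOfSize : ∀ m → ℕ → List (Subset m)
subsetsOfSize m k = filter (λ S → ∣ S ∣ ℕ.≟ k) (subsets m)

vectors : ∀ {A : Set} n → List A → List (Vec A n)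
vectors zero    xs = [] ∷ []
vectors (suc n) xs = cartesianProductWith _∷_ xs (vectors n xs)

-- All F = (F_v), without repetition.  Independent uniform choices of the F_v
-- amount to a uniform choice from this list, which is nonempty if k ≤ m.
assignments : ∀ n m → ℕ → List (Vec (Subset m) n)
assignments n m k = vectors n (subsetsOfSize m k)

Intersection : ∀ {n m} → Vec (Subset m) n → Graph n
Intersection F u v = u ≢ v × Nonempty (lookup F u ∩ lookup F v)

intersection? : ∀ {n m} (F : Vec (Subset m) n) → Decidable (Intersection F)
intersection? F u v = ¬? (u ≟ v) ×-dec nonempty? (lookup F u ∩ lookup F v)

-- a / b, and 0 if b = 0.
proportion : ℕ → ℕ → ℚ
proportion a zero    = 0ℚ
proportion a (suc b) = + a / suc b

uniformProbability : ∀ {A : Set} {P : A → Set} → List A → Unary.Decidable P → ℚ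
uniformProbability Ω P? = proportion (length (filter P? Ω)) (length Ω)

ℙ[G_,_,_]connected : ℕ → ℕ → ℕ → ℚ
ℙ[G n , m , k ]connected =
  uniformProbability (assignments n m k) λ F → connected? (intersection? F)

ℙ[G_,_,_]disconnected : ℕ → ℕ → ℕ → ℚ
ℙ[G n , m , k ]disconnected =
  uniformProbability (assignments n m k) λ F → ¬? (connected? (intersection? F))

{-# OPTIONS --safe #-}

-- Let z = (1 − 1/m)^k: a set V of colours is avoided by a random k-set with
-- probability at most z^∣V∣.  Partial sums of the exponential series turn the
-- hypotheses into n z^(k e) ≤ 1 with e slightly below n in (i), and into
-- n v^(n + a) ≥ 1 with v close to z^k and a a small multiple of n in (ii).
--
-- (i) In a disconnected graph the vertices split into S and its complement so
-- that no colour is shared.  Write U for the union of the F_v, v ∈ S.  Adding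
-- one vertex at a time bounds E y^∣U∣ as long as S has at most t vertices, for
-- a suitable t.  This bounds the expected number of isolated sets of at most t
-- vertices, and, by Markov's inequality, the probability that some t vertices
-- have unusually few colours.  Otherwise both sides have many colours.  If
-- k n / m is bounded, a union bound over the smaller side S, with at most 2^n
-- choices, suffices; if k n / m is large, a union bound over the set X of
-- colours of a side does, every F_v being contained in X or disjoint from X.
--
-- (ii) Chebyshev's inequality applies to the number of isolated vertices, since
-- log-concavity of binomial coefficients makes isolations of two vertices
-- almost negatively correlated.

module Submission where

open import Defs renaming (fromℕ to ι)
open import Data.Bool.Base using (true; false; if_then_else_)
open import Data.Empty using (⊥-elim)
open import Data.Fin.Base using (Fin; zero; suc)
import Data.Fin.Properties as Fin
open import Data.Fin.Subset using (Subset; inside; outside; Nonempty; Empty; _∩_; _∪_; ∁; ⊥; ⁅_⁆; _∈_; _∉_; _⊆_; ∣_∣)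
open import Data.Fin.Subset.Properties
  using (nonempty?; drop-∷-Empty; ∣p∣≤n; ∣⊥∣≡0; ⊆-antisym; p⊆q⇒∣p∣≤∣q∣; x∈p∩q⁺; x∈p∩q⁻; x∈p∪q⁺; x∈p∪q⁻;
         x∈p⇒x∉∁p; x∈∁p⇒x∉p; x∉p⇒x∈∁p; ∉⊥; _∈?_; ∣∁p∣≡n∸∣p∣; ∣⁅x⁆∣≡1; x∈⁅x⁆; x∈⁅y⁆⇒x≡y)
import Data.Integer.Base as ℤ
import Data.Integer.Properties as ℤ
open import Data.List.Base using (List; []; _∷_; _++_; map; filter; length; cartesianProductWith)
open import Data.List.Membership.Propositional using () renaming (_∈_ to _∈ˡ_)
open import Data.List.Membership.Propositional.Properties using (∈-filter⁻; ∈-cartesianProductWith⁻; ∈-++⁺ˡ; ∈-++⁺ʳ; ∈-map⁺)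
open import Data.List.Relation.Unary.Any using (here; there)
open import Data.Nat.Base as ℕ using (ℕ; zero; suc; z≤n; s≤s; _!)
open import Data.Nat.DivMod using (m/n*n≤m; m%n<n; m≡m%n+[m/n]*n; /-monoˡ-≤; m*n/n≡m)
import Data.Nat.Properties as ℕ
open import Data.Nat.Properties using (_!≢0)
import Data.Nat.Tactic.RingSolver as ℕ-Ring
open import Data.Product.Base using (∃; _×_; _,_; proj₁; proj₂)
open import Data.Rational.Base
  using (ℚ; 0ℚ; 1ℚ; _+_; _-_; -_; _*_; _/_; _<_; _≤_; *≤*; *<*; mkℚ; 1/_; toℚᵘ) renaming (∣_∣ to abs)
import Data.Rational.Base as ℚ
open import Data.Rational.Properties hiding (_≟_)
import Data.Rational.Properties as ℚ
open import Data.Rational.Solver using (module +-*-Solver)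
import Data.Rational.Unnormalised.Base as ℚᵘ
import Data.Rational.Unnormalised.Properties as ℚᵘ
open import Data.Sum.Base using (_⊎_; inj₁; inj₂)
open import Data.Vec.Base using (Vec; []; _∷_; lookup; tabulate; here; there)
open import Data.Vec.Properties using (lookup∘tabulate; []=⇒lookup; lookup⇒[]=)
open import Effect.Monad using (RawMonad)
open import Function.Base using (_∘_)
open import Relation.Binary.Construct.Closure.ReflexiveTransitive using (Star; ε; _◅_; _◅◅_)
open import Relation.Binary.PropositionalEquality
open import Relation.Nullary
open import Relation.Nullary.Decidable using (does; _because_; ¬?; dec-true; dec-false; decidable-stable; ¬¬-excluded-middle)
open import Relation.Nullary.Negation using (¬¬-Monad)
open import Relation.Unary using () renaming (Decidable to Decidable₁)
open +-*-Solver using (solve; _:+_; _:*_; _:-_; :-_; _:=_; con)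

-- Rational arithmetic

-- Given the set U of its colours, S is isolated with probability at most z^(|U|(n - |S|)). The
-- obstacle is that colours repeat, so that |U| may be well below k|S|, while k may lie anywhere
-- between 2 and m/2. Hence the bound on E y^|U| with y = z^b: a further vertex multiplies it by at
-- most (y + 2|U|/m)^k, since each of its k colours is either new and contributes y, or repeated and
-- contributes 1. This factor is at most z^(ck), with c slightly below b, as long as 2|U|/m stays
-- within the gap z^c - z^b; the gap determines t. Beyond t vertices only the number of colours of a
-- side is controlled, by a fixed multiple of (z^c - z^b)m from below. Let b - c = a, a fixed
-- fraction of n. If z^a is bounded below, the gap is of order ak/m, so that z^(number of colours)
-- is tiny and beats the 2^n choices of S. If z^a is small, the gap may be too small for that; but
-- then y = z^a z^c is small against the gap, and the costs y^|X| of sets X of that many colours can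
-- be summed, very large X being treated separately.

toℚᵘ-ι : ∀ n → toℚᵘ (ι n) ℚᵘ.≃ ℚᵘ.mkℚᵘ (ℤ.+ n) 0
toℚᵘ-ι n = toℚᵘ-fromℚᵘ (ℚᵘ.mkℚᵘ (ℤ.+ n) 0)

ι-+ : ∀ i j → ι (i ℕ.+ j) ≡ ι i + ι j
ι-+ i j = toℚᵘ-injective (ℚᵘ.≃-trans (toℚᵘ-ι (i ℕ.+ j)) (ℚᵘ.≃-sym
  (ℚᵘ.≃-trans (toℚᵘ-homo-+ (ι i) (ι j))
  (ℚᵘ.≃-trans (ℚᵘ.+-cong (toℚᵘ-ι i) (toℚᵘ-ι j))
    (ℚᵘ.*≡* (cong (ℤ._* (ℤ.+ 1)) (cong₂ ℤ._+_ (ℤ.*-identityʳ (ℤ.+ i)) (ℤ.*-identityʳ (ℤ.+ j)))))))))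

ι-* : ∀ i j → ι (i ℕ.* j) ≡ ι i * ι j
ι-* i j = toℚᵘ-injective (ℚᵘ.≃-trans (toℚᵘ-ι (i ℕ.* j)) (ℚᵘ.≃-sym
  (ℚᵘ.≃-trans (toℚᵘ-homo-* (ι i) (ι j))
  (ℚᵘ.≃-trans (ℚᵘ.*-cong (toℚᵘ-ι i) (toℚᵘ-ι j))
    (ℚᵘ.*≡* (cong (ℤ._* (ℤ.+ 1)) (sym (ℤ.pos-* i j))))))))

ι-suc : ∀ i → ι (suc i) ≡ 1ℚ + ι i
ι-suc i = ι-+ 1 i

ι-mono-≤ : ∀ {i j} → i ℕ.≤ j → ι i ≤ ι j
ι-mono-≤ {i} {j} i≤j = toℚᵘ-cancel-≤ (ℚᵘ.≤-respˡ-≃ (ℚᵘ.≃-sym (toℚᵘ-ι i))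
  (ℚᵘ.≤-respʳ-≃ (ℚᵘ.≃-sym (toℚᵘ-ι j)) (ℚᵘ.*≤* (ℤ.*-monoʳ-≤-nonNeg (ℤ.+ 1) (ℤ.+≤+ i≤j)))))

ι-mono-< : ∀ {i j} → i ℕ.< j → ι i < ι j
ι-mono-< {i} {j} i<j = toℚᵘ-cancel-< (ℚᵘ.<-respˡ-≃ (ℚᵘ.≃-sym (toℚᵘ-ι i))
  (ℚᵘ.<-respʳ-≃ (ℚᵘ.≃-sym (toℚᵘ-ι j)) (ℚᵘ.*<* (ℤ.*-monoʳ-<-pos (ℤ.+ 1) (ℤ.+<+ i<j)))))

ι-cancel-≤ : ∀ {i j} → ι i ≤ ι j → i ℕ.≤ j
ι-cancel-≤ p = ℕ.≮⇒≥ λ j<i → <-irrefl refl (<-≤-trans (ι-mono-< j<i) p)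

0≤ι : ∀ i → 0ℚ ≤ ι i
0≤ι i = ι-mono-≤ {0} {i} z≤n

ι-∸ : ∀ {i j} → i ℕ.≤ j → ι (j ℕ.∸ i) ≡ ι j - ι i
ι-∸ {i} {j} i≤j = trans
  (solve 2 (λ a b → a := (a :+ b) :- b) refl (ι (j ℕ.∸ i)) (ι i))
  (cong (_- ι i) (trans (sym (ι-+ (j ℕ.∸ i) i)) (cong ι (ℕ.m∸n+n≡m i≤j))))

archimedean : ∀ p → ∃ λ K → p ≤ ι K
archimedean p@(mkℚ (ℤ.+ i) d _) = i , toℚᵘ-cancel-≤ (ℚᵘ.≤-respʳ-≃ (ℚᵘ.≃-sym (toℚᵘ-ι i))
  (ℚᵘ.*≤* (ℤ.*-monoˡ-≤-nonNeg (ℤ.+ i) (ℤ.+≤+ (s≤s z≤n)))))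
archimedean p@(mkℚ ℤ.-[1+ i ] d _) = 0 , *≤* ℤ.-≤+

0≤1 : 0ℚ ≤ 1ℚ
0≤1 = 0≤ι 1

0<1 : 0ℚ < 1ℚ
0<1 = ι-mono-< {0} {1} (s≤s z≤n)

*-mono-≤ : ∀ {a b c d} → 0ℚ ≤ a → 0ℚ ≤ c → a ≤ b → c ≤ d → a * c ≤ b * d
*-mono-≤ {a} {b} {c} {d} 0≤a 0≤c a≤b c≤d = ≤-trans
  (*-monoʳ-≤-nonNeg c {{ℚ.nonNegative 0≤c}} a≤b)
  (*-monoˡ-≤-nonNeg b {{ℚ.nonNegative (≤-trans 0≤a a≤b)}} c≤d)

*-monoˡ : ∀ {a b c} → 0ℚ ≤ c → a ≤ b → c * a ≤ c * b
*-monoˡ {c = c} 0≤c = *-monoˡ-≤-nonNeg c {{ℚ.nonNegative 0≤c}}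

*-monoʳ : ∀ {a b c} → 0ℚ ≤ c → a ≤ b → a * c ≤ b * c
*-monoʳ {c = c} 0≤c = *-monoʳ-≤-nonNeg c {{ℚ.nonNegative 0≤c}}

*-monoˡ-< : ∀ {a b c} → 0ℚ < c → a < b → c * a < c * b
*-monoˡ-< {c = c} 0<c = *-monoʳ-<-pos c {{ℚ.positive 0<c}}

*-cancelˡ-≤ : ∀ {a b c} → 0ℚ < c → c * a ≤ c * b → a ≤ b
*-cancelˡ-≤ {c = c} 0<c = *-cancelˡ-≤-pos c {{ℚ.positive 0<c}}

*-cancelʳ-≤ : ∀ {a b c} → 0ℚ < c → a * c ≤ b * c → a ≤ b
*-cancelʳ-≤ {c = c} 0<c = *-cancelʳ-≤-pos c {{ℚ.positive 0<c}}

*-cancelˡ-< : ∀ {a b c} → 0ℚ ≤ c → c * a < c * b → a < b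
*-cancelˡ-< {c = c} 0≤c = *-cancelˡ-<-nonNeg c {{ℚ.nonNegative 0≤c}}

0≤*-pos : ∀ {a b} → 0ℚ ≤ a → 0ℚ ≤ b → 0ℚ ≤ a * b
0≤*-pos {a} {b} 0≤a 0≤b = ≤-trans (≤-reflexive (sym (*-zeroʳ a))) (*-monoˡ 0≤a 0≤b)

0<*-pos : ∀ {a b} → 0ℚ < a → 0ℚ < b → 0ℚ < a * b
0<*-pos {a} {b} 0<a 0<b = ≤-<-trans (≤-reflexive (sym (*-zeroʳ a))) (*-monoˡ-< 0<a 0<b)

0≤+ : ∀ {a b} → 0ℚ ≤ a → 0ℚ ≤ b → 0ℚ ≤ a + b
0≤+ = +-mono-≤

≤⇒0≤- : ∀ {a b} → a ≤ b → 0ℚ ≤ b - a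
≤⇒0≤- {a} a≤b = ≤-trans (≤-reflexive (sym (+-inverseʳ a))) (+-monoˡ-≤ (- a) a≤b)

≤-by : ∀ {a b} e → 0ℚ ≤ e → b ≡ a + e → a ≤ b
≤-by {a} e 0≤e b≡ = ≤-trans (≤-reflexive (sym (+-identityʳ a)))
  (≤-trans (+-monoʳ-≤ a 0≤e) (≤-reflexive (sym b≡)))

a≤a+b : ∀ {a b} → 0ℚ ≤ b → a ≤ a + b
a≤a+b {b = b} 0≤b = ≤-by b 0≤b refl

a-b≤a : ∀ {a b} → 0ℚ ≤ b → a - b ≤ a
a-b≤a {a} {b} 0≤b = ≤-by b 0≤b (solve 2 (λ a b → a := (a :- b) :+ b) refl a b)

recip : ∀ {p} → 0ℚ < p → ∃ λ r → 0ℚ < r × p * r ≡ 1ℚ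
recip {p} 0<p = (1/ p) {{nz}} , positive⁻¹ ((1/ p) {{nz}}) {{1/pos⇒pos p {{pos}}}} , *-inverseʳ p {{nz}}
  where
  pos : ℚ.Positive p
  pos = ℚ.positive 0<p
  nz : ℚ.NonZero p
  nz = pos⇒nonZero p {{pos}}

0≤^ : ∀ {a} n → 0ℚ ≤ a → 0ℚ ≤ a ^ n
0≤^ zero    0≤a = 0≤1
0≤^ (suc n) 0≤a = 0≤*-pos 0≤a (0≤^ n 0≤a)

0<^ : ∀ {a} n → 0ℚ < a → 0ℚ < a ^ n
0<^ zero    0<a = 0<1
0<^ (suc n) 0<a = 0<*-pos 0<a (0<^ n 0<a)

^-mono : ∀ {a b} n → 0ℚ ≤ a → a ≤ b → a ^ n ≤ b ^ n
^-mono zero    0≤a a≤b = ≤-refl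
^-mono (suc n) 0≤a a≤b = *-mono-≤ 0≤a (0≤^ n 0≤a) a≤b (^-mono n 0≤a a≤b)

1^ : ∀ n → 1ℚ ^ n ≡ 1ℚ
1^ zero    = refl
1^ (suc n) = trans (*-identityˡ (1ℚ ^ n)) (1^ n)

^≤1 : ∀ {a} n → 0ℚ ≤ a → a ≤ 1ℚ → a ^ n ≤ 1ℚ
^≤1 n 0≤a a≤1 = ≤-trans (^-mono n 0≤a a≤1) (≤-reflexive (1^ n))

1≤^ : ∀ {a} n → 1ℚ ≤ a → 1ℚ ≤ a ^ n
1≤^ n 1≤a = ≤-trans (≤-reflexive (sym (1^ n))) (^-mono n 0≤1 1≤a)

^-+ : ∀ a i j → a ^ (i ℕ.+ j) ≡ a ^ i * a ^ j
^-+ a zero    j = sym (*-identityˡ (a ^ j))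
^-+ a (suc i) j = trans (cong (a *_) (^-+ a i j)) (sym (*-assoc a (a ^ i) (a ^ j)))

^-distrib-* : ∀ a b n → (a * b) ^ n ≡ a ^ n * b ^ n
^-distrib-* a b zero    = refl
^-distrib-* a b (suc n) = trans (cong (a * b *_) (^-distrib-* a b n))
  (solve 4 (λ a b x y → a :* b :* (x :* y) := a :* x :* (b :* y)) refl a b (a ^ n) (b ^ n))

^-* : ∀ a i j → a ^ (i ℕ.* j) ≡ (a ^ i) ^ j
^-* a zero    j = sym (1^ j)
^-* a (suc i) j = trans (^-+ a j (i ℕ.* j)) (trans (cong (a ^ j *_) (^-* a i j)) (sym (^-distrib-* a (a ^ i) j)))

^-comm : ∀ a i j → (a ^ i) ^ j ≡ (a ^ j) ^ i
^-comm a i j = trans (sym (^-* a i j)) (trans (cong (a ^_) (ℕ.*-comm i j)) (^-* a j i))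

^-anti : ∀ {a i j} → 0ℚ ≤ a → a ≤ 1ℚ → i ℕ.≤ j → a ^ j ≤ a ^ i
^-anti {j = j} 0≤a a≤1 z≤n = ^≤1 j 0≤a a≤1
^-anti 0≤a a≤1 (s≤s i≤j) = *-monoˡ 0≤a (^-anti 0≤a a≤1 i≤j)

^-monoʳ : ∀ {a i j} → 1ℚ ≤ a → i ℕ.≤ j → a ^ i ≤ a ^ j
^-monoʳ {j = j} 1≤a z≤n = 1≤^ j 1≤a
^-monoʳ 1≤a (s≤s i≤j) = *-monoˡ (≤-trans 0≤1 1≤a) (^-monoʳ 1≤a i≤j)

^≤ : ∀ {a} n → 0ℚ ≤ a → a ≤ 1ℚ → 1 ℕ.≤ n → a ^ n ≤ a
^≤ {a} n 0≤a a≤1 1≤n = ≤-trans (^-anti 0≤a a≤1 1≤n) (≤-reflexive (*-identityʳ a))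

^-cancel-≤ : ∀ {a b} n → 0ℚ ≤ b → a ^ suc n ≤ b ^ suc n → a ≤ b
^-cancel-≤ {a} {b} n 0≤b p with a ℚ.≤? b
... | yes a≤b = a≤b
... | no  a≰b = ⊥-elim (<-irrefl refl (<-≤-trans (strict n) p))
  where
  b<a : b < a
  b<a = ≰⇒> a≰b
  strict : ∀ n → b ^ suc n < a ^ suc n
  strict zero    = subst₂ _<_ (sym (*-identityʳ b)) (sym (*-identityʳ a)) b<a
  strict (suc n) = ≤-<-trans (*-monoˡ 0≤b (<⇒≤ (strict n)))
    (subst₂ _<_ (*-comm (a ^ suc n) b) (*-comm (a ^ suc n) a) (*-monoˡ-< (0<^ (suc n) (≤-<-trans 0≤b b<a)) b<a))

0≤square : ∀ a → 0ℚ ≤ a * a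
0≤square a with ≤-total 0ℚ a
... | inj₁ 0≤a = 0≤*-pos 0≤a 0≤a
... | inj₂ a≤0 = subst (0ℚ ≤_) (solve 1 (λ a → (:- a) :* (:- a) := a :* a) refl a)
  (0≤*-pos (neg-antimono-≤ a≤0) (neg-antimono-≤ a≤0))

bernoulli : ∀ {x} n → 0ℚ ≤ 1ℚ + x → 1ℚ + ι n * x ≤ (1ℚ + x) ^ n
bernoulli {x} zero    0≤ = ≤-reflexive (trans (cong (1ℚ +_) (*-zeroˡ x)) (+-identityʳ 1ℚ))
bernoulli {x} (suc n) 0≤ = ≤-trans
  (≤-by (ι n * (x * x)) (0≤*-pos (0≤ι n) (0≤square x))
    (trans (solve 2 (λ x n → (con 1ℚ :+ x) :* (con 1ℚ :+ n :* x) := con 1ℚ :+ (con 1ℚ :+ n) :* x :+ n :* (x :* x)) refl x (ι n))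
      (cong (λ s → 1ℚ + s * x + ι n * (x * x)) (sym (ι-suc n)))))
  (*-monoˡ 0≤ (bernoulli n 0≤))

bernoulli⁻ : ∀ {x} n → x ≤ 1ℚ → 1ℚ - ι n * x ≤ (1ℚ - x) ^ n
bernoulli⁻ {x} n x≤1 = ≤-trans
  (≤-reflexive (cong (1ℚ +_) (neg-distribʳ-* (ι n) x)))
  (bernoulli n (≤⇒0≤- x≤1))

-- Finite sums

∑ : {A : Set} → List A → (A → ℚ) → ℚ
∑ []       f = 0ℚ
∑ (x ∷ xs) f = f x + ∑ xs f

𝟙 : {P : Set} → Dec P → ℚ
𝟙 P? = if does P? then 1ℚ else 0ℚ

module _ {P : Set} where

  𝟙-yes : (P? : Dec P) → P → 𝟙 P? ≡ 1ℚ
  𝟙-yes P? p = cong (if_then 1ℚ else 0ℚ) (dec-true P? p)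

  𝟙-no : (P? : Dec P) → ¬ P → 𝟙 P? ≡ 0ℚ
  𝟙-no P? ¬p = cong (if_then 1ℚ else 0ℚ) (dec-false P? ¬p)

  0≤𝟙 : (P? : Dec P) → 0ℚ ≤ 𝟙 P?
  0≤𝟙 (true  because _) = 0≤1
  0≤𝟙 (false because _) = ≤-refl

  𝟙≤1 : (P? : Dec P) → 𝟙 P? ≤ 1ℚ
  𝟙≤1 (true  because _) = ≤-refl
  𝟙≤1 (false because _) = 0≤1

  𝟙≤ : (P? : Dec P) {a : ℚ} → 0ℚ ≤ a → (P → 1ℚ ≤ a) → 𝟙 P? ≤ a
  𝟙≤ (yes p) 0≤a 1≤a = 1≤a p
  𝟙≤ (no _)  0≤a 1≤a = 0≤a

𝟙*-≤ : {P : Set} (P? : Dec P) {a b : ℚ} → 0ℚ ≤ b → (P → a ≤ b) → 𝟙 P? * a ≤ b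
𝟙*-≤ (yes p) {a} 0≤b a≤b = ≤-trans (≤-reflexive (*-identityˡ a)) (a≤b p)
𝟙*-≤ (no _)  {a} 0≤b a≤b = ≤-trans (≤-reflexive (*-zeroˡ a)) 0≤b

𝟙-⇔ : {P Q : Set} (P? : Dec P) (Q? : Dec Q) → (P → Q) → (Q → P) → 𝟙 P? ≡ 𝟙 Q?
𝟙-⇔ (yes p) Q? f g = sym (𝟙-yes Q? (f p))
𝟙-⇔ (no ¬p) Q? f g = sym (𝟙-no Q? (¬p ∘ g))

𝟙-¬ : {P : Set} (P? : Dec P) → 𝟙 P? + 𝟙 (¬? P?) ≡ 1ℚ
𝟙-¬ (yes _) = refl
𝟙-¬ (no _)  = refl

module _ {A : Set} where

  ∑-cong-∈ : (xs : List A) {f g : A → ℚ} → (∀ {x} → x ∈ˡ xs → f x ≡ g x) → ∑ xs f ≡ ∑ xs g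
  ∑-cong-∈ []       eq = refl
  ∑-cong-∈ (x ∷ xs) eq = cong₂ _+_ (eq (here refl)) (∑-cong-∈ xs (eq ∘ there))

  ∑-cong : (xs : List A) {f g : A → ℚ} → (∀ x → f x ≡ g x) → ∑ xs f ≡ ∑ xs g
  ∑-cong xs eq = ∑-cong-∈ xs λ {x} _ → eq x

  ∑-mono-∈ : (xs : List A) {f g : A → ℚ} → (∀ {x} → x ∈ˡ xs → f x ≤ g x) → ∑ xs f ≤ ∑ xs g
  ∑-mono-∈ []       f≤g = ≤-refl
  ∑-mono-∈ (x ∷ xs) f≤g = +-mono-≤ (f≤g (here refl)) (∑-mono-∈ xs (f≤g ∘ there))

  ∑-mono : (xs : List A) {f g : A → ℚ} → (∀ x → f x ≤ g x) → ∑ xs f ≤ ∑ xs g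
  ∑-mono xs f≤g = ∑-mono-∈ xs λ {x} _ → f≤g x

  ∑-0 : (xs : List A) → ∑ xs (λ _ → 0ℚ) ≡ 0ℚ
  ∑-0 []       = refl
  ∑-0 (x ∷ xs) = trans (+-identityˡ _) (∑-0 xs)

  0≤∑ : (xs : List A) {f : A → ℚ} → (∀ x → 0ℚ ≤ f x) → 0ℚ ≤ ∑ xs f
  0≤∑ xs 0≤f = ≤-trans (≤-reflexive (sym (∑-0 xs))) (∑-mono xs 0≤f)

  ∑-+ : (xs : List A) (f g : A → ℚ) → ∑ xs (λ x → f x + g x) ≡ ∑ xs f + ∑ xs g
  ∑-+ []       f g = refl
  ∑-+ (x ∷ xs) f g = trans (cong (f x + g x +_) (∑-+ xs f g))
    (solve 4 (λ a b c d → a :+ b :+ (c :+ d) := a :+ c :+ (b :+ d)) refl (f x) (g x) (∑ xs f) (∑ xs g))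

  ∑-*ˡ : (xs : List A) (c : ℚ) (f : A → ℚ) → ∑ xs (λ x → c * f x) ≡ c * ∑ xs f
  ∑-*ˡ []       c f = sym (*-zeroʳ c)
  ∑-*ˡ (x ∷ xs) c f = trans (cong (c * f x +_) (∑-*ˡ xs c f)) (sym (*-distribˡ-+ c (f x) (∑ xs f)))

  ∑-*ʳ : (xs : List A) (f : A → ℚ) (c : ℚ) → ∑ xs (λ x → f x * c) ≡ ∑ xs f * c
  ∑-*ʳ xs f c = trans (∑-cong xs λ x → *-comm (f x) c) (trans (∑-*ˡ xs c f) (*-comm c (∑ xs f)))

  ∑-const : (xs : List A) (c : ℚ) → ∑ xs (λ _ → c) ≡ ι (length xs) * c
  ∑-const []       c = sym (*-zeroˡ c)
  ∑-const (x ∷ xs) c = trans (cong (c +_) (∑-const xs c))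
    (trans (solve 2 (λ c l → c :+ l :* c := (con 1ℚ :+ l) :* c) refl c (ι (length xs)))
      (cong (_* c) (sym (ι-suc (length xs)))))

  ∑-1 : (xs : List A) → ∑ xs (λ _ → 1ℚ) ≡ ι (length xs)
  ∑-1 xs = trans (∑-const xs 1ℚ) (*-identityʳ _)

  ∑-++ : (xs ys : List A) (f : A → ℚ) → ∑ (xs ++ ys) f ≡ ∑ xs f + ∑ ys f
  ∑-++ []       ys f = sym (+-identityˡ _)
  ∑-++ (x ∷ xs) ys f = trans (cong (f x +_) (∑-++ xs ys f)) (sym (+-assoc (f x) (∑ xs f) (∑ ys f)))

  ∑-∈ : (xs : List A) {f : A → ℚ} → (∀ x → 0ℚ ≤ f x) → ∀ {x} → x ∈ˡ xs → f x ≤ ∑ xs f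
  ∑-∈ (x ∷ xs) 0≤f (here refl) = a≤a+b (0≤∑ xs 0≤f)
  ∑-∈ (x ∷ xs) {f} 0≤f (there i)  = ≤-trans (∑-∈ xs 0≤f i)
    (≤-by (f x) (0≤f x) (+-comm (f x) _))

  ∑-filter : {P : A → Set} (P? : Decidable₁ P) (xs : List A) (f : A → ℚ) →
    ∑ (filter P? xs) f ≡ ∑ xs (λ x → 𝟙 (P? x) * f x)
  ∑-filter P? []       f = refl
  ∑-filter P? (x ∷ xs) f with does (P? x)
  ... | true  = cong₂ _+_ (sym (*-identityˡ (f x))) (∑-filter P? xs f)
  ... | false = trans (∑-filter P? xs f) (sym (trans (cong (_+ _) (*-zeroˡ (f x))) (+-identityˡ _)))

  length-filter : {P : A → Set} (P? : Decidable₁ P) (xs : List A) →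
    ι (length (filter P? xs)) ≡ ∑ xs (λ x → 𝟙 (P? x))
  length-filter P? xs = trans (sym (∑-1 (filter P? xs)))
    (trans (∑-filter P? xs _) (∑-cong xs λ x → *-identityʳ _))

∑-map : {A B : Set} (g : A → B) (xs : List A) (f : B → ℚ) → ∑ (map g xs) f ≡ ∑ xs (f ∘ g)
∑-map g []       f = refl
∑-map g (x ∷ xs) f = cong (f (g x) +_) (∑-map g xs f)

∑-swap : {A B : Set} (xs : List A) (ys : List B) (f : A → B → ℚ) →
  ∑ xs (λ x → ∑ ys (f x)) ≡ ∑ ys (λ y → ∑ xs (λ x → f x y))
∑-swap []       ys f = sym (∑-0 ys)
∑-swap (x ∷ xs) ys f = trans (cong (∑ ys (f x) +_) (∑-swap xs ys f)) (sym (∑-+ ys (f x) _))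

∑-vectors : {A : Set} (n : ℕ) (xs : List A) (f : Vec A (suc n) → ℚ) →
  ∑ (vectors (suc n) xs) f ≡ ∑ xs (λ x → ∑ (vectors n xs) (λ v → f (x ∷ v)))
∑-vectors n xs f = go xs
  where
  go : ∀ ys → ∑ (cartesianProductWith _∷_ ys (vectors n xs)) f ≡ ∑ ys (λ x → ∑ (vectors n xs) (λ v → f (x ∷ v)))
  go []       = refl
  go (y ∷ ys) = trans (∑-++ (map (y ∷_) (vectors n xs)) _ f)
    (cong₂ _+_ (∑-map (y ∷_) (vectors n xs) f) (go ys))

length-vectors : {A : Set} (n : ℕ) (xs : List A) → ι (length (vectors n xs)) ≡ ι (length xs) ^ n
length-vectors zero    xs = refl
length-vectors (suc n) xs = begin
  ι (length (vectors (suc n) xs))      ≡⟨ sym (∑-1 (vectors (suc n) xs)) ⟩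
  ∑ (vectors (suc n) xs) (λ _ → 1ℚ)        ≡⟨ ∑-vectors n xs _ ⟩
  ∑ xs (λ _ → ∑ (vectors n xs) (λ _ → 1ℚ)) ≡⟨ ∑-const xs _ ⟩
  ι (length xs) * ∑ (vectors n xs) (λ _ → 1ℚ) ≡⟨ cong (ι (length xs) *_) (trans (∑-1 (vectors n xs)) (length-vectors n xs)) ⟩
  ι (length xs) * ι (length xs) ^ n ∎
  where open ≡-Reasoning

-- Sums over subsets, binomial coefficients

∑-subsets : ∀ m (f : Subset (suc m) → ℚ) →
  ∑ (subsets (suc m)) f ≡ ∑ (subsets m) (λ S → f (outside ∷ S)) + ∑ (subsets m) (λ S → f (inside ∷ S))
∑-subsets m f = trans (∑-++ (map (outside ∷_) (subsets m)) _ f)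
  (cong₂ _+_ (∑-map (outside ∷_) (subsets m) f) (∑-map (inside ∷_) (subsets m) f))

-- The binomial theorem with the sum taken over the subsets themselves: an element contributes 1 if
-- left out and g if taken.
∑-subsets-^ : ∀ m g → ∑ (subsets m) (λ S → g ^ ∣ S ∣) ≡ (1ℚ + g) ^ m
∑-subsets-^ zero    g = refl
∑-subsets-^ (suc m) g = trans (∑-subsets m _)
  (trans (cong₂ _+_ (∑-subsets-^ m g) (trans (∑-*ˡ (subsets m) g _) (cong (g *_) (∑-subsets-^ m g))))
    (solve 2 (λ g x → x :+ g :* x := (con 1ℚ :+ g) :* x) refl g ((1ℚ + g) ^ m)))

private
  sized : ∀ m k (f : Subset m → ℚ) →
    ∑ (subsetsOfSize m k) f ≡ ∑ (subsets m) (λ S → 𝟙 (∣ S ∣ ℕ.≟ k) * f S)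
  sized m k f = ∑-filter (λ S → ∣ S ∣ ℕ.≟ k) (subsets m) f

∑-subsetsOfSize-0 : ∀ m (f : Subset (suc m) → ℚ) →
  ∑ (subsetsOfSize (suc m) 0) f ≡ ∑ (subsetsOfSize m 0) (λ S → f (outside ∷ S))
∑-subsetsOfSize-0 m f = begin
  ∑ (subsetsOfSize (suc m) 0) f ≡⟨ sized (suc m) 0 f ⟩
  ∑ (subsets (suc m)) (λ S → 𝟙 (∣ S ∣ ℕ.≟ 0) * f S) ≡⟨ ∑-subsets m _ ⟩
  ∑ (subsets m) (λ S → 𝟙 (∣ S ∣ ℕ.≟ 0) * f (outside ∷ S)) + ∑ (subsets m) (λ S → 0ℚ * f (inside ∷ S))
    ≡⟨ cong₂ _+_ (sym (sized m 0 _)) (trans (∑-cong (subsets m) λ S → *-zeroˡ (f (inside ∷ S))) (∑-0 (subsets m))) ⟩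
  ∑ (subsetsOfSize m 0) (λ S → f (outside ∷ S)) + 0ℚ ≡⟨ +-identityʳ _ ⟩
  ∑ (subsetsOfSize m 0) (λ S → f (outside ∷ S)) ∎
  where open ≡-Reasoning

∑-subsetsOfSize-suc : ∀ m k (f : Subset (suc m) → ℚ) →
  ∑ (subsetsOfSize (suc m) (suc k)) f ≡
  ∑ (subsetsOfSize m (suc k)) (λ S → f (outside ∷ S)) + ∑ (subsetsOfSize m k) (λ S → f (inside ∷ S))
∑-subsetsOfSize-suc m k f = begin
  ∑ (subsetsOfSize (suc m) (suc k)) f ≡⟨ sized (suc m) (suc k) f ⟩
  ∑ (subsets (suc m)) (λ S → 𝟙 (∣ S ∣ ℕ.≟ suc k) * f S) ≡⟨ ∑-subsets m _ ⟩
  ∑ (subsets m) (λ S → 𝟙 (∣ S ∣ ℕ.≟ suc k) * f (outside ∷ S)) + ∑ (subsets m) (λ S → 𝟙 (∣ S ∣ ℕ.≟ k) * f (inside ∷ S))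
    ≡⟨ cong₂ _+_ (sym (sized m (suc k) _)) (sym (sized m k _)) ⟩
  ∑ (subsetsOfSize m (suc k)) (λ S → f (outside ∷ S)) + ∑ (subsetsOfSize m k) (λ S → f (inside ∷ S)) ∎
  where open ≡-Reasoning

-- A list length, so that it is by definition the number of choices of one vertex; rational, because
-- it is inverted later on.
binom : ℕ → ℕ → ℚ
binom m k = ι (length (subsetsOfSize m k))

0≤binom : ∀ m k → 0ℚ ≤ binom m k
0≤binom m k = 0≤ι (length (subsetsOfSize m k))

binom-0 : ∀ m → binom m 0 ≡ 1ℚ
binom-0 zero    = refl
binom-0 (suc m) = trans (sym (∑-1 (subsetsOfSize (suc m) 0)))
  (trans (∑-subsetsOfSize-0 m _) (trans (∑-1 (subsetsOfSize m 0)) (binom-0 m)))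

pascal : ∀ m k → binom (suc m) (suc k) ≡ binom m (suc k) + binom m k
pascal m k = trans (sym (∑-1 (subsetsOfSize (suc m) (suc k))))
  (trans (∑-subsetsOfSize-suc m k _) (cong₂ _+_ (∑-1 (subsetsOfSize m (suc k))) (∑-1 (subsetsOfSize m k))))

-- The difference is taken in ℚ, so that no assumption k ≤ m is needed: both sides vanish for k ≥ m.
-- All later comparisons of binomial coefficients are inductions on k with this recursion.
binom-absorb : ∀ m k → ι (suc k) * binom m (suc k) ≡ (ι m - ι k) * binom m k
binom-absorb zero zero    = refl
binom-absorb zero (suc k) = trans (*-zeroʳ (ι (suc (suc k)))) (sym (*-zeroʳ (ι 0 - ι (suc k))))
binom-absorb (suc m) zero = begin
  ι 1 * binom (suc m) 1 ≡⟨ cong (ι 1 *_) (pascal m 0) ⟩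
  ι 1 * (binom m 1 + binom m 0) ≡⟨ *-distribˡ-+ (ι 1) (binom m 1) (binom m 0) ⟩
  ι 1 * binom m 1 + ι 1 * binom m 0 ≡⟨ cong₂ (λ s t → s + ι 1 * t) (binom-absorb m 0) (binom-0 m) ⟩
  (ι m - ι 0) * binom m 0 + ι 1 * 1ℚ ≡⟨ cong (λ s → (ι m - ι 0) * s + ι 1 * 1ℚ) (binom-0 m) ⟩
  (ι m - ι 0) * 1ℚ + ι 1 * 1ℚ
    ≡⟨ solve 1 (λ m → (m :- con (ι 0)) :* con 1ℚ :+ con (ι 1) :* con 1ℚ := (con 1ℚ :+ m :- con (ι 0)) :* con 1ℚ) refl (ι m) ⟩
  (1ℚ + ι m - ι 0) * 1ℚ ≡⟨ cong₂ (λ s t → (s - ι 0) * t) (sym (ι-suc m)) (sym (binom-0 (suc m))) ⟩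
  (ι (suc m) - ι 0) * binom (suc m) 0 ∎
  where open ≡-Reasoning
binom-absorb (suc m) (suc k) = begin
  ι (suc (suc k)) * binom (suc m) (suc (suc k)) ≡⟨ cong (ι (suc (suc k)) *_) (pascal m (suc k)) ⟩
  ι (suc (suc k)) * (b₂ + b₁) ≡⟨ *-distribˡ-+ (ι (suc (suc k))) b₂ b₁ ⟩
  ι (suc (suc k)) * b₂ + ι (suc (suc k)) * b₁ ≡⟨ cong₂ (λ s t → s + t * b₁) (binom-absorb m (suc k)) (ι-suc (suc k)) ⟩
  (M - K) * b₁ + (1ℚ + K) * b₁ ≡⟨ solve 3 (λ m k b → (m :- k) :* b :+ (con 1ℚ :+ k) :* b := (con 1ℚ :+ m :- k) :* b :+ k :* b) refl M K b₁ ⟩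
  (1ℚ + M - K) * b₁ + K * b₁ ≡⟨ cong ((1ℚ + M - K) * b₁ +_) (binom-absorb m k) ⟩
  (1ℚ + M - K) * b₁ + (M - ι k) * b₀ ≡⟨ cong ((1ℚ + M - K) * b₁ +_) (cong (_* b₀) (trans
      (solve 2 (λ m k → m :- k := con 1ℚ :+ m :- (con 1ℚ :+ k)) refl M (ι k)) (cong (λ s → 1ℚ + M - s) (sym (ι-suc k))))) ⟩
  (1ℚ + M - K) * b₁ + (1ℚ + M - K) * b₀ ≡⟨ sym (*-distribˡ-+ (1ℚ + M - K) b₁ b₀) ⟩
  (1ℚ + M - K) * (b₁ + b₀) ≡⟨ cong₂ (λ s t → (s - K) * t) (sym (ι-suc m)) (sym (pascal m k)) ⟩
  (ι (suc m) - K) * binom (suc m) (suc k) ∎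
  where
  open ≡-Reasoning
  M = ι m
  K = ι (suc k)
  b₂ = binom m (suc (suc k))
  b₁ = binom m (suc k)
  b₀ = binom m k

0<binom : ∀ {m k} → k ℕ.≤ m → 0ℚ < binom m k
0<binom {m} z≤n = <-≤-trans 0<1 (≤-reflexive (sym (binom-0 m)))
0<binom {suc m} {suc k} (s≤s k≤m) = <-≤-trans (0<binom k≤m)
  (≤-by (binom m (suc k)) (0≤binom m (suc k)) (trans (pascal m k) (+-comm (binom m (suc k)) (binom m k))))

disjoint? : ∀ {m} (V A : Subset m) → Dec (Empty (V ∩ A))
disjoint? V A = ¬? (nonempty? (V ∩ A))

∑-disjoint : ∀ {m} k (V : Subset m) → ∑ (subsetsOfSize m k) (λ A → 𝟙 (disjoint? V A)) ≡ binom (m ℕ.∸ ∣ V ∣) k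
∑-disjoint zero    [] = refl
∑-disjoint (suc k) [] = refl
∑-disjoint {suc m} zero (s ∷ V) = begin
  ∑ (subsetsOfSize (suc m) 0) (λ A → 𝟙 (disjoint? (s ∷ V) A)) ≡⟨ ∑-subsetsOfSize-0 m _ ⟩
  ∑ (subsetsOfSize m 0) (λ A → 𝟙 (disjoint? (s ∷ V) (outside ∷ A))) ≡⟨ ∑-cong (subsetsOfSize m 0) (out s) ⟩
  ∑ (subsetsOfSize m 0) (λ A → 𝟙 (disjoint? V A)) ≡⟨ ∑-disjoint 0 V ⟩
  binom (m ℕ.∸ ∣ V ∣) 0 ≡⟨ trans (binom-0 (m ℕ.∸ ∣ V ∣)) (sym (binom-0 (suc m ℕ.∸ ∣ s ∷ V ∣))) ⟩
  binom (suc m ℕ.∸ ∣ s ∷ V ∣) 0 ∎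
  where
  open ≡-Reasoning
  push : ∀ {p : Subset m} → Empty p → Empty (outside ∷ p)
  push e (suc x , there i) = e (x , i)
  out : ∀ s A → 𝟙 (disjoint? (s ∷ V) (outside ∷ A)) ≡ 𝟙 (disjoint? V A)
  out inside  A = 𝟙-⇔ (disjoint? (inside ∷ V) (outside ∷ A)) (disjoint? V A) drop-∷-Empty push
  out outside A = 𝟙-⇔ (disjoint? (outside ∷ V) (outside ∷ A)) (disjoint? V A) drop-∷-Empty push
∑-disjoint {suc m} (suc k) (s ∷ V) = trans (∑-subsetsOfSize-suc m k _)
  (trans (cong₂ _+_ (trans (∑-cong (subsetsOfSize m (suc k)) (out s)) (∑-disjoint (suc k) V)) refl) (second s))
  where
  push : ∀ {p : Subset m} → Empty p → Empty (outside ∷ p)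
  push e (suc x , there i) = e (x , i)
  out : ∀ s A → 𝟙 (disjoint? (s ∷ V) (outside ∷ A)) ≡ 𝟙 (disjoint? V A)
  out inside  A = 𝟙-⇔ (disjoint? (inside ∷ V) (outside ∷ A)) (disjoint? V A) drop-∷-Empty push
  out outside A = 𝟙-⇔ (disjoint? (outside ∷ V) (outside ∷ A)) (disjoint? V A) drop-∷-Empty push
  second : ∀ s → binom (m ℕ.∸ ∣ V ∣) (suc k) + ∑ (subsetsOfSize m k) (λ A → 𝟙 (disjoint? (s ∷ V) (inside ∷ A))) ≡
    binom (suc m ℕ.∸ ∣ s ∷ V ∣) (suc k)
  second inside = trans (cong (binom (m ℕ.∸ ∣ V ∣) (suc k) +_)
    (trans (∑-cong (subsetsOfSize m k) λ A → 𝟙-no (disjoint? (inside ∷ V) (inside ∷ A)) λ e → e (zero , here))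
      (∑-0 (subsetsOfSize m k)))) (+-identityʳ _)
  second outside = begin
    binom (m ℕ.∸ ∣ V ∣) (suc k) + ∑ (subsetsOfSize m k) (λ A → 𝟙 (disjoint? (outside ∷ V) (inside ∷ A)))
      ≡⟨ cong (binom (m ℕ.∸ ∣ V ∣) (suc k) +_) (trans (∑-cong (subsetsOfSize m k) λ A →
           𝟙-⇔ (disjoint? (outside ∷ V) (inside ∷ A)) (disjoint? V A) drop-∷-Empty push) (∑-disjoint k V)) ⟩
    binom (m ℕ.∸ ∣ V ∣) (suc k) + binom (m ℕ.∸ ∣ V ∣) k ≡⟨ sym (pascal (m ℕ.∸ ∣ V ∣) k) ⟩
    binom (suc (m ℕ.∸ ∣ V ∣)) (suc k) ≡⟨ cong (λ s → binom s (suc k)) (sym (ℕ.+-∸-assoc 1 (∣p∣≤n V))) ⟩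
    binom (suc m ℕ.∸ ∣ V ∣) (suc k) ∎
    where open ≡-Reasoning

-- The quotient of the two coefficients is the product of (a - i)/(m - i) over i < k, and each
-- factor is at most a/m because a ≤ m. Here r stands for 1/m.
binom-≤-^ : ∀ {m r} → ι m * r ≡ 1ℚ → 0ℚ ≤ r → ∀ a k → a ℕ.≤ m → k ℕ.≤ m →
  binom a k ≤ (ι a * r) ^ k * binom m k
binom-≤-^ {m} {r} mr≡1 0≤r a zero a≤m _ = ≤-reflexive (trans (binom-0 a) (trans (sym (binom-0 m)) (sym (*-identityˡ (binom m 0)))))
binom-≤-^ {m} {r} mr≡1 0≤r a (suc k) a≤m k<m = *-cancelˡ-≤ (ι-mono-< {0} {suc k} (s≤s z≤n)) (begin
  ι (suc k) * binom a (suc k) ≡⟨ binom-absorb a k ⟩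
  (A - K) * binom a k ≤⟨ *-monoʳ (0≤binom a k) A-K≤ ⟩
  A * r * (M - K) * binom a k ≤⟨ *-monoˡ 0≤c (binom-≤-^ mr≡1 0≤r a k a≤m (ℕ.<⇒≤ k<m)) ⟩
  A * r * (M - K) * ((A * r) ^ k * binom m k)
    ≡⟨ solve 4 (λ s t u b → s :* t :* (u :* b) := s :* u :* (t :* b)) refl (A * r) (M - K) ((A * r) ^ k) (binom m k) ⟩
  (A * r) ^ suc k * ((M - K) * binom m k) ≡⟨ cong ((A * r) ^ suc k *_) (sym (binom-absorb m k)) ⟩
  (A * r) ^ suc k * (ι (suc k) * binom m (suc k))
    ≡⟨ solve 3 (λ s t u → s :* (t :* u) := t :* (s :* u)) refl ((A * r) ^ suc k) (ι (suc k)) (binom m (suc k)) ⟩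
  ι (suc k) * ((A * r) ^ suc k * binom m (suc k)) ∎)
  where
  open ≤-Reasoning
  A = ι a
  M = ι m
  K = ι k
  Ar≤1 : A * r ≤ 1ℚ
  Ar≤1 = ≤-trans (*-monoʳ 0≤r (ι-mono-≤ a≤m)) (≤-reflexive mr≡1)
  0≤c : 0ℚ ≤ A * r * (M - K)
  0≤c = 0≤*-pos (0≤*-pos (0≤ι a) 0≤r) (≤⇒0≤- (ι-mono-≤ (ℕ.<⇒≤ k<m)))
  A-K≤ : A - K ≤ A * r * (M - K)
  A-K≤ = ≤-by (K * (1ℚ - A * r)) (0≤*-pos (0≤ι k) (≤⇒0≤- Ar≤1)) (begin-equality
    A * r * (M - K) ≡⟨ solve 4 (λ a r m k → a :* r :* (m :- k) := a :* (m :* r) :- a :* r :* k) refl A r M K ⟩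
    A * (M * r) - A * r * K ≡⟨ cong (λ s → A * s - A * r * K) mr≡1 ⟩
    A * 1ℚ - A * r * K ≡⟨ solve 3 (λ a r k → a :* con 1ℚ :- a :* r :* k := a :- k :+ k :* (con 1ℚ :- a :* r)) refl A r K ⟩
    A - K + K * (1ℚ - A * r) ∎)

-- The generating function of the size of V ∪ A for a random k-set A

unionSum : ∀ {m} → ℚ → ℕ → Subset m → ℚ
unionSum {m} y k V = ∑ (subsetsOfSize m k) (λ A → y ^ ∣ V ∪ A ∣)

module _ {y : ℚ} (0≤y : 0ℚ ≤ y) where

  private
    0≤unionSum : ∀ {m} k (V : Subset m) → 0ℚ ≤ unionSum y k V
    0≤unionSum {m} k V = 0≤∑ (subsetsOfSize m k) λ A → 0≤^ ∣ V ∪ A ∣ 0≤y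

    unionSum-0 : ∀ {m} (V : Subset m) → unionSum y 0 V ≡ y ^ ∣ V ∣
    unionSum-0 []            = refl
    unionSum-0 {suc m} (outside ∷ V) = trans (∑-subsetsOfSize-0 m _) (unionSum-0 V)
    unionSum-0 {suc m} (inside ∷ V) = trans (∑-subsetsOfSize-0 m _)
      (trans (∑-*ˡ (subsetsOfSize m 0) y _) (cong (y *_) (unionSum-0 V)))

    unionSum-outside : ∀ {m} k (V : Subset m) → unionSum y (suc k) (outside ∷ V) ≡ unionSum y (suc k) V + y * unionSum y k V
    unionSum-outside {m} k V = trans (∑-subsetsOfSize-suc m k _)
      (cong (unionSum y (suc k) V +_) (∑-*ˡ (subsetsOfSize m k) y _))

    unionSum-inside : ∀ {m} k (V : Subset m) → unionSum y (suc k) (inside ∷ V) ≡ y * (unionSum y (suc k) V + unionSum y k V)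
    unionSum-inside {m} k V = trans (∑-subsetsOfSize-suc m k _)
      (trans (cong₂ _+_ (∑-*ˡ (subsetsOfSize m (suc k)) y _) (∑-*ˡ (subsetsOfSize m k) y _))
        (sym (*-distribˡ-+ y (unionSum y (suc k) V) (unionSum y k V))))

    -- A bound for the total weight outside a k-set: there are m - k colours, each counted with y,
    -- and those in V weigh at most 1 more.
    coeff : ∀ {m} → ℕ → Subset m → ℚ
    coeff {m} k V = (ι m - ι k) * y + ι ∣ V ∣

    coeff-out : ∀ {m} k (V : Subset m) → coeff k (outside ∷ V) ≡ coeff k V + y
    coeff-out {m} k V = trans (cong (λ s → (s - ι k) * y + ι ∣ V ∣) (ι-suc m))
      (solve 4 (λ m k y v → (con 1ℚ :+ m :- k) :* y :+ v := (m :- k) :* y :+ v :+ y) refl (ι m) (ι k) y (ι ∣ V ∣))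

    coeff-in : ∀ {m} k (V : Subset m) → coeff k (inside ∷ V) ≡ coeff k V + 1ℚ + y
    coeff-in {m} k V = trans (cong₂ (λ s t → (s - ι k) * y + t) (ι-suc m) (ι-suc ∣ V ∣))
      (solve 4 (λ m k y v → (con 1ℚ :+ m :- k) :* y :+ (con 1ℚ :+ v) := (m :- k) :* y :+ v :+ con 1ℚ :+ y) refl (ι m) (ι k) y (ι ∣ V ∣))

    coeff-suc : ∀ {m} k (V : Subset m) → coeff k V ≡ coeff (suc k) V + y
    coeff-suc {m} k V = trans
      (solve 4 (λ m k y v → (m :- k) :* y :+ v := (m :- (con 1ℚ :+ k)) :* y :+ v :+ y) refl (ι m) (ι k) y (ι ∣ V ∣))
      (cong (λ s → (ι m - s) * y + ι ∣ V ∣ + y) (sym (ι-suc k)))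

  -- An analogue of the identity (k+1) e_{k+1} = Σ_{|B| = k} w_B Σ_{a ∉ B} w_a
  -- for elementary symmetric functions, with weight 1 on V and y elsewhere.
  unionSum-step : ∀ {m} k (V : Subset m) →
    ι (suc k) * unionSum y (suc k) V ≤ ((ι m - ι k) * y + ι ∣ V ∣) * unionSum y k V
  unionSum-step zero [] = ≤-reflexive
    (solve 1 (λ y → con (ι 1) :* con 0ℚ := (con (ι 0 - ι 0) :* y :+ con (ι 0)) :* con (1ℚ + 0ℚ)) refl y)
  unionSum-step (suc k) [] = ≤-reflexive (trans (*-zeroʳ (ι (suc (suc k)))) (sym (*-zeroʳ (coeff (suc k) []))))
  unionSum-step {suc m} zero (outside ∷ V) = begin
    ι 1 * unionSum y 1 (outside ∷ V) ≡⟨ cong (ι 1 *_) (unionSum-outside 0 V) ⟩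
    ι 1 * (e₁ + y * e₀) ≡⟨ solve 3 (λ e₁ e₀ y → con (ι 1) :* (e₁ :+ y :* e₀) := con (ι 1) :* e₁ :+ y :* e₀) refl e₁ e₀ y ⟩
    ι 1 * e₁ + y * e₀ ≤⟨ +-monoˡ-≤ (y * e₀) (unionSum-step 0 V) ⟩
    coeff 0 V * e₀ + y * e₀ ≡⟨ sym (*-distribʳ-+ e₀ (coeff 0 V) y) ⟩
    (coeff 0 V + y) * e₀ ≡⟨ cong₂ _*_ (sym (coeff-out 0 V)) (trans (unionSum-0 V) (sym (unionSum-0 (outside ∷ V)))) ⟩
    coeff 0 (outside ∷ V) * unionSum y 0 (outside ∷ V) ∎
    where
    open ≤-Reasoning
    e₁ = unionSum y 1 V
    e₀ = unionSum y 0 V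
  unionSum-step {suc m} zero (inside ∷ V) = begin
    ι 1 * unionSum y 1 (inside ∷ V) ≡⟨ cong (ι 1 *_) (unionSum-inside 0 V) ⟩
    ι 1 * (y * (e₁ + e₀)) ≡⟨ solve 3 (λ e₁ e₀ y → con (ι 1) :* (y :* (e₁ :+ e₀)) := y :* (con (ι 1) :* e₁ :+ e₀)) refl e₁ e₀ y ⟩
    y * (ι 1 * e₁ + e₀) ≤⟨ *-monoˡ 0≤y (+-monoˡ-≤ e₀ (unionSum-step 0 V)) ⟩
    y * (coeff 0 V * e₀ + e₀) ≤⟨ ≤-by (y * (y * e₀)) (0≤*-pos 0≤y (0≤*-pos 0≤y (0≤unionSum 0 V)))
      (solve 3 (λ c e y → (c :+ con 1ℚ :+ y) :* (y :* e) := y :* (c :* e :+ e) :+ y :* (y :* e)) refl (coeff 0 V) e₀ y) ⟩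
    (coeff 0 V + 1ℚ + y) * (y * e₀)
      ≡⟨ cong₂ _*_ (sym (coeff-in 0 V)) (trans (cong (y *_) (unionSum-0 V)) (sym (unionSum-0 (inside ∷ V)))) ⟩
    coeff 0 (inside ∷ V) * unionSum y 0 (inside ∷ V) ∎
    where
    open ≤-Reasoning
    e₁ = unionSum y 1 V
    e₀ = unionSum y 0 V
  unionSum-step {suc m} (suc k) (outside ∷ V) = begin
    ι (suc (suc k)) * unionSum y (suc (suc k)) (outside ∷ V) ≡⟨ cong (ι (suc (suc k)) *_) (unionSum-outside (suc k) V) ⟩
    K₂ * (e₂ + y * e₁) ≡⟨ trans (*-distribˡ-+ K₂ e₂ (y * e₁)) (cong (λ s → K₂ * e₂ + s * (y * e₁)) (ι-suc (suc k))) ⟩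
    K₂ * e₂ + (1ℚ + K₁) * (y * e₁)
      ≡⟨ solve 5 (λ a e₂ b e₁ y → a :* e₂ :+ (con 1ℚ :+ b) :* (y :* e₁) := a :* e₂ :+ y :* e₁ :+ y :* (b :* e₁)) refl K₂ e₂ K₁ e₁ y ⟩
    K₂ * e₂ + y * e₁ + y * (K₁ * e₁) ≤⟨ +-mono-≤ (+-monoˡ-≤ (y * e₁) (unionSum-step (suc k) V)) (*-monoˡ 0≤y (unionSum-step k V)) ⟩
    coeff (suc k) V * e₁ + y * e₁ + y * (coeff k V * e₀) ≡⟨ cong (λ s → coeff (suc k) V * e₁ + y * e₁ + y * (s * e₀)) (coeff-suc k V) ⟩
    coeff (suc k) V * e₁ + y * e₁ + y * ((coeff (suc k) V + y) * e₀)
      ≡⟨ solve 4 (λ c e₁ e₀ y → c :* e₁ :+ y :* e₁ :+ y :* ((c :+ y) :* e₀) := (c :+ y) :* (e₁ :+ y :* e₀)) refl (coeff (suc k) V) e₁ e₀ y ⟩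
    (coeff (suc k) V + y) * (e₁ + y * e₀) ≡⟨ cong₂ _*_ (sym (coeff-out (suc k) V)) (sym (unionSum-outside k V)) ⟩
    coeff (suc k) (outside ∷ V) * unionSum y (suc k) (outside ∷ V) ∎
    where
    open ≤-Reasoning
    K₂ = ι (suc (suc k))
    K₁ = ι (suc k)
    e₂ = unionSum y (suc (suc k)) V
    e₁ = unionSum y (suc k) V
    e₀ = unionSum y k V
  unionSum-step {suc m} (suc k) (inside ∷ V) = begin
    ι (suc (suc k)) * unionSum y (suc (suc k)) (inside ∷ V) ≡⟨ cong (ι (suc (suc k)) *_) (unionSum-inside (suc k) V) ⟩
    K₂ * (y * (e₂ + e₁)) ≡⟨ solve 4 (λ a e₂ e₁ y → a :* (y :* (e₂ :+ e₁)) := y :* (a :* e₂ :+ a :* e₁)) refl K₂ e₂ e₁ y ⟩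
    y * (K₂ * e₂ + K₂ * e₁) ≡⟨ cong (λ s → y * (K₂ * e₂ + s * e₁)) (ι-suc (suc k)) ⟩
    y * (K₂ * e₂ + (1ℚ + K₁) * e₁)
      ≡⟨ solve 5 (λ a e₂ b e₁ y → y :* (a :* e₂ :+ (con 1ℚ :+ b) :* e₁) := y :* (a :* e₂ :+ e₁ :+ b :* e₁)) refl K₂ e₂ K₁ e₁ y ⟩
    y * (K₂ * e₂ + e₁ + K₁ * e₁) ≤⟨ *-monoˡ 0≤y (+-mono-≤ (+-monoˡ-≤ e₁ (unionSum-step (suc k) V)) (unionSum-step k V)) ⟩
    y * (coeff (suc k) V * e₁ + e₁ + coeff k V * e₀) ≡⟨ cong (λ s → y * (coeff (suc k) V * e₁ + e₁ + s * e₀)) (coeff-suc k V) ⟩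
    y * (coeff (suc k) V * e₁ + e₁ + (coeff (suc k) V + y) * e₀)
      ≤⟨ ≤-by (y * (y * e₁ + e₀)) (0≤*-pos 0≤y (0≤+ (0≤*-pos 0≤y (0≤unionSum (suc k) V)) (0≤unionSum k V)))
        (solve 4 (λ c e₁ e₀ y → (c :+ con 1ℚ :+ y) :* (y :* (e₁ :+ e₀)) := y :* (c :* e₁ :+ e₁ :+ (c :+ y) :* e₀) :+ y :* (y :* e₁ :+ e₀)) refl (coeff (suc k) V) e₁ e₀ y) ⟩
    (coeff (suc k) V + 1ℚ + y) * (y * (e₁ + e₀)) ≡⟨ cong₂ _*_ (sym (coeff-in (suc k) V)) (sym (unionSum-inside k V)) ⟩
    coeff (suc k) (inside ∷ V) * unionSum y (suc k) (inside ∷ V) ∎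
    where
    open ≤-Reasoning
    K₂ = ι (suc (suc k))
    K₁ = ι (suc k)
    e₂ = unionSum y (suc (suc k)) V
    e₁ = unionSum y (suc k) V
    e₀ = unionSum y k V

  -- While at most half of the colours are used up, m - k is at least m/2, so the summand ∣V∣ of the
  -- step coefficient is at most (m - k) · 2∣V∣/m. Each colour of A then costs at most y + 2∣V∣/m ≤
  -- g, and the remaining factors multiply up to the binomial coefficient.
  unionSum-≤ : ∀ {m r} → ι m * r ≡ 1ℚ → (V : Subset m) → ∀ {g} → y + ι 2 * ι ∣ V ∣ * r ≤ g →
    0ℚ ≤ g → ∀ k → 2 ℕ.* k ℕ.≤ m → unionSum y k V ≤ binom m k * (y ^ ∣ V ∣ * g ^ k)
  unionSum-≤ {m} {r} mr≡1 V {g} y+≤g 0≤g zero 2k≤m = ≤-reflexive (trans (unionSum-0 V)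
    (trans (solve 1 (λ x → x := con 1ℚ :* (x :* con 1ℚ)) refl (y ^ ∣ V ∣)) (cong (_* (y ^ ∣ V ∣ * 1ℚ)) (sym (binom-0 m)))))
  unionSum-≤ {m} {r} mr≡1 V {g} y+≤g 0≤g (suc k) 2k≤m = *-cancelˡ-≤ (ι-mono-< {0} {suc k} (s≤s z≤n)) (begin
    ι (suc k) * unionSum y (suc k) V ≤⟨ unionSum-step k V ⟩
    ((M - K) * y + v) * unionSum y k V ≤⟨ *-monoʳ (0≤unionSum k V) coeff≤ ⟩
    (M - K) * g * unionSum y k V ≤⟨ *-monoˡ (0≤*-pos 0≤M-K 0≤g) (unionSum-≤ {r = r} mr≡1 V y+≤g 0≤g k (ℕ.≤-trans (ℕ.*-monoʳ-≤ 2 (ℕ.n≤1+n k)) 2k≤m)) ⟩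
    (M - K) * g * (binom m k * (y ^ ∣ V ∣ * g ^ k))
      ≡⟨ solve 5 (λ s g b x h → s :* g :* (b :* (x :* h)) := s :* b :* (x :* (g :* h))) refl (M - K) g (binom m k) (y ^ ∣ V ∣) (g ^ k) ⟩
    (M - K) * binom m k * (y ^ ∣ V ∣ * g ^ suc k) ≡⟨ cong (_* (y ^ ∣ V ∣ * g ^ suc k)) (sym (binom-absorb m k)) ⟩
    ι (suc k) * binom m (suc k) * (y ^ ∣ V ∣ * g ^ suc k) ≡⟨ *-assoc (ι (suc k)) (binom m (suc k)) _ ⟩
    ι (suc k) * (binom m (suc k) * (y ^ ∣ V ∣ * g ^ suc k)) ∎)
    where
    open ≤-Reasoning
    M = ι m
    K = ι k
    v = ι ∣ V ∣
    2K≤M : ι 2 * K ≤ M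
    2K≤M = ≤-trans (≤-reflexive (sym (ι-* 2 k))) (ι-mono-≤ (ℕ.≤-trans (ℕ.*-monoʳ-≤ 2 (ℕ.n≤1+n k)) 2k≤m))
    0≤M-K : 0ℚ ≤ M - K
    0≤M-K = ≤⇒0≤- (≤-trans (≤-by K (0≤ι k) (solve 1 (λ k → con (ι 2) :* k := k :+ k) refl K)) 2K≤M)
    0≤r : 0ℚ ≤ r
    0≤r with ≤-total 0ℚ r
    ... | inj₁ 0≤r = 0≤r
    ... | inj₂ r≤0 = ⊥-elim (<-irrefl refl (<-≤-trans 0<1
      (≤-trans (≤-reflexive (sym mr≡1)) (≤-trans (*-monoˡ (0≤ι m) r≤0) (≤-reflexive (*-zeroʳ M))))))
    coeff≤ : (M - K) * y + v ≤ (M - K) * g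
    coeff≤ = ≤-trans (≤-by (v * r * (M - ι 2 * K)) (0≤*-pos (0≤*-pos (0≤ι ∣ V ∣) 0≤r) (≤⇒0≤- 2K≤M))
      (trans (solve 5 (λ m k y v r → (m :- k) :* (y :+ con (ι 2) :* v :* r) :=
                (m :- k) :* y :+ v :* (m :* r) :+ v :* r :* (m :- con (ι 2) :* k)) refl M K y v r)
        (cong (λ s → (M - K) * y + s + v * r * (M - ι 2 * K)) (trans (cong (v *_) mr≡1) (*-identityʳ v)))))
      (*-monoˡ 0≤M-K y+≤g)

-- Cardinalities and enumerations

∣p∪q∣≤∣p∣+∣q∣ : ∀ {n} (p q : Subset n) → ∣ p ∪ q ∣ ℕ.≤ ∣ p ∣ ℕ.+ ∣ q ∣
∣p∪q∣≤∣p∣+∣q∣ [] [] = z≤n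
∣p∪q∣≤∣p∣+∣q∣ (inside  ∷ p) (inside  ∷ q) = s≤s (ℕ.≤-trans (∣p∪q∣≤∣p∣+∣q∣ p q) (ℕ.+-monoʳ-≤ ∣ p ∣ (ℕ.n≤1+n ∣ q ∣)))
∣p∪q∣≤∣p∣+∣q∣ (inside  ∷ p) (outside ∷ q) = s≤s (∣p∪q∣≤∣p∣+∣q∣ p q)
∣p∪q∣≤∣p∣+∣q∣ (outside ∷ p) (inside  ∷ q) = ℕ.≤-trans (s≤s (∣p∪q∣≤∣p∣+∣q∣ p q)) (ℕ.≤-reflexive (sym (ℕ.+-suc ∣ p ∣ ∣ q ∣)))
∣p∪q∣≤∣p∣+∣q∣ (outside ∷ p) (outside ∷ q) = ∣p∪q∣≤∣p∣+∣q∣ p q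

∣p∣+∣q∣≤∣p∪q∣ : ∀ {n} (p q : Subset n) → Empty (p ∩ q) → ∣ p ∣ ℕ.+ ∣ q ∣ ℕ.≤ ∣ p ∪ q ∣
∣p∣+∣q∣≤∣p∪q∣ [] [] e = z≤n
∣p∣+∣q∣≤∣p∪q∣ (inside  ∷ p) (inside  ∷ q) e = ⊥-elim (e (zero , here))
∣p∣+∣q∣≤∣p∪q∣ (inside  ∷ p) (outside ∷ q) e = s≤s (∣p∣+∣q∣≤∣p∪q∣ p q (drop-∷-Empty e))
∣p∣+∣q∣≤∣p∪q∣ (outside ∷ p) (inside  ∷ q) e = ℕ.≤-trans (ℕ.≤-reflexive (ℕ.+-suc ∣ p ∣ ∣ q ∣)) (s≤s (∣p∣+∣q∣≤∣p∪q∣ p q (drop-∷-Empty e)))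
∣p∣+∣q∣≤∣p∪q∣ (outside ∷ p) (outside ∷ q) e = ∣p∣+∣q∣≤∣p∪q∣ p q (drop-∷-Empty e)

subset-of-size : ∀ {n} (S : Subset n) t → t ℕ.≤ ∣ S ∣ → ∃ λ T → T ⊆ S × ∣ T ∣ ≡ t
subset-of-size [] zero _ = [] , (λ x∈ → x∈) , refl
subset-of-size (outside ∷ S) t t≤ with T , T⊆S , ∣T∣≡t ← subset-of-size S t t≤ =
  outside ∷ T , (λ { (there i) → there (T⊆S i) }) , ∣T∣≡t
subset-of-size (inside ∷ S) zero t≤ with T , T⊆S , ∣T∣≡t ← subset-of-size S zero z≤n =
  outside ∷ T , (λ { (there i) → there (T⊆S i) }) , ∣T∣≡t
subset-of-size (inside ∷ S) (suc t) (s≤s t≤) with T , T⊆S , ∣T∣≡t ← subset-of-size S t t≤ =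
  inside ∷ T , (λ { here → here ; (there i) → there (T⊆S i) }) , cong suc ∣T∣≡t

∈-subsets : ∀ {n} (S : Subset n) → S ∈ˡ subsets n
∈-subsets []            = here refl
∈-subsets (outside ∷ S) = ∈-++⁺ˡ (∈-map⁺ (outside ∷_) (∈-subsets S))
∈-subsets (inside ∷ S)  = ∈-++⁺ʳ (map (outside ∷_) (subsets _)) (∈-map⁺ (inside ∷_) (∈-subsets S))

∈-subsetsOfSize : ∀ {m k A} → A ∈ˡ subsetsOfSize m k → ∣ A ∣ ≡ k
∈-subsetsOfSize {m} {k} i = proj₂ (∈-filter⁻ (λ S → ∣ S ∣ ℕ.≟ k) {xs = subsets m} i)

∈-vectors : ∀ {A : Set} n (xs : List A) {F} → F ∈ˡ vectors n xs → ∀ u → lookup F u ∈ˡ xs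
∈-vectors (suc n) xs i u with x , v , x∈ , v∈ , refl ← ∈-cartesianProductWith⁻ _∷_ xs (vectors n xs) i with u
... | zero  = x∈
... | suc u = ∈-vectors n xs v∈ u

-- Unions and independence in assignments

-- The accumulator V holds the colours of the vertices already passed, so that an induction along F
-- can add one vertex at a time.
⋃ : ∀ {m n} → Subset m → Subset n → Vec (Subset m) n → Subset m
⋃ V []            []      = V
⋃ V (inside  ∷ S) (A ∷ F) = ⋃ (V ∪ A) S F
⋃ V (outside ∷ S) (A ∷ F) = ⋃ V S F

∈-⋃⁻ : ∀ {m n} (V : Subset m) (S : Subset n) F {x} → x ∈ ⋃ V S F → x ∈ V ⊎ ∃ λ u → u ∈ S × x ∈ lookup F u
∈-⋃⁻ V [] [] i = inj₁ i
∈-⋃⁻ V (inside ∷ S) (A ∷ F) i with ∈-⋃⁻ (V ∪ A) S F i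
... | inj₂ (u , u∈S , x∈) = inj₂ (suc u , there u∈S , x∈)
... | inj₁ x∈V∪A with x∈p∪q⁻ V A x∈V∪A
...   | inj₁ x∈V = inj₁ x∈V
...   | inj₂ x∈A = inj₂ (zero , here , x∈A)
∈-⋃⁻ V (outside ∷ S) (A ∷ F) i with ∈-⋃⁻ V S F i
... | inj₁ x∈V            = inj₁ x∈V
... | inj₂ (u , u∈S , x∈) = inj₂ (suc u , there u∈S , x∈)

∈-⋃⁺ : ∀ {m n} (V : Subset m) (S : Subset n) F {x} → x ∈ V ⊎ (∃ λ u → u ∈ S × x ∈ lookup F u) → x ∈ ⋃ V S F
∈-⋃⁺ V [] [] (inj₁ x∈V) = x∈V
∈-⋃⁺ V (inside ∷ S) (A ∷ F) (inj₁ x∈V) = ∈-⋃⁺ (V ∪ A) S F (inj₁ (x∈p∪q⁺ (inj₁ x∈V)))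
∈-⋃⁺ V (inside ∷ S) (A ∷ F) (inj₂ (zero , _ , x∈A)) = ∈-⋃⁺ (V ∪ A) S F (inj₁ (x∈p∪q⁺ (inj₂ x∈A)))
∈-⋃⁺ V (inside ∷ S) (A ∷ F) (inj₂ (suc u , there u∈S , x∈)) = ∈-⋃⁺ (V ∪ A) S F (inj₂ (u , u∈S , x∈))
∈-⋃⁺ V (outside ∷ S) (A ∷ F) (inj₁ x∈V) = ∈-⋃⁺ V S F (inj₁ x∈V)
∈-⋃⁺ V (outside ∷ S) (A ∷ F) (inj₂ (suc u , there u∈S , x∈)) = ∈-⋃⁺ V S F (inj₂ (u , u∈S , x∈))

⋃-mono : ∀ {m n} {S T : Subset n} (F : Vec (Subset m) n) → S ⊆ T → ⋃ ⊥ S F ⊆ ⋃ ⊥ T F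
⋃-mono {S = S} {T} F S⊆T i with ∈-⋃⁻ ⊥ S F i
... | inj₁ x∈⊥            = ⊥-elim (∉⊥ x∈⊥)
... | inj₂ (u , u∈S , x∈) = ∈-⋃⁺ ⊥ T F (inj₂ (u , S⊆T u∈S , x∈))

∏∉ : ∀ {A : Set} {n} → (A → ℚ) → Subset n → Vec A n → ℚ
∏∉ h []            []      = 1ℚ
∏∉ h (inside  ∷ S) (A ∷ F) = ∏∉ h S F
∏∉ h (outside ∷ S) (A ∷ F) = h A * ∏∉ h S F

module _ {A : Set} {h : A → ℚ} where

  0≤∏∉ : (∀ x → 0ℚ ≤ h x) → ∀ {n} (S : Subset n) F → 0ℚ ≤ ∏∉ h S F
  0≤∏∉ 0≤h []            []      = 0≤1
  0≤∏∉ 0≤h (inside  ∷ S) (A ∷ F) = 0≤∏∉ 0≤h S F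
  0≤∏∉ 0≤h (outside ∷ S) (A ∷ F) = 0≤*-pos (0≤h A) (0≤∏∉ 0≤h S F)

  1≤∏∉ : ∀ {n} (S : Subset n) F → (∀ w → w ∉ S → 1ℚ ≤ h (lookup F w)) → 1ℚ ≤ ∏∉ h S F
  1≤∏∉ []            []      1≤h = ≤-refl
  1≤∏∉ (inside  ∷ S) (A ∷ F) 1≤h = 1≤∏∉ S F λ w w∉S → 1≤h (suc w) λ { (there i) → w∉S i }
  1≤∏∉ (outside ∷ S) (A ∷ F) 1≤h = *-mono-≤ 0≤1 0≤1 (1≤h zero λ ())
    (1≤∏∉ S F λ w w∉S → 1≤h (suc w) λ { (there i) → w∉S i })

∏∉-𝟙 : ∀ {A : Set} {P : A → Set} (P? : Decidable₁ P) {n} (S : Subset n) F →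
  (∏∉ (𝟙 ∘ P?) S F ≡ 1ℚ × (∀ w → w ∉ S → P (lookup F w))) ⊎ ∏∉ (𝟙 ∘ P?) S F ≡ 0ℚ
∏∉-𝟙 P? [] [] = inj₁ (refl , λ ())
∏∉-𝟙 P? (inside ∷ S) (A ∷ F) with ∏∉-𝟙 P? S F
... | inj₂ eq       = inj₂ eq
... | inj₁ (eq , p) = inj₁ (eq , λ { zero w∉ → ⊥-elim (w∉ here) ; (suc w) w∉ → p w (w∉ ∘ there) })
∏∉-𝟙 P? (outside ∷ S) (A ∷ F) with P? A | ∏∉-𝟙 P? S F
... | no  _  | _              = inj₂ (*-zeroˡ (∏∉ (𝟙 ∘ P?) S F))
... | yes _  | inj₂ eq        = inj₂ (trans (*-identityˡ _) eq)
... | yes p₀ | inj₁ (eq , p)  = inj₁ (trans (*-identityˡ _) eq , λ { zero _ → p₀ ; (suc w) w∉ → p w (w∉ ∘ there) })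

-- Given the entries indexed by S, the other entries are independent.
∑-assignments : ∀ {m} (Ω : List (Subset m)) {h : Subset m → Subset m → ℚ} {d : Subset m → ℚ} →
  (∀ V → ∑ Ω (h V) ≡ ι (length Ω) * d V) →
  ∀ n (V : Subset m) (S : Subset n) (φ : Subset m → ℚ) →
  ∑ (vectors n Ω) (λ F → φ (⋃ V S F) * ∏∉ (h (⋃ V S F)) S F) ≡
  ∑ (vectors n Ω) (λ F → φ (⋃ V S F) * d (⋃ V S F) ^ (n ℕ.∸ ∣ S ∣))
∑-assignments Ω Σh≡ zero V [] φ = refl
∑-assignments Ω Σh≡ (suc n) V (inside ∷ S) φ = trans (∑-vectors n Ω _)
  (trans (∑-cong Ω λ A → ∑-assignments Ω Σh≡ n (V ∪ A) S φ) (sym (∑-vectors n Ω _)))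
∑-assignments Ω {h} {d} Σh≡ (suc n) V (outside ∷ S) φ = begin
  ∑ (vectors (suc n) Ω) (λ F → φ (⋃ V (outside ∷ S) F) * ∏∉ (h (⋃ V (outside ∷ S) F)) (outside ∷ S) F) ≡⟨ ∑-vectors n Ω _ ⟩
  ∑ Ω (λ A → ∑ Ωⁿ (λ F → φ (U F) * (h (U F) A * ∏∉ (h (U F)) S F))) ≡⟨ ∑-swap Ω Ωⁿ _ ⟩
  ∑ Ωⁿ (λ F → ∑ Ω (λ A → φ (U F) * (h (U F) A * ∏∉ (h (U F)) S F))) ≡⟨ ∑-cong Ωⁿ inner ⟩
  ∑ Ωⁿ (λ F → N * (φ (U F) * d (U F) * ∏∉ (h (U F)) S F)) ≡⟨ ∑-*ˡ Ωⁿ N _ ⟩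
  -- The union does not involve the entry of the vertex outside S, which has therefore been summed
  -- out first. Its factor `d` is absorbed into the weight, which is why φ has to be arbitrary.
  N * ∑ Ωⁿ (λ F → φ (U F) * d (U F) * ∏∉ (h (U F)) S F) ≡⟨ cong (N *_) (∑-assignments Ω Σh≡ n V S (λ W → φ W * d W)) ⟩
  N * ∑ Ωⁿ (λ F → φ (U F) * d (U F) * d (U F) ^ (n ℕ.∸ ∣ S ∣)) ≡⟨ sym (∑-const Ω _) ⟩
  ∑ Ω (λ _ → ∑ Ωⁿ (λ F → φ (U F) * d (U F) * d (U F) ^ (n ℕ.∸ ∣ S ∣)))
    ≡⟨ ∑-cong Ω (λ _ → ∑-cong Ωⁿ λ F → trans (*-assoc (φ (U F)) (d (U F)) _)
         (cong (λ e → φ (U F) * d (U F) ^ e) (sym (ℕ.+-∸-assoc 1 (∣p∣≤n S))))) ⟩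
  ∑ Ω (λ _ → ∑ Ωⁿ (λ F → φ (U F) * d (U F) ^ (suc n ℕ.∸ ∣ S ∣))) ≡⟨ sym (∑-vectors n Ω _) ⟩
  ∑ (vectors (suc n) Ω) (λ F → φ (⋃ V (outside ∷ S) F) * d (⋃ V (outside ∷ S) F) ^ (suc n ℕ.∸ ∣ S ∣)) ∎
  where
  open ≡-Reasoning
  Ωⁿ = vectors n Ω
  N = ι (length Ω)
  U = ⋃ V S
  inner : ∀ F → ∑ Ω (λ A → φ (U F) * (h (U F) A * ∏∉ (h (U F)) S F)) ≡ N * (φ (U F) * d (U F) * ∏∉ (h (U F)) S F)
  inner F = begin
    ∑ Ω (λ A → φ (U F) * (h (U F) A * p)) ≡⟨ ∑-*ˡ Ω (φ (U F)) _ ⟩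
    φ (U F) * ∑ Ω (λ A → h (U F) A * p) ≡⟨ cong (φ (U F) *_) (trans (∑-*ʳ Ω (h (U F)) p) (cong (_* p) (Σh≡ (U F)))) ⟩
    φ (U F) * (N * d (U F) * p) ≡⟨ solve 4 (λ x n d p → x :* (n :* d :* p) := n :* (x :* d :* p)) refl (φ (U F)) N (d (U F)) p ⟩
    N * (φ (U F) * d (U F) * p) ∎
    where
    p = ∏∉ (h (U F)) S F

-- Each vertex of S costs a factor β. The index i counts the vertices of S already passed; it limits
-- the accumulated union to ik colours, so the bound for a single vertex is called only for i below
-- t.
∑-^-⋃ : ∀ {m k t y β} → 0ℚ ≤ y → 0ℚ ≤ β →
  (∀ i (V : Subset m) → suc i ℕ.≤ t → ∣ V ∣ ℕ.≤ i ℕ.* k → unionSum y k V ≤ binom m k * (y ^ ∣ V ∣ * β)) →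
  ∀ n i (V : Subset m) (S : Subset n) → ∣ V ∣ ℕ.≤ i ℕ.* k → i ℕ.+ ∣ S ∣ ℕ.≤ t →
  ∑ (assignments n m k) (λ F → y ^ ∣ ⋃ V S F ∣) ≤ binom m k ^ n * (y ^ ∣ V ∣ * β ^ ∣ S ∣)
∑-^-⋃ {y = y} 0≤y 0≤β step zero i V [] _ _ = ≤-reflexive
  (solve 1 (λ x → x :+ con 0ℚ := con 1ℚ :* (x :* con 1ℚ)) refl (y ^ ∣ V ∣))
∑-^-⋃ {m} {k} {t} {y} {β} 0≤y 0≤β step (suc n) i V (inside ∷ S) V≤ i+S≤ = begin
  ∑ (assignments (suc n) m k) (λ F → y ^ ∣ ⋃ V (inside ∷ S) F ∣) ≡⟨ ∑-vectors n Ω _ ⟩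
  ∑ Ω (λ A → ∑ (assignments n m k) (λ F → y ^ ∣ ⋃ (V ∪ A) S F ∣)) ≤⟨ ∑-mono-∈ Ω (λ {A} A∈ →
    ∑-^-⋃ 0≤y 0≤β step n (suc i) (V ∪ A) S (V∪A≤ A∈) i+S≤′) ⟩
  ∑ Ω (λ A → N ^ n * (y ^ ∣ V ∪ A ∣ * β ^ ∣ S ∣)) ≡⟨ trans (∑-*ˡ Ω (N ^ n) _) (cong (N ^ n *_) (∑-*ʳ Ω _ (β ^ ∣ S ∣))) ⟩
  N ^ n * (unionSum y k V * β ^ ∣ S ∣) ≤⟨ *-monoˡ (0≤^ n (0≤binom m k)) (*-monoʳ (0≤^ ∣ S ∣ 0≤β) (step i V
    (ℕ.≤-trans (ℕ.m≤m+n (suc i) ∣ S ∣) i+S≤′) V≤)) ⟩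
  N ^ n * (N * (y ^ ∣ V ∣ * β) * β ^ ∣ S ∣)
    ≡⟨ solve 5 (λ p n y b c → p :* (n :* (y :* b) :* c) := n :* p :* (y :* (b :* c))) refl (N ^ n) N (y ^ ∣ V ∣) β (β ^ ∣ S ∣) ⟩
  N ^ suc n * (y ^ ∣ V ∣ * β ^ suc ∣ S ∣) ∎
  where
  open ≤-Reasoning
  Ω = subsetsOfSize m k
  N = binom m k
  i+S≤′ : suc i ℕ.+ ∣ S ∣ ℕ.≤ t
  i+S≤′ = ℕ.≤-trans (ℕ.≤-reflexive (sym (ℕ.+-suc i ∣ S ∣))) i+S≤
  V∪A≤ : ∀ {A} → A ∈ˡ Ω → ∣ V ∪ A ∣ ℕ.≤ suc i ℕ.* k
  V∪A≤ {A} A∈ = ℕ.≤-trans (∣p∪q∣≤∣p∣+∣q∣ V A) (ℕ.≤-trans (ℕ.+-mono-≤ V≤ (ℕ.≤-reflexive (∈-subsetsOfSize A∈)))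
    (ℕ.≤-reflexive (ℕ.+-comm (i ℕ.* k) k)))
∑-^-⋃ {m} {k} {t} {y} {β} 0≤y 0≤β step (suc n) i V (outside ∷ S) V≤ i+S≤ = begin
  ∑ (assignments (suc n) m k) (λ F → y ^ ∣ ⋃ V (outside ∷ S) F ∣) ≡⟨ ∑-vectors n Ω _ ⟩
  ∑ Ω (λ A → ∑ (assignments n m k) (λ F → y ^ ∣ ⋃ V S F ∣)) ≤⟨ ∑-mono Ω (λ A → ∑-^-⋃ 0≤y 0≤β step n i V S V≤ i+S≤) ⟩
  ∑ Ω (λ A → N ^ n * (y ^ ∣ V ∣ * β ^ ∣ S ∣)) ≡⟨ ∑-const Ω _ ⟩
  N * (N ^ n * (y ^ ∣ V ∣ * β ^ ∣ S ∣)) ≡⟨ sym (*-assoc N (N ^ n) _) ⟩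
  N ^ suc n * (y ^ ∣ V ∣ * β ^ ∣ S ∣) ∎
  where
  open ≤-Reasoning
  Ω = subsetsOfSize m k
  N = binom m k

-- Cuts of disconnected graphs

IsCut : ∀ {m n} → Vec (Subset m) n → Subset n → Set
IsCut F S = Nonempty S × Nonempty (∁ S) × (∀ u w → u ∈ S → w ∉ S → Empty (lookup F u ∩ lookup F w))

-- One side is the component of a vertex that does not reach all others. Turning it into a `Subset`
-- requires deciding reachability; under a double negation, finitely many instances of excluded
-- middle are available. The cut is only used to prove a decidable inequality, so the double
-- negation does no harm.
disconnected⇒cut : ∀ {m n} (F : Vec (Subset m) n) → ¬ Connected (Intersection F) → ¬ ¬ ∃ (IsCut F)
disconnected⇒cut {m} {n} F ¬conn ¬cut = dec-star λ star? → ¬conn λ u v → decidable-stable (star? u v) λ ¬uv →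
  let reach = tabulate (λ w → does (star? u w))
      reach⁺ : ∀ {w} → Star E u w → w ∈ reach
      reach⁺ {w} s = lookup⇒[]= w reach (trans (lookup∘tabulate _ w) (dec-true (star? u w) s))
      reach⁻ : ∀ {w} → w ∈ reach → Star E u w
      reach⁻ {w} i = decidable-stable (star? u w) λ ¬s →
        λ-absurd (trans (sym (dec-false (star? u w) ¬s)) (trans (sym (lookup∘tabulate _ w)) ([]=⇒lookup i)))
  in ¬cut (reach , (u , reach⁺ ε) , (v , x∉p⇒x∈∁p (¬uv ∘ reach⁻)) ,
    λ a w a∈ w∉ ne → w∉ (reach⁺ (reach⁻ a∈ ◅◅ ((λ { refl → w∉ a∈ }) , ne) ◅ ε)))
  where
  E = Intersection F
  λ-absurd : ¬ (false ≡ true)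
  λ-absurd ()
  open RawMonad ¬¬-Monad using (rawApplicative)
  dec-star : ¬ ¬ (∀ u v → Dec (Star E u v))
  dec-star = Fin.sequence rawApplicative λ u → Fin.sequence rawApplicative λ v → ¬¬-excluded-middle

cut-∁ : ∀ {m n} {F : Vec (Subset m) n} {S} → IsCut F S → IsCut F (∁ S)
cut-∁ {F = F} {S} ((a , a∈S) , ∁ne , sep) = ∁ne , (a , x∉p⇒x∈∁p (x∈p⇒x∉∁p a∈S)) , λ u w u∈ w∉ (x , i) →
  let u∉S = x∈∁p⇒x∉p u∈
      w∈S = decidable-stable (w ∈? S) (w∉ ∘ x∉p⇒x∈∁p)
      p , q = x∈p∩q⁻ (lookup F u) (lookup F w) i
  in sep w u w∈S u∉S (x , x∈p∩q⁺ (q , p))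

cut-⋃ : ∀ {m n} {F : Vec (Subset m) n} {S} → IsCut F S → ∀ w → w ∉ S → Empty (⋃ ⊥ S F ∩ lookup F w)
cut-⋃ {F = F} {S} (_ , _ , sep) w w∉S (x , i) with x∈p∩q⁻ (⋃ ⊥ S F) (lookup F w) i
... | x∈⋃ , x∈w with ∈-⋃⁻ ⊥ S F x∈⋃
...   | inj₁ x∈⊥             = ∉⊥ x∈⊥
...   | inj₂ (u , u∈S , x∈u) = sep u w u∈S w∉S (x , x∈p∩q⁺ (x∈u , x∈w))

-- The exponential series

/-* : ∀ a b .{{_ : ℕ.NonZero b}} → (ℤ.+ a / b) * ι b ≡ ι a
/-* a b@(suc b-1) = toℚᵘ-injective (ℚᵘ.≃-trans (toℚᵘ-homo-* (ℤ.+ a / b) (ι b))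
  (ℚᵘ.≃-trans (ℚᵘ.*-cong (toℚᵘ-fromℚᵘ (ℚᵘ.mkℚᵘ (ℤ.+ a) b-1)) (toℚᵘ-ι b))
  (ℚᵘ.≃-trans (ℚᵘ.*≡* (trans (ℤ.*-identityʳ _) (cong (ℤ.+ a ℤ.*_) (cong (λ s → ℤ.+ suc s) (sym (ℕ.*-identityʳ b-1)))))) (ℚᵘ.≃-sym (toℚᵘ-ι a)))))

1/!_ : ℕ → ℚ
1/! i = _/_ (ℤ.+ 1) (i !) {{i !≢0}}

expSum : ℕ → ℚ → ℚ
expSum N x = sumBelow N λ i → x ^ i * 1/! i

1/!-suc : ∀ i → ι (suc i) * 1/! (suc i) ≡ 1/! i
1/!-suc i = begin
  ι (suc i) * 1/! (suc i) ≡⟨ solve 3 (λ s a b → s :* a := s :* a :* con 1ℚ) refl (ι (suc i)) (1/! (suc i)) 0ℚ ⟩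
  ι (suc i) * 1/! (suc i) * 1ℚ ≡⟨ cong (ι (suc i) * 1/! (suc i) *_) (sym (/-* 1 (i !) {{i !≢0}})) ⟩
  ι (suc i) * 1/! (suc i) * (1/! i * ι (i !))
    ≡⟨ solve 4 (λ s a b f → s :* a :* (b :* f) := b :* (a :* (s :* f))) refl (ι (suc i)) (1/! (suc i)) (1/! i) (ι (i !)) ⟩
  1/! i * (1/! (suc i) * (ι (suc i) * ι (i !))) ≡⟨ cong (λ s → 1/! i * (1/! (suc i) * s)) (sym (ι-* (suc i) (i !))) ⟩
  1/! i * (1/! (suc i) * ι (suc i !)) ≡⟨ cong (1/! i *_) (/-* 1 (suc i !) {{suc i !≢0}}) ⟩
  1/! i * 1ℚ ≡⟨ *-identityʳ (1/! i) ⟩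
  1/! i ∎
  where open ≡-Reasoning

0≤1/! : ∀ i → 0ℚ ≤ 1/! i
0≤1/! zero    = 0≤1
0≤1/! (suc i) = *-cancelˡ-≤ (ι-mono-< {0} {suc i} (s≤s z≤n))
  (≤-trans (≤-reflexive (*-zeroʳ (ι (suc i)))) (≤-trans (0≤1/! i) (≤-reflexive (sym (1/!-suc i)))))

expSum-mono-N : ∀ {x} N → 0ℚ ≤ x → expSum N x ≤ expSum (suc N) x
expSum-mono-N N 0≤x = a≤a+b (0≤*-pos (0≤^ N 0≤x) (0≤1/! N))

expSum-mono-≤ : ∀ {x M N} → 0ℚ ≤ x → M ℕ.≤ N → expSum M x ≤ expSum N x
expSum-mono-≤ {x} 0≤x M≤N = go (ℕ.≤⇒≤′ M≤N)
  where
  go : ∀ {M N} → M ℕ.≤′ N → expSum M x ≤ expSum N x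
  go ℕ.≤′-refl = ≤-refl
  go (ℕ.≤′-step {N} M≤N) = ≤-trans (go M≤N) (expSum-mono-N N 0≤x)

expSum-mono : ∀ {x y} N → 0ℚ ≤ x → x ≤ y → expSum N x ≤ expSum N y
expSum-mono zero    0≤x x≤y = ≤-refl
expSum-mono (suc N) 0≤x x≤y = +-mono-≤ (expSum-mono N 0≤x x≤y) (*-monoʳ (0≤1/! N) (^-mono N 0≤x x≤y))

expSum-0 : ∀ N → expSum N 0ℚ ≤ 1ℚ
expSum-0 zero          = 0≤1
expSum-0 (suc zero)    = ≤-refl
expSum-0 (suc (suc N)) = ≤-trans (≤-reflexive (trans (cong (expSum (suc N) 0ℚ +_)
  (trans (cong (_* 1/! (suc N)) (*-zeroˡ (0ℚ ^ N))) (*-zeroˡ (1/! (suc N))))) (+-identityʳ _))) (expSum-0 (suc N))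

-- exp (x + t) lies between (1 + t) exp x and (1 − t)⁻¹ exp x; termwise, this
-- persists for the partial sums.
module _ {x t : ℚ} (0≤x : 0ℚ ≤ x) (0≤t : 0ℚ ≤ t) where

  private
    0≤x+t : 0ℚ ≤ x + t
    0≤x+t = 0≤+ 0≤x 0≤t

    ^-step-≤ : ∀ i → (x + t) ^ suc i ≤ x ^ suc i + ι (suc i) * (t * (x + t) ^ i)
    ^-step-≤ zero    = ≤-reflexive
      (solve 2 (λ x t → (x :+ t) :* con 1ℚ := x :* con 1ℚ :+ con (ι 1) :* (t :* con 1ℚ)) refl x t)
    ^-step-≤ (suc i) = begin
      (x + t) * p ≤⟨ *-monoˡ 0≤x+t (^-step-≤ i) ⟩
      (x + t) * (x ^ suc i + K * (t * q))
        ≡⟨ solve 5 (λ x t z k q → (x :+ t) :* (z :+ k :* (t :* q)) := x :* z :+ (t :* z :+ k :* (t :* ((x :+ t) :* q)))) refl x t (x ^ suc i) K q ⟩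
      x * x ^ suc i + (t * x ^ suc i + K * (t * p)) ≤⟨ +-monoʳ-≤ (x * x ^ suc i) (+-monoˡ-≤ (K * (t * p)) (*-monoˡ 0≤t (^-mono (suc i) 0≤x (a≤a+b 0≤t)))) ⟩
      x * x ^ suc i + (t * p + K * (t * p)) ≡⟨ cong (x * x ^ suc i +_) (trans
        (solve 2 (λ k s → s :+ k :* s := (con 1ℚ :+ k) :* s) refl K (t * p)) (cong (_* (t * p)) (sym (ι-suc (suc i))))) ⟩
      x * x ^ suc i + ι (suc (suc i)) * (t * p) ∎
      where
      open ≤-Reasoning
      K = ι (suc i)
      p = (x + t) ^ suc i
      q = (x + t) ^ i

    ^-step-≥ : ∀ i → x ^ suc i + ι (suc i) * (t * x ^ i) ≤ (x + t) ^ suc i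
    ^-step-≥ zero    = ≤-reflexive
      (solve 2 (λ x t → x :* con 1ℚ :+ con (ι 1) :* (t :* con 1ℚ) := (x :+ t) :* con 1ℚ) refl x t)
    ^-step-≥ (suc i) = begin
      x * z + ι (suc (suc i)) * (t * z) ≤⟨ ≤-by (K * (t * (t * q))) (0≤*-pos (0≤ι (suc i)) (0≤*-pos 0≤t (0≤*-pos 0≤t (0≤^ i 0≤x))))
        (trans (solve 4 (λ x t k q → (x :+ t) :* (x :* q :+ k :* (t :* q)) := x :* (x :* q) :+ (con 1ℚ :+ k) :* (t :* (x :* q)) :+ k :* (t :* (t :* q))) refl x t K q)
          (cong (λ s → x * z + s * (t * z) + K * (t * (t * q))) (sym (ι-suc (suc i))))) ⟩
      (x + t) * (z + K * (t * q)) ≤⟨ *-monoˡ 0≤x+t (^-step-≥ i) ⟩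
      (x + t) * (x + t) ^ suc i ∎
      where
      open ≤-Reasoning
      K = ι (suc i)
      z = x ^ suc i
      q = x ^ i

    shift : ∀ i a → ι (suc i) * (t * a) * 1/! (suc i) ≡ t * (a * 1/! i)
    shift i a = trans (solve 4 (λ k t a f → k :* (t :* a) :* f := t :* (a :* (k :* f))) refl (ι (suc i)) t a (1/! (suc i)))
      (cong (λ s → t * (a * s)) (1/!-suc i))

  expSum-step-≤ : ∀ N → expSum (suc N) (x + t) ≤ expSum (suc N) x + t * expSum N (x + t)
  expSum-step-≤ zero    = ≤-reflexive (sym (trans (cong (expSum 1 x +_) (*-zeroʳ t)) (+-identityʳ _)))
  expSum-step-≤ (suc N) = begin
    expSum (suc N) (x + t) + (x + t) ^ suc N * 1/! (suc N) ≤⟨ +-mono-≤ (expSum-step-≤ N) (*-monoʳ (0≤1/! (suc N)) (^-step-≤ N)) ⟩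
    expSum (suc N) x + t * expSum N (x + t) + (x ^ suc N + ι (suc N) * (t * (x + t) ^ N)) * 1/! (suc N)
      ≡⟨ cong (expSum (suc N) x + t * expSum N (x + t) +_) (trans (*-distribʳ-+ (1/! (suc N)) (x ^ suc N) _)
           (cong (x ^ suc N * 1/! (suc N) +_) (shift N ((x + t) ^ N)))) ⟩
    expSum (suc N) x + t * expSum N (x + t) + (x ^ suc N * 1/! (suc N) + t * ((x + t) ^ N * 1/! N))
      ≡⟨ solve 5 (λ a t b c d → a :+ t :* b :+ (c :+ t :* d) := a :+ c :+ t :* (b :+ d)) refl (expSum (suc N) x) t (expSum N (x + t)) (x ^ suc N * 1/! (suc N)) ((x + t) ^ N * 1/! N) ⟩
    expSum (suc (suc N)) x + t * expSum (suc N) (x + t) ∎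
    where open ≤-Reasoning

  expSum-step-≥ : ∀ N → expSum (suc N) x + t * expSum N x ≤ expSum (suc N) (x + t)
  expSum-step-≥ zero    = ≤-reflexive (trans (cong (expSum 1 x +_) (*-zeroʳ t)) (+-identityʳ _))
  expSum-step-≥ (suc N) = begin
    expSum (suc (suc N)) x + t * expSum (suc N) x
      ≡⟨ solve 5 (λ a t b c d → a :+ c :+ t :* (b :+ d) := a :+ t :* b :+ (c :+ t :* d)) refl (expSum (suc N) x) t (expSum N x) (x ^ suc N * 1/! (suc N)) (x ^ N * 1/! N) ⟩
    expSum (suc N) x + t * expSum N x + (x ^ suc N * 1/! (suc N) + t * (x ^ N * 1/! N))
      ≡⟨ cong (expSum (suc N) x + t * expSum N x +_) (sym (trans (*-distribʳ-+ (1/! (suc N)) (x ^ suc N) _)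
           (cong (x ^ suc N * 1/! (suc N) +_) (shift N (x ^ N))))) ⟩
    expSum (suc N) x + t * expSum N x + (x ^ suc N + ι (suc N) * (t * x ^ N)) * 1/! (suc N)
      ≤⟨ +-mono-≤ (expSum-step-≥ N) (*-monoʳ (0≤1/! (suc N)) (^-step-≥ N)) ⟩
    expSum (suc N) (x + t) + (x + t) ^ suc N * 1/! (suc N) ∎
    where open ≤-Reasoning

ι-suc-* : ∀ W t → ι (suc W) * t ≡ ι W * t + t
ι-suc-* W t = trans (cong (_* t) (ι-suc W)) (solve 2 (λ w t → (con 1ℚ :+ w) :* t := w :* t :+ t) refl (ι W) t)

-- W steps of length t from 0, each multiplying a partial sum by at most 1/(1 - t): exp (Wt) ≤ (1 -
-- t)^(-W).
expSum-upper : ∀ {t} → 0ℚ ≤ t → t ≤ 1ℚ → ∀ W N → expSum N (ι W * t) * (1ℚ - t) ^ W ≤ 1ℚ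
expSum-upper {t} 0≤t t≤1 zero N = ≤-trans (≤-reflexive (trans (*-identityʳ _) (cong (expSum N) (*-zeroˡ t)))) (expSum-0 N)
expSum-upper {t} 0≤t t≤1 (suc W) N = begin
  expSum N (ι (suc W) * t) * ((1ℚ - t) * (1ℚ - t) ^ W) ≡⟨ sym (*-assoc (expSum N (ι (suc W) * t)) (1ℚ - t) ((1ℚ - t) ^ W)) ⟩
  expSum N (ι (suc W) * t) * (1ℚ - t) * (1ℚ - t) ^ W ≤⟨ *-monoʳ (0≤^ W (≤⇒0≤- t≤1)) (≤-trans (≤-reflexive (cong (λ s → expSum N s * (1ℚ - t)) (ι-suc-* W t))) (one N)) ⟩
  expSum N (ι W * t) * (1ℚ - t) ^ W ≤⟨ expSum-upper 0≤t t≤1 W N ⟩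
  1ℚ ∎
  where
  open ≤-Reasoning
  x = ι W * t
  0≤x : 0ℚ ≤ x
  0≤x = 0≤*-pos (0≤ι W) 0≤t
  one : ∀ N → expSum N (x + t) * (1ℚ - t) ≤ expSum N x
  one zero    = ≤-reflexive (*-zeroˡ (1ℚ - t))
  one (suc N) = ≤-by (expSum (suc N) x + t * expSum (suc N) (x + t) - expSum (suc N) (x + t))
    (≤⇒0≤- (≤-trans (expSum-step-≤ 0≤x 0≤t N) (+-monoʳ-≤ (expSum (suc N) x) (*-monoˡ 0≤t (expSum-mono-N N (0≤+ 0≤x 0≤t))))))
    (solve 3 (λ a b t → a := b :* (con 1ℚ :- t) :+ (a :+ t :* b :- b)) refl (expSum (suc N) x) (expSum (suc N) (x + t)) t)

-- W steps of length t from 0, each multiplying by at least 1 + t. A step uses up one more term of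
-- the series, whence the index `suc W`.
expSum-lower : ∀ {t} → 0ℚ ≤ t → ∀ W → (1ℚ + t) ^ W ≤ expSum (suc W) (ι W * t)
expSum-lower {t} 0≤t zero    = ≤-refl
expSum-lower {t} 0≤t (suc W) = begin
  (1ℚ + t) * (1ℚ + t) ^ W ≤⟨ *-monoˡ (0≤+ 0≤1 0≤t) (expSum-lower 0≤t W) ⟩
  (1ℚ + t) * expSum (suc W) x ≡⟨ solve 2 (λ t a → (con 1ℚ :+ t) :* a := a :+ t :* a) refl t (expSum (suc W) x) ⟩
  expSum (suc W) x + t * expSum (suc W) x ≤⟨ +-monoˡ-≤ (t * expSum (suc W) x) (expSum-mono-N (suc W) 0≤x) ⟩
  expSum (suc (suc W)) x + t * expSum (suc W) x ≤⟨ expSum-step-≥ 0≤x 0≤t (suc W) ⟩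
  expSum (suc (suc W)) (x + t) ≡⟨ cong (expSum (suc (suc W))) (sym (ι-suc-* W t)) ⟩
  expSum (suc (suc W)) (ι (suc W) * t) ∎
  where
  open ≤-Reasoning
  x = ι W * t
  0≤x : 0ℚ ≤ x
  0≤x = 0≤*-pos (0≤ι W) 0≤t

-- Bonferroni's inequalities and partial sums at negative arguments

private
  double : ℕ → ℕ
  double zero    = zero
  double (suc j) = suc (suc (double j))

  n≤double : ∀ j → j ℕ.≤ double j
  n≤double zero    = z≤n
  n≤double (suc j) = s≤s (ℕ.m≤n⇒m≤1+n (n≤double j))

  binomSum : ℕ → ℕ → ℚ → ℚ
  binomSum J R x = sumBelow J λ i → binom R i * x ^ i

  binomSum-pascal : ∀ J R x → binomSum (suc J) (suc R) x ≡ binomSum (suc J) R x + x * binomSum J R x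
  binomSum-pascal zero R x = trans (cong (λ b → 0ℚ + b * 1ℚ) (trans (binom-0 (suc R)) (sym (binom-0 R))))
    (sym (trans (cong (0ℚ + binom R 0 * 1ℚ +_) (*-zeroʳ x)) (+-identityʳ (0ℚ + binom R 0 * 1ℚ))))
  binomSum-pascal (suc J) R x = trans (cong₂ (λ s b → s + b * (x * x ^ J)) (binomSum-pascal J R x) (pascal R J))
    (solve 6 (λ a x b c d p → a :+ x :* b :+ (c :+ d) :* (x :* p) := a :+ c :* (x :* p) :+ x :* (b :+ d :* p)) refl
      (binomSum (suc J) R x) x (binomSum J R x) (binom R (suc J)) (binom R J) (x ^ J))

  binomSum-0 : ∀ J x → binomSum (suc J) 0 x ≡ 1ℚ
  binomSum-0 zero    x = refl
  binomSum-0 (suc J) x = trans (cong (binomSum (suc J) 0 x +_) (*-zeroˡ (x ^ suc J)))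
    (trans (+-identityʳ (binomSum (suc J) 0 x)) (binomSum-0 J x))

module _ {s : ℚ} (0≤s : 0ℚ ≤ s) (s≤1 : s ≤ 1ℚ) where

  private
    neg-anti : ∀ {a b} → a ≤ b → (- s) * b ≤ (- s) * a
    neg-anti {a} {b} a≤b = subst₂ _≤_ (neg-distribˡ-* s b) (neg-distribˡ-* s a) (neg-antimono-≤ (*-monoˡ 0≤s a≤b))

    1-s^ : ∀ R → (1ℚ - s) ^ R + (- s) * (1ℚ - s) ^ R ≡ (1ℚ - s) ^ suc R
    1-s^ R = solve 2 (λ s p → p :+ (:- s) :* p := (con 1ℚ :- s) :* p) refl s ((1ℚ - s) ^ R)

  mutual
    -- Pascal's rule expresses a truncation for R + 1 by two consecutive truncations for R, the
    -- shorter one with the negative factor -s. This turns an upper bound into a lower one, so the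
    -- two parities are proved together.
    bonferroni-even : ∀ j R → binomSum (double j) R (- s) ≤ (1ℚ - s) ^ R
    bonferroni-even zero    R       = 0≤^ R (≤⇒0≤- s≤1)
    bonferroni-even (suc j) zero    = ≤-reflexive (binomSum-0 (suc (double j)) (- s))
    bonferroni-even (suc j) (suc R) = ≤-trans (≤-reflexive (binomSum-pascal (suc (double j)) R (- s)))
      (≤-trans (+-mono-≤ (bonferroni-even (suc j) R) (neg-anti (bonferroni-odd j R))) (≤-reflexive (1-s^ R)))

    bonferroni-odd : ∀ j R → (1ℚ - s) ^ R ≤ binomSum (suc (double j)) R (- s)
    bonferroni-odd j zero    = ≤-reflexive (sym (binomSum-0 (double j) (- s)))
    bonferroni-odd j (suc R) = ≤-trans (≤-reflexive (sym (1-s^ R)))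
      (≤-trans (+-mono-≤ (bonferroni-odd j R) (neg-anti (bonferroni-even j R))) (≤-reflexive (sym (binomSum-pascal (double j) R (- s)))))

module _ {R : ℕ} {s v : ℚ} (0≤s : 0ℚ ≤ s) (0≤v : 0ℚ ≤ v) (Rs≡v : ι R * s ≡ v) where

  private
    p b : ℕ → ℚ
    p i = v ^ i * 1/! i
    b i = binom R i * s ^ i

    0≤p : ∀ i → 0ℚ ≤ p i
    0≤p i = 0≤*-pos (0≤^ i 0≤v) (0≤1/! i)

    0≤b : ∀ i → 0ℚ ≤ b i
    0≤b i = 0≤*-pos (0≤binom R i) (0≤^ i 0≤s)

    p-suc : ∀ i → ι (suc i) * p (suc i) ≡ v * p i
    p-suc i = trans (solve 4 (λ k v q f → k :* (v :* q :* f) := v :* (q :* (k :* f))) refl (ι (suc i)) v (v ^ i) (1/! (suc i)))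
      (cong (λ f → v * (v ^ i * f)) (1/!-suc i))

    b-suc : ∀ i → ι (suc i) * b (suc i) ≡ v * b i - ι i * s * b i
    b-suc i = begin
      ι (suc i) * (binom R (suc i) * (s * s ^ i)) ≡⟨ sym (*-assoc (ι (suc i)) (binom R (suc i)) (s * s ^ i)) ⟩
      ι (suc i) * binom R (suc i) * (s * s ^ i) ≡⟨ cong (_* (s * s ^ i)) (binom-absorb R i) ⟩
      (ι R - ι i) * binom R i * (s * s ^ i)
        ≡⟨ solve 5 (λ r i c s q → (r :- i) :* c :* (s :* q) := r :* s :* (c :* q) :- i :* s :* (c :* q)) refl (ι R) (ι i) (binom R i) s (s ^ i) ⟩
      ι R * s * b i - ι i * s * b i ≡⟨ cong (λ u → u * b i - ι i * s * b i) Rs≡v ⟩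
      v * b i - ι i * s * b i ∎
      where open ≡-Reasoning

    b≤p : ∀ i → b i ≤ p i
    b≤p zero    = ≤-reflexive (cong (_* 1ℚ) (binom-0 R))
    b≤p (suc i) = *-cancelˡ-≤ (ι-mono-< {0} {suc i} (s≤s z≤n)) (begin
      ι (suc i) * b (suc i) ≡⟨ b-suc i ⟩
      v * b i - ι i * s * b i ≤⟨ a-b≤a (0≤*-pos (0≤*-pos (0≤ι i) 0≤s) (0≤b i)) ⟩
      v * b i ≤⟨ *-monoˡ 0≤v (b≤p i) ⟩
      v * p i ≡⟨ sym (p-suc i) ⟩
      ι (suc i) * p (suc i) ∎)
      where open ≤-Reasoning

    -- The quotient of `b i` by `p i` is the product of 1 - j/R over j < i, so the relative error is
    -- at most i²/R. It is stated multiplied by R to avoid the division.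
    p-b≤ : ∀ i → ι R * (p i - b i) ≤ ι i * ι i * p i
    p-b≤ zero = ≤-reflexive (trans (cong (λ u → ι R * (1ℚ * 1ℚ - u * 1ℚ)) (binom-0 R)) (trans (*-zeroʳ (ι R)) refl))
    p-b≤ (suc i) = *-cancelˡ-≤ (ι-mono-< {0} {suc i} (s≤s z≤n)) (begin
      K * (ρ * (p (suc i) - b (suc i))) ≡⟨ solve 4 (λ k r p b → k :* (r :* (p :- b)) := r :* (k :* p :- k :* b)) refl K ρ (p (suc i)) (b (suc i)) ⟩
      ρ * (K * p (suc i) - K * b (suc i)) ≡⟨ cong₂ (λ u w → ρ * (u - w)) (p-suc i) (b-suc i) ⟩
      ρ * (v * p i - (v * b i - I * s * b i))
        ≡⟨ solve 6 (λ r v p b i s → r :* (v :* p :- (v :* b :- i :* s :* b)) := v :* (r :* (p :- b)) :+ i :* (r :* s) :* b) refl ρ v (p i) (b i) I s ⟩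
      v * (ρ * (p i - b i)) + I * (ρ * s) * b i ≡⟨ cong (λ u → v * (ρ * (p i - b i)) + I * u * b i) Rs≡v ⟩
      v * (ρ * (p i - b i)) + I * v * b i ≤⟨ +-mono-≤ (*-monoˡ 0≤v (p-b≤ i)) (*-monoˡ (0≤*-pos (0≤ι i) 0≤v) (b≤p i)) ⟩
      v * (I * I * p i) + I * v * p i ≡⟨ trans (solve 3 (λ v i p → v :* (i :* i :* p) :+ i :* v :* p := i :* (con 1ℚ :+ i) :* (v :* p)) refl v I (p i))
        (cong₂ (λ u w → I * u * w) (sym (ι-suc i)) (sym (p-suc i))) ⟩
      I * K * (K * p (suc i)) ≤⟨ *-monoʳ (0≤*-pos (0≤ι (suc i)) (0≤p (suc i))) (*-monoʳ (0≤ι (suc i)) (ι-mono-≤ (ℕ.n≤1+n i))) ⟩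
      K * K * (K * p (suc i)) ≡⟨ solve 2 (λ k p → k :* k :* (k :* p) := k :* (k :* k :* p)) refl K (p (suc i)) ⟩
      K * (K * K * p (suc i)) ∎)
      where
      open ≤-Reasoning
      K = ι (suc i)
      I = ι i
      ρ = ι R

    -1^ : ℕ → ℚ
    -1^ i = (- 1ℚ) ^ i

    -1≤-1^≤1 : ∀ i → - 1ℚ ≤ -1^ i × -1^ i ≤ 1ℚ
    -1≤-1^≤1 zero    = ≤-trans (neg-antimono-≤ 0≤1) 0≤1 , ≤-refl
    -1≤-1^≤1 (suc i) with lo , hi ← -1≤-1^≤1 i =
      ≤-trans (neg-antimono-≤ hi) (≤-reflexive (neg≡ (-1^ i))) ,
      ≤-trans (≤-reflexive (sym (neg≡ (-1^ i)))) (neg-antimono-≤ lo)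
      where
      neg≡ : ∀ a → - a ≡ - 1ℚ * a
      neg≡ = solve 1 (λ a → :- a := con (- 1ℚ) :* a) refl

    neg-^ : ∀ x i → (- x) ^ i ≡ -1^ i * x ^ i
    neg-^ x i = trans (cong (_^ i) (solve 1 (λ x → :- x := con (- 1ℚ) :* x) refl x)) (^-distrib-* (- 1ℚ) x i)

  private
    errorSum : ℕ → ℚ
    errorSum J = sumBelow J λ i → ι i * ι i * p i

    expSum-binomSum : ∀ J → ι R * expSum J (- v) ≤ ι R * binomSum J R (- s) + errorSum J
    expSum-binomSum zero    = ≤-reflexive (solve 1 (λ r → r :* con 0ℚ := r :* con 0ℚ :+ con 0ℚ) refl (ι R))
    expSum-binomSum (suc J) = begin
      ρ * (expSum J (- v) + (- v) ^ J * 1/! J) ≡⟨ cong (λ u → ρ * (expSum J (- v) + u * 1/! J)) (neg-^ v J) ⟩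
      ρ * (expSum J (- v) + σ * v ^ J * 1/! J) ≡⟨ solve 6 (λ r e σ q f b → r :* (e :+ σ :* q :* f) := r :* e :+ (r :* (σ :* b) :+ σ :* (r :* (q :* f :- b)))) refl
        ρ (expSum J (- v)) σ (v ^ J) (1/! J) (b J) ⟩
      ρ * expSum J (- v) + (ρ * (σ * b J) + σ * (ρ * (p J - b J)))
        ≤⟨ +-mono-≤ (expSum-binomSum J) (+-monoʳ-≤ (ρ * (σ * b J)) (≤-trans (≤-trans (*-monoʳ 0≤e (proj₂ (-1≤-1^≤1 J))) (≤-reflexive (*-identityˡ _))) (p-b≤ J))) ⟩
      ρ * binomSum J R (- s) + errorSum J + (ρ * (σ * b J) + ι J * ι J * p J)
        ≡⟨ trans (solve 6 (λ r a w σ c d → r :* a :+ w :+ (r :* (σ :* c) :+ d) := r :* (a :+ σ :* c) :+ (w :+ d)) refl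
            ρ (binomSum J R (- s)) (errorSum J) σ (b J) (ι J * ι J * p J))
          (cong (λ u → ρ * (binomSum J R (- s) + u) + errorSum (suc J)) (trans
            (solve 3 (λ σ c q → σ :* (c :* q) := c :* (σ :* q)) refl σ (binom R J) (s ^ J)) (cong (binom R J *_) (sym (neg-^ s J))))) ⟩
      ρ * binomSum (suc J) R (- s) + errorSum (suc J) ∎
      where
      open ≤-Reasoning
      ρ = ι R
      σ = -1^ J
      0≤e : 0ℚ ≤ ρ * (p J - b J)
      0≤e = 0≤*-pos (0≤ι R) (≤⇒0≤- (b≤p J))

  -- The even truncation lies below (1 - s)^R ≤ 1. Replacing each `b i` by `p i` costs an error
  -- which, multiplied by R, is bounded in terms of v alone.
  expSum-neg-error : s ≤ 1ℚ → ∀ j → ι R * expSum (double j) (- v) ≤ ι R + sumBelow (double j) λ i → ι i * ι i * (v ^ i * 1/! i)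
  expSum-neg-error s≤1 j = ≤-trans (expSum-binomSum (double j)) (+-monoˡ-≤ (errorSum (double j))
    (≤-trans (*-monoˡ (0≤ι R) (≤-trans (bonferroni-even 0≤s s≤1 j R) (^≤1 R (≤⇒0≤- s≤1) (a-b≤a 0≤s)))) (≤-reflexive (*-identityʳ (ι R)))))

-- A rational u above log n is only known to satisfy n < exp u, so negative u
-- have to be excluded.  The bound follows from Bonferroni's inequalities for
-- (1 − v/R)^R as R grows.
expSum-neg : ∀ {v} → 0ℚ ≤ v → ∀ N → ∃ λ N′ → N ℕ.≤ N′ × expSum N′ (- v) ≤ ι 2
expSum-neg {v} 0≤v N = double N , n≤double N ,
  *-cancelˡ-≤ 0<R (≤-trans (expSum-neg-error {R} {s} 0≤s 0≤v Rs≡v s≤1 N)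
    (≤-trans (+-monoʳ-≤ (ι R) (≤-trans K≤ (ι-mono-≤ (ℕ.≤-trans (ℕ.m≤n+m K₁ K₂) (ℕ.n≤1+n (K₂ ℕ.+ K₁))))))
      (≤-reflexive (solve 1 (λ r → r :+ r := r :* con (ι 2)) refl (ι R)))))
  where
  K₂ = proj₁ (archimedean v)
  K₁ = proj₁ (archimedean (sumBelow (double N) λ i → ι i * ι i * (v ^ i * 1/! i)))
  K≤ = proj₂ (archimedean (sumBelow (double N) λ i → ι i * ι i * (v ^ i * 1/! i)))
  -- Large enough for v/R ≤ 1, which Bonferroni's inequalities need, and for the error bound, which
  -- does not involve R, to be at most R.
  R = suc (K₂ ℕ.+ K₁)
  0<R : 0ℚ < ι R
  0<R = ι-mono-< {0} {R} (s≤s z≤n)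
  r = proj₁ (recip 0<R)
  0≤r = <⇒≤ (proj₁ (proj₂ (recip 0<R)))
  Rr≡1 = proj₂ (proj₂ (recip 0<R))
  s = v * r
  0≤s : 0ℚ ≤ s
  0≤s = 0≤*-pos 0≤v 0≤r
  Rs≡v : ι R * s ≡ v
  Rs≡v = trans (solve 3 (λ a v r → a :* (v :* r) := v :* (a :* r)) refl (ι R) v r) (trans (cong (v *_) Rr≡1) (*-identityʳ v))
  s≤1 : s ≤ 1ℚ
  s≤1 = ≤-trans (*-monoʳ 0≤r (≤-trans (proj₂ (archimedean v)) (ι-mono-≤ (ℕ.≤-trans (ℕ.m≤m+n K₂ K₁) (ℕ.n≤1+n (K₂ ℕ.+ K₁)))))) (≤-reflexive Rr≡1)

-- Elementary estimates, and powers in place of logarithms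

archimedean-* : ∀ {p i b} j → p * i ≡ 1ℚ → 0ℚ ≤ p → b * i ≤ ι j → b ≤ p * ι j
archimedean-* {p} {i} {b} j pi≡1 0≤p bi≤j = ≤-trans
  (≤-reflexive (sym (trans (solve 3 (λ p b i → p :* (b :* i) := b :* (p :* i)) refl p b i) (trans (cong (b *_) pi≡1) (*-identityʳ b)))))
  (*-monoˡ 0≤p bi≤j)

n≤2q[n/q] : ∀ n q .{{_ : ℕ.NonZero q}} → 1 ℕ.≤ n ℕ./ q → n ℕ.≤ 2 ℕ.* q ℕ.* (n ℕ./ q)
n≤2q[n/q] n q 1≤a = begin
  n ≡⟨ m≡m%n+[m/n]*n n q ⟩
  n ℕ.% q ℕ.+ a ℕ.* q ≤⟨ ℕ.+-monoˡ-≤ (a ℕ.* q) (ℕ.≤-trans (ℕ.<⇒≤ (m%n<n n q))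
    (ℕ.≤-trans (ℕ.≤-reflexive (sym (ℕ.*-identityˡ q))) (ℕ.*-monoˡ-≤ q 1≤a))) ⟩
  a ℕ.* q ℕ.+ a ℕ.* q ≡⟨ arith a q ⟩
  2 ℕ.* q ℕ.* a ∎
  where
  open ℕ.≤-Reasoning
  a = n ℕ./ q
  arith : ∀ a q → a ℕ.* q ℕ.+ a ℕ.* q ≡ 2 ℕ.* q ℕ.* a
  arith = ℕ-Ring.solve-∀

floor : ∀ {c ρ} → 0ℚ < c → 0ℚ ≤ ρ → ∃ λ τ → ι τ * c ≤ ρ × ρ < ι (suc τ) * c
floor {c} {ρ} 0<c 0≤ρ with d , 0<d , cd≡1 ← recip 0<c = search K ρ<
  where
  K = proj₁ (archimedean (ρ * d))
  ρ< : ρ < ι (suc K) * c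
  ρ< = ≤-<-trans (≤-trans
    (≤-reflexive (sym (trans (*-assoc ρ d c) (trans (cong (ρ *_) (trans (*-comm d c) cd≡1)) (*-identityʳ ρ)))))
    (*-monoʳ (<⇒≤ 0<c) (proj₂ (archimedean (ρ * d)))))
    (subst₂ _<_ (*-comm c (ι K)) (*-comm c (ι (suc K))) (*-monoˡ-< 0<c (ι-mono-< (ℕ.n<1+n K))))
  search : ∀ j → ρ < ι (suc j) * c → ∃ λ τ → ι τ * c ≤ ρ × ρ < ι (suc τ) * c
  search zero    ρ<c = 0 , ≤-trans (≤-reflexive (*-zeroˡ c)) 0≤ρ , ρ<c
  search (suc j) ρ<c with ι (suc j) * c ℚ.≤? ρ
  ... | yes ≤ρ = suc j , ≤ρ , ρ<c
  ... | no  ≰ρ = search j (≰⇒> ≰ρ)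

[1+x]^[1-x]^≤1 : ∀ {x} n → 0ℚ ≤ x → x ≤ 1ℚ → (1ℚ + x) ^ n * (1ℚ - x) ^ n ≤ 1ℚ
[1+x]^[1-x]^≤1 {x} n 0≤x x≤1 = ≤-trans (≤-reflexive (sym (^-distrib-* (1ℚ + x) (1ℚ - x) n)))
  (^≤1 n (0≤*-pos (0≤+ 0≤1 0≤x) (≤⇒0≤- x≤1)) (≤-by (x * x) (0≤*-pos 0≤x 0≤x)
    (solve 1 (λ x → con 1ℚ := (con 1ℚ :+ x) :* (con 1ℚ :- x) :+ x :* x) refl x)))

-- (1 + x)^n ≤ (1 - x)^(-n) ≤ 1/(1 - nx), and 1/(1 - s) ≤ 1 + 2s for s ≤ 1/2.
^-≤-1+2nx : ∀ {x} n → 0ℚ ≤ x → x ≤ 1ℚ → ι 2 * (ι n * x) ≤ 1ℚ → (1ℚ + x) ^ n ≤ 1ℚ + ι 2 * (ι n * x)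
^-≤-1+2nx {x} n 0≤x x≤1 2nx≤1 = *-cancelʳ-≤ 0<1-s (begin
  (1ℚ + x) ^ n * (1ℚ - s) ≤⟨ *-monoˡ (0≤^ n (0≤+ 0≤1 0≤x)) (bernoulli⁻ n x≤1) ⟩
  (1ℚ + x) ^ n * (1ℚ - x) ^ n ≤⟨ [1+x]^[1-x]^≤1 n 0≤x x≤1 ⟩
  1ℚ ≤⟨ ≤-by (s * (1ℚ - ι 2 * s)) (0≤*-pos 0≤s (≤⇒0≤- 2nx≤1))
    (solve 1 (λ s → (con 1ℚ :+ con (ι 2) :* s) :* (con 1ℚ :- s) := con 1ℚ :+ s :* (con 1ℚ :- con (ι 2) :* s)) refl s) ⟩
  (1ℚ + ι 2 * s) * (1ℚ - s) ∎)
  where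
  open ≤-Reasoning
  s = ι n * x
  0≤s : 0ℚ ≤ s
  0≤s = 0≤*-pos (0≤ι n) 0≤x
  0<1-s : 0ℚ < 1ℚ - s
  0<1-s = *-cancelˡ-< (0≤ι 2) (<-≤-trans (≤-<-trans (≤-reflexive (*-zeroʳ (ι 2))) 0<1)
    (≤-by (1ℚ - ι 2 * s) (≤⇒0≤- 2nx≤1)
      (solve 1 (λ s → con (ι 2) :* (con 1ℚ :- s) := con 1ℚ :+ (con 1ℚ :- con (ι 2) :* s)) refl s)))

-- The exponent is split into two halves, each giving a power of at most 2, and one further factor 1
-- + r ≤ 2 in case m is odd.
[1+1/m]^m≤8 : ∀ {m r} → ι m * r ≡ 1ℚ → 0ℚ ≤ r → r ≤ 1ℚ → (1ℚ + r) ^ m ≤ ι 8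
[1+1/m]^m≤8 {m} {r} mr≡1 0≤r r≤1 = begin
  (1ℚ + r) ^ m ≤⟨ ^-monoʳ 1≤1+r m≤ ⟩
  (1ℚ + r) ^ suc (2 ℕ.* j) ≡⟨ cong ((1ℚ + r) *_) (trans (cong ((1ℚ + r) ^_) (ℕ.*-comm 2 j)) (^-* (1ℚ + r) j 2)) ⟩
  (1ℚ + r) * ((1ℚ + r) ^ j) ^ 2 ≤⟨ *-mono-≤ (0≤+ 0≤1 0≤r) (0≤^ 2 (0≤^ j (0≤+ 0≤1 0≤r))) (+-monoʳ-≤ 1ℚ r≤1) (^-mono 2 (0≤^ j (0≤+ 0≤1 0≤r)) half) ⟩
  ι 2 * ι 2 ^ 2 ∎
  where
  open ≤-Reasoning
  j = ℕ.⌊ m /2⌋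
  1≤1+r = a≤a+b {1ℚ} 0≤r
  m≤ : m ℕ.≤ suc (2 ℕ.* j)
  m≤ = ℕ.≤-trans (ℕ.≤-reflexive (sym (ℕ.⌊n/2⌋+⌈n/2⌉≡n m))) (ℕ.≤-trans (ℕ.+-monoʳ-≤ j (ℕ.⌊n/2⌋-mono (ℕ.n≤1+n (suc m))))
    (ℕ.≤-reflexive (trans (ℕ.+-suc j j) (cong (λ s → suc (j ℕ.+ s)) (sym (ℕ.+-identityʳ j))))))
  2j≤m : 2 ℕ.* j ℕ.≤ m
  2j≤m = ℕ.≤-trans (ℕ.≤-reflexive (cong (j ℕ.+_) (ℕ.+-identityʳ j))) (ℕ.≤-trans (ℕ.+-monoʳ-≤ j (ℕ.⌊n/2⌋≤⌈n/2⌉ m)) (ℕ.≤-reflexive (ℕ.⌊n/2⌋+⌈n/2⌉≡n m)))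
  2jr≤1 : ι 2 * (ι j * r) ≤ 1ℚ
  2jr≤1 = ≤-trans (≤-reflexive (trans (sym (*-assoc (ι 2) (ι j) r)) (cong (_* r) (sym (ι-* 2 j)))))
    (≤-trans (*-monoʳ 0≤r (ι-mono-≤ 2j≤m)) (≤-reflexive mr≡1))
  half : (1ℚ + r) ^ j ≤ ι 2
  half = ≤-trans (^-≤-1+2nx j 0≤r r≤1 2jr≤1) (+-monoʳ-≤ 1ℚ 2jr≤1)

nonempty-sum : ∀ n g → ∑ (subsets n) (λ S → 𝟙 (1 ℕ.≤? ∣ S ∣) * g ^ ∣ S ∣) + 1ℚ ≡ (1ℚ + g) ^ n
nonempty-sum zero    g = refl
nonempty-sum (suc n) g = begin
  ∑ (subsets (suc n)) (λ S → 𝟙 (1 ℕ.≤? ∣ S ∣) * g ^ ∣ S ∣) + 1ℚ ≡⟨ cong (_+ 1ℚ) (∑-subsets n _) ⟩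
  P + ∑ (subsets n) (λ S → 1ℚ * (g * g ^ ∣ S ∣)) + 1ℚ
    ≡⟨ cong (λ s → P + s + 1ℚ) (trans (∑-cong (subsets n) λ S → *-identityˡ (g * g ^ ∣ S ∣)) (trans (∑-*ˡ (subsets n) g _) (cong (g *_) (∑-subsets-^ n g)))) ⟩
  P + g * (1ℚ + g) ^ n + 1ℚ ≡⟨ solve 2 (λ p s → p :+ s :+ con 1ℚ := p :+ con 1ℚ :+ s) refl P (g * (1ℚ + g) ^ n) ⟩
  P + 1ℚ + g * (1ℚ + g) ^ n ≡⟨ cong (_+ g * (1ℚ + g) ^ n) (nonempty-sum n g) ⟩
  (1ℚ + g) ^ n + g * (1ℚ + g) ^ n ≡⟨ solve 2 (λ p g → p :+ g :* p := (con 1ℚ :+ g) :* p) refl ((1ℚ + g) ^ n) g ⟩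
  (1ℚ + g) ^ suc n ∎
  where
  open ≡-Reasoning
  P = ∑ (subsets n) (λ S → 𝟙 (1 ℕ.≤? ∣ S ∣) * g ^ ∣ S ∣)

-- The shape of the union bounds over vertex sets: if sets cost g per vertex and ng is small, all
-- nonempty sets together cost (1 + g)^n - 1, which is of the order of the singletons alone.
nonempty-sum-≤ : ∀ n {g} → 0ℚ ≤ g → g ≤ 1ℚ → ι 2 * (ι n * g) ≤ 1ℚ →
  ∑ (subsets n) (λ S → 𝟙 (1 ℕ.≤? ∣ S ∣) * g ^ ∣ S ∣) ≤ ι 2 * (ι n * g)
nonempty-sum-≤ n {g} 0≤g g≤1 2ng≤1 = ≤-by (1ℚ + ι 2 * (ι n * g) - (1ℚ + g) ^ n) (≤⇒0≤- (^-≤-1+2nx n 0≤g g≤1 2ng≤1))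
  (trans (solve 2 (λ p s → s := p :+ (con 1ℚ :+ s :- (p :+ con 1ℚ))) refl P (ι 2 * (ι n * g)))
    (cong (λ s → P + (1ℚ + ι 2 * (ι n * g) - s)) (nonempty-sum n g)))
  where
  P = ∑ (subsets n) (λ S → 𝟙 (1 ℕ.≤? ∣ S ∣) * g ^ ∣ S ∣)

-- For u ≤ 0 there are arbitrarily long partial sums of at most 2, whereas eventually all of them
-- exceed n; this is where 2 ≤ n enters.
<exp⇒ : ∀ {n u} → 2 ℕ.≤ n → ι n <ᶜ exp u → 0ℚ < u × ∃ λ N → ι n < expSum N u
<exp⇒ {n} {u} 2≤n (c , n<c , N , above) =
  ≰⇒> (λ u≤0 → contra (subst (λ u → ∃ λ N′ → N ℕ.≤ N′ × expSum N′ u ≤ ι 2)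
    (solve 1 (λ u → :- (:- u) := u) refl u) (expSum-neg (neg-antimono-≤ u≤0) N))) ,
  N , <-trans n<c (above N ℕ.≤-refl)
  where
  contra : ¬ ∃ λ N′ → N ℕ.≤ N′ × expSum N′ u ≤ ι 2
  contra (N′ , N≤N′ , ≤2) = <-irrefl refl (<-≤-trans (above N′ N≤N′)
    (≤-trans ≤2 (≤-trans (ι-mono-≤ 2≤n) (<⇒≤ n<c))))

exp<⇒ : ∀ {n l} → 0ℚ ≤ l → exp l ᶜ< ι n → ∀ N → expSum N l ≤ ι n
exp<⇒ 0≤l (c , c<n , N₀ , below) N = ≤-trans (expSum-mono-≤ 0≤l (ℕ.m≤m+n N N₀))
  (<⇒≤ (<-trans (below (N ℕ.+ N₀) (ℕ.m≤n+m N₀ N)) c<n))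

-- The logarithm in part (i): if log n < u and mu ≤ W, then n < exp u ≤ exp (W/m) ≤ (1 - 1/m)^(-W).
n[1-1/m]^W≤1 : ∀ {n m u r} → 2 ℕ.≤ n → ι n <ᶜ exp u → ι m * r ≡ 1ℚ → 0ℚ ≤ r → r ≤ 1ℚ →
  ∀ W → ι m * u ≤ ι W → ι n * (1ℚ - r) ^ W ≤ 1ℚ
n[1-1/m]^W≤1 {n} {m} {u} {r} 2≤n n<exp mr≡1 0≤r r≤1 W mu≤W = go (<exp⇒ {n} {u} 2≤n n<exp)
  where
  go : (0ℚ < u × ∃ λ N → ι n < expSum N u) → ι n * (1ℚ - r) ^ W ≤ 1ℚ
  go (0<u , N , n<) = ≤-trans (*-monoʳ (0≤^ W (≤⇒0≤- r≤1)) (≤-trans (<⇒≤ n<) (expSum-mono N (<⇒≤ 0<u) u≤Wr))) (expSum-upper 0≤r r≤1 W N)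
    where
    u≤Wr : u ≤ ι W * r
    u≤Wr = ≤-trans (≤-reflexive (sym (trans (solve 3 (λ m u r → m :* u :* r := u :* (m :* r)) refl (ι m) u r)
      (trans (cong (u *_) mr≡1) (*-identityʳ u))))) (*-monoʳ 0≤r mu≤W)

-- The logarithm in part (ii): if l < log n and Wt ≤ l, then (1 + t)^W ≤ exp (Wt) ≤ exp l < n.
[1+t]^W≤n : ∀ {n l t} → 0ℚ ≤ l → exp l ᶜ< ι n → 0ℚ ≤ t → ∀ W → ι W * t ≤ l → (1ℚ + t) ^ W ≤ ι n
[1+t]^W≤n {n} {l} {t} 0≤l exp<n 0≤t W Wt≤l = ≤-trans (expSum-lower 0≤t W)
  (≤-trans (expSum-mono (suc W) (0≤*-pos (0≤ι W) 0≤t) Wt≤l) (exp<⇒ {n} {l} 0≤l exp<n (suc W)))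

-- Disconnection

-- An indicator written as a product over the vertices outside S, so that their independence, given
-- the colours of S, turns its sum into a power.
isolation : ∀ {m n} → Subset n → Vec (Subset m) n → ℚ
isolation S F = ∏∉ (λ A → 𝟙 (disjoint? (⋃ ⊥ S F) A)) S F

small : ∀ {m n} → ℕ → Vec (Subset m) n → ℚ
small {n = n} t F = ∑ (subsets n) λ S → 𝟙 (1 ℕ.≤? ∣ S ∣) * (𝟙 (∣ S ∣ ℕ.≤? t) * isolation S F)

narrow : ∀ {m n} → ℕ → ℚ → ℚ → Vec (Subset m) n → ℚ
narrow {n = n} t v y F = ∑ (subsets n) λ T → 𝟙 (∣ T ∣ ℕ.≟ t) * (v ^ ∣ T ∣ * y ^ ∣ ⋃ ⊥ T F ∣)

cut-isolation : ∀ {m n} {F : Vec (Subset m) n} {S} → IsCut F S → 1ℚ ≤ isolation S F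
cut-isolation {F = F} {S} cut = 1≤∏∉ S F λ w w∉S → ≤-reflexive (sym (𝟙-yes (disjoint? (⋃ ⊥ S F) (lookup F w)) (cut-⋃ {F = F} {S} cut w w∉S)))

0≤isolation : ∀ {m n} S (F : Vec (Subset m) n) → 0ℚ ≤ isolation S F
0≤isolation S F = 0≤∏∉ (λ A → 0≤𝟙 (disjoint? (⋃ ⊥ S F) A)) S F

module _ {m n : ℕ} (t x : ℕ) {v y : ℚ} (0≤v : 0ℚ ≤ v) (0≤y : 0ℚ ≤ y) where

  private
    0≤small-term : ∀ (F : Vec (Subset m) n) S → 0ℚ ≤ 𝟙 (1 ℕ.≤? ∣ S ∣) * (𝟙 (∣ S ∣ ℕ.≤? t) * isolation S F)
    0≤small-term F S = 0≤*-pos (0≤𝟙 (1 ℕ.≤? ∣ S ∣)) (0≤*-pos (0≤𝟙 (∣ S ∣ ℕ.≤? t)) (0≤isolation S F))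

    0≤narrow-term : ∀ (F : Vec (Subset m) n) T → 0ℚ ≤ 𝟙 (∣ T ∣ ℕ.≟ t) * (v ^ ∣ T ∣ * y ^ ∣ ⋃ ⊥ T F ∣)
    0≤narrow-term F T = 0≤*-pos (0≤𝟙 (∣ T ∣ ℕ.≟ t)) (0≤*-pos (0≤^ ∣ T ∣ 0≤v) (0≤^ ∣ ⋃ ⊥ T F ∣ 0≤y))

  private
    nonempty-size : ∀ {F : Vec (Subset m) n} {S} → IsCut F S → 1 ℕ.≤ ∣ S ∣
    nonempty-size {S = S} ((u , u∈S) , _) = ℕ.≤-trans (ℕ.≤-reflexive (sym (∣⁅x⁆∣≡1 u)))
      (p⊆q⇒∣p∣≤∣q∣ λ {w} w∈ → subst (_∈ S) (sym (x∈⁅y⁆⇒x≡y u w∈)) u∈S)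

    small-cut : ∀ {F S} → IsCut F S → ∣ S ∣ ℕ.≤ t → 1ℚ ≤ small t F
    small-cut {F} {S} cut S≤t = ≤-trans
      (*-mono-≤ 0≤1 (0≤*-pos 0≤1 0≤1) (≤-reflexive (sym (𝟙-yes (1 ℕ.≤? ∣ S ∣) (nonempty-size {F} cut))))
        (*-mono-≤ 0≤1 0≤1 (≤-reflexive (sym (𝟙-yes (∣ S ∣ ℕ.≤? t) S≤t))) (cut-isolation {F = F} {S} cut)))
      (∑-∈ (subsets n) (0≤small-term F) (∈-subsets S))

  -- v^t y^x ≥ 1 turns the second sum into Markov's bound for ∣ ⋃ ⊥ T F ∣ ≤ x.
  disconnected-≤ : y ≤ 1ℚ → 1ℚ ≤ v ^ t * y ^ x → ∀ F (big : ℚ) → 0ℚ ≤ big →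
    (∀ S → IsCut F S → suc x ℕ.≤ ∣ ⋃ ⊥ S F ∣ → suc x ℕ.≤ ∣ ⋃ ⊥ (∁ S) F ∣ → 1ℚ ≤ big) →
    𝟙 (¬? (connected? (intersection? F))) ≤ small t F + (narrow t v y F + big)
  disconnected-≤ y≤1 1≤vy F big 0≤big big-cut = 𝟙≤ (¬? (connected? (intersection? F))) 0≤total λ ¬conn →
    decidable-stable (1ℚ ℚ.≤? total) λ ≰ → disconnected⇒cut F ¬conn λ (S , cut) → ≰ (main S cut)
    where
    total = small t F + (narrow t v y F + big)
    0≤small = 0≤∑ (subsets n) (0≤small-term F)
    0≤narrow = 0≤∑ (subsets n) (0≤narrow-term F)
    0≤total : 0ℚ ≤ total
    0≤total = 0≤+ 0≤small (0≤+ 0≤narrow 0≤big)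
    via-small : 1ℚ ≤ small t F → 1ℚ ≤ total
    via-small 1≤ = ≤-trans 1≤ (a≤a+b (0≤+ 0≤narrow 0≤big))
    via-rest : 1ℚ ≤ narrow t v y F + big → 1ℚ ≤ total
    via-rest 1≤ = ≤-trans 1≤ (≤-by (small t F) 0≤small (+-comm (small t F) (narrow t v y F + big)))
    via-narrow : 1ℚ ≤ narrow t v y F → 1ℚ ≤ total
    via-narrow 1≤ = via-rest (≤-trans 1≤ (a≤a+b 0≤big))
    via-big : 1ℚ ≤ big → 1ℚ ≤ total
    via-big 1≤ = via-rest (≤-trans 1≤ (≤-by (narrow t v y F) 0≤narrow (+-comm (narrow t v y F) big)))
    -- Of a large side only t vertices are looked at, since the bound on the generating function of
    -- the union does not reach beyond t. The whole side has at least as many colours.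
    large-side : ∀ S → t ℕ.≤ ∣ S ∣ → 1ℚ ≤ narrow t v y F ⊎ suc x ℕ.≤ ∣ ⋃ ⊥ S F ∣
    large-side S t≤S with subset-of-size S t t≤S
    ... | T , T⊆S , T≡t with ∣ ⋃ ⊥ T F ∣ ℕ.≤? x
    ...   | yes U≤x = inj₁ (≤-trans (≤-trans 1≤vy (≤-trans
      (*-monoˡ (0≤^ t 0≤v) (^-anti 0≤y y≤1 U≤x))
      (≤-reflexive (trans (cong (λ s → v ^ s * y ^ ∣ ⋃ ⊥ T F ∣) (sym T≡t))
        (sym (trans (cong (_* (v ^ ∣ T ∣ * y ^ ∣ ⋃ ⊥ T F ∣)) (𝟙-yes (∣ T ∣ ℕ.≟ t) T≡t)) (*-identityˡ _)))))))
      (∑-∈ (subsets n) (0≤narrow-term F) (∈-subsets T)))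
    ...   | no U≰x = inj₂ (ℕ.≤-trans (ℕ.≰⇒> U≰x) (p⊆q⇒∣p∣≤∣q∣ (⋃-mono {S = T} {S} F T⊆S)))
    main : ∀ S → IsCut F S → 1ℚ ≤ total
    main S cut with ∣ S ∣ ℕ.≤? t | ∣ ∁ S ∣ ℕ.≤? t
    ... | yes S≤t | _        = via-small (small-cut cut S≤t)
    ... | no _    | yes ∁S≤t = via-small (small-cut (cut-∁ {F = F} cut) ∁S≤t)
    ... | no S≰t  | no ∁S≰t with large-side S (ℕ.<⇒≤ (ℕ.≰⇒> S≰t)) | large-side (∁ S) (ℕ.<⇒≤ (ℕ.≰⇒> ∁S≰t))
    ...   | inj₁ 1≤ | _       = via-narrow 1≤
    ...   | inj₂ _  | inj₁ 1≤ = via-narrow 1≤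
    ...   | inj₂ x< | inj₂ x<′ = via-big (big-cut S cut x< x<′)

-- The probability of avoiding a set of colours

module Avoidance {m k : ℕ} {r : ℚ} (mr≡1 : ι m * r ≡ 1ℚ) (0≤r : 0ℚ ≤ r) (r≤1 : r ≤ 1ℚ) (k≤m : k ℕ.≤ m) where

  private
    Ω = subsetsOfSize m k
    N = binom m k

    N⁻¹ : ∃ λ s → 0ℚ < s × N * s ≡ 1ℚ
    N⁻¹ = recip (0<binom k≤m)
    s = proj₁ N⁻¹
    0≤s : 0ℚ ≤ s
    0≤s = <⇒≤ (proj₁ (proj₂ N⁻¹))

  normalise : ∀ {a b} → a ≤ b * N → a * s ≤ b
  normalise {a} {b} a≤bN = ≤-trans (*-monoʳ 0≤s a≤bN)
    (≤-reflexive (trans (*-assoc b N s) (trans (cong (b *_) (proj₂ (proj₂ N⁻¹))) (*-identityʳ b))))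

  unnormalise : ∀ a → N * (a * s) ≡ a
  unnormalise a = trans (solve 3 (λ n a s → n :* (a :* s) := a :* (n :* s)) refl N a s)
    (trans (cong (a *_) (proj₂ (proj₂ N⁻¹))) (*-identityʳ a))

  avoidance : Subset m → ℚ
  avoidance V = binom (m ℕ.∸ ∣ V ∣) k * s

  0≤avoidance : ∀ V → 0ℚ ≤ avoidance V
  0≤avoidance V = 0≤*-pos (0≤binom (m ℕ.∸ ∣ V ∣) k) 0≤s

  ∑-avoidance : ∀ V → ∑ Ω (λ A → 𝟙 (disjoint? V A)) ≡ N * avoidance V
  ∑-avoidance V = trans (∑-disjoint k V) (sym (unnormalise (binom (m ℕ.∸ ∣ V ∣) k)))

  binom-≤-^′ : ∀ a → a ℕ.≤ m → binom a k * s ≤ (ι a * r) ^ k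
  binom-≤-^′ a a≤m = normalise (binom-≤-^ mr≡1 0≤r a k a≤m k≤m)

  ι-∸-r : ∀ {x} → x ℕ.≤ m → ι (m ℕ.∸ x) * r ≡ 1ℚ - ι x * r
  ι-∸-r {x} x≤m = trans (cong (_* r) (ι-∸ x≤m))
    (trans (solve 3 (λ m x r → (m :- x) :* r := m :* r :- x :* r) refl (ι m) (ι x) r) (cong (_- ι x * r) mr≡1))

  avoidance-≤ : ∀ V → avoidance V ≤ (1ℚ - ι ∣ V ∣ * r) ^ k
  avoidance-≤ V = ≤-trans (binom-≤-^′ (m ℕ.∸ ∣ V ∣) (ℕ.m∸n≤m m ∣ V ∣)) (≤-reflexive (cong (_^ k) (ι-∸-r (∣p∣≤n V))))

  xr≤1 : ∀ {x} → x ℕ.≤ m → ι x * r ≤ 1ℚ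
  xr≤1 x≤m = ≤-trans (*-monoʳ 0≤r (ι-mono-≤ x≤m)) (≤-reflexive mr≡1)

  z : ℚ
  z = (1ℚ - r) ^ k

  0≤z : 0ℚ ≤ z
  0≤z = 0≤^ k (≤⇒0≤- r≤1)

  z≤1 : z ≤ 1ℚ
  z≤1 = ^≤1 k (≤⇒0≤- r≤1) (a-b≤a 0≤r)

  [1-xr]^k≤z^x : ∀ {x} → x ℕ.≤ m → (1ℚ - ι x * r) ^ k ≤ z ^ x
  [1-xr]^k≤z^x {x} x≤m = ≤-trans (^-mono k (≤⇒0≤- (xr≤1 x≤m)) (bernoulli⁻ x r≤1)) (≤-reflexive (^-comm (1ℚ - r) x k))

  avoidance≤z^ : ∀ V → avoidance V ≤ z ^ ∣ V ∣
  avoidance≤z^ V = ≤-trans (avoidance-≤ V) ([1-xr]^k≤z^x (∣p∣≤n V))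

  ∑-isolation : ∀ n (S : Subset n) (φ : Subset m → ℚ) →
    ∑ (assignments n m k) (λ F → φ (⋃ ⊥ S F) * isolation S F) ≡
    ∑ (assignments n m k) (λ F → φ (⋃ ⊥ S F) * avoidance (⋃ ⊥ S F) ^ (n ℕ.∸ ∣ S ∣))
  ∑-isolation n S φ = ∑-assignments Ω ∑-avoidance n ⊥ S φ

-- Union bounds over sets of colours and over the smaller side

splitBy : ∀ {m n} → Subset m → Vec (Subset m) n → ℚ
splitBy X F = ∏∉ (λ A → 𝟙 (disjoint? X A) + 𝟙 (disjoint? (∁ X) A)) ⊥ F

-- The colour sets of the two sides are disjoint, so one of them has at most m/2 elements. Taking
-- that one as X makes avoiding X the likelier of the two alternatives for a vertex.
colourSplit : ∀ {m n} → ℕ → Vec (Subset m) n → ℚ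
colourSplit {m} x F = ∑ (subsets m) λ X → 𝟙 (x ℕ.≤? ∣ X ∣) * (𝟙 (2 ℕ.* ∣ X ∣ ℕ.≤? m) * splitBy X F)

-- With S the side of at most n/2 vertices, at least n/2 vertices outside S have to avoid its
-- colours.
wide : ∀ {m n} → ℕ → Vec (Subset m) n → ℚ
wide {n = n} x F = ∑ (subsets n) λ S → 𝟙 (2 ℕ.* ∣ S ∣ ℕ.≤? n) * (𝟙 (x ℕ.≤? ∣ ⋃ ⊥ S F ∣) * isolation S F)

module _ {m n : ℕ} (x : ℕ) (F : Vec (Subset m) n) where

  private
    0≤split : ∀ (X A : Subset m) → 0ℚ ≤ 𝟙 (disjoint? X A) + 𝟙 (disjoint? (∁ X) A)
    0≤split X A = 0≤+ (0≤𝟙 (disjoint? X A)) (0≤𝟙 (disjoint? (∁ X) A))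

    0≤split-term : ∀ X → 0ℚ ≤ 𝟙 (x ℕ.≤? ∣ X ∣) * (𝟙 (2 ℕ.* ∣ X ∣ ℕ.≤? m) * splitBy X F)
    0≤split-term X = 0≤*-pos (0≤𝟙 (x ℕ.≤? ∣ X ∣)) (0≤*-pos (0≤𝟙 (2 ℕ.* ∣ X ∣ ℕ.≤? m)) (0≤∏∉ (0≤split X) ⊥ F))

    0≤wide-term : ∀ S → 0ℚ ≤ 𝟙 (2 ℕ.* ∣ S ∣ ℕ.≤? n) * (𝟙 (x ℕ.≤? ∣ ⋃ ⊥ S F ∣) * isolation S F)
    0≤wide-term S = 0≤*-pos (0≤𝟙 (2 ℕ.* ∣ S ∣ ℕ.≤? n)) (0≤*-pos (0≤𝟙 (x ℕ.≤? ∣ ⋃ ⊥ S F ∣)) (0≤isolation S F))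

    two-halves : ∀ {a b c} → a ℕ.+ b ℕ.≤ c → 2 ℕ.* a ℕ.≤ c ⊎ 2 ℕ.* b ℕ.≤ c
    two-halves {a} {b} a+b≤c with ℕ.≤-total a b
    ... | inj₁ a≤b = inj₁ (ℕ.≤-trans (ℕ.+-monoʳ-≤ a (ℕ.≤-trans (ℕ.≤-reflexive (ℕ.+-identityʳ a)) a≤b)) a+b≤c)
    ... | inj₂ b≤a = inj₂ (ℕ.≤-trans (ℕ.≤-trans (ℕ.+-monoʳ-≤ b (ℕ.≤-trans (ℕ.≤-reflexive (ℕ.+-identityʳ b)) b≤a)) (ℕ.≤-reflexive (ℕ.+-comm b a))) a+b≤c)

    1≤𝟙* : ∀ {P : Set} (P? : Dec P) {a} → P → 1ℚ ≤ a → 1ℚ ≤ 𝟙 P? * a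
    1≤𝟙* P? p 1≤a = *-mono-≤ 0≤1 0≤1 (≤-reflexive (sym (𝟙-yes P? p))) 1≤a

    split-⋃ : ∀ S → IsCut F S → x ℕ.≤ ∣ ⋃ ⊥ S F ∣ → 2 ℕ.* ∣ ⋃ ⊥ S F ∣ ℕ.≤ m → 1ℚ ≤ colourSplit x F
    split-⋃ S cut x≤ 2U≤m = ≤-trans (1≤𝟙* (x ℕ.≤? ∣ U ∣) x≤ (1≤𝟙* (2 ℕ.* ∣ U ∣ ℕ.≤? m) 2U≤m (1≤∏∉ ⊥ F λ w _ → 1≤split w)))
      (∑-∈ (subsets m) 0≤split-term (∈-subsets U))
      where
      U = ⋃ ⊥ S F
      1≤split : ∀ w → 1ℚ ≤ 𝟙 (disjoint? U (lookup F w)) + 𝟙 (disjoint? (∁ U) (lookup F w))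
      1≤split w with w ∈? S
      ... | no  w∉S = ≤-trans (≤-reflexive (sym (𝟙-yes (disjoint? U (lookup F w)) (cut-⋃ {F = F} {S} cut w w∉S)))) (a≤a+b (0≤𝟙 (disjoint? (∁ U) (lookup F w))))
      ... | yes w∈S = ≤-trans (≤-reflexive (sym (𝟙-yes (disjoint? (∁ U) (lookup F w)) inside-U)))
        (≤-by (𝟙 (disjoint? U (lookup F w))) (0≤𝟙 (disjoint? U (lookup F w))) (+-comm (𝟙 (disjoint? U (lookup F w))) _))
        where
        inside-U : Empty (∁ U ∩ lookup F w)
        inside-U (c , i) with c∈∁U , c∈w ← x∈p∩q⁻ (∁ U) (lookup F w) i = x∈∁p⇒x∉p c∈∁U (∈-⋃⁺ ⊥ S F (inj₂ (w , w∈S , c∈w)))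

    wide-⋃ : ∀ S → IsCut F S → x ℕ.≤ ∣ ⋃ ⊥ S F ∣ → 2 ℕ.* ∣ S ∣ ℕ.≤ n → 1ℚ ≤ wide x F
    wide-⋃ S cut x≤ 2S≤n = ≤-trans (1≤𝟙* (2 ℕ.* ∣ S ∣ ℕ.≤? n) 2S≤n (1≤𝟙* (x ℕ.≤? ∣ ⋃ ⊥ S F ∣) x≤ (cut-isolation {F = F} {S} cut)))
      (∑-∈ (subsets n) 0≤wide-term (∈-subsets S))

  0≤colourSplit : 0ℚ ≤ colourSplit x F
  0≤colourSplit = 0≤∑ (subsets m) 0≤split-term

  0≤wide : 0ℚ ≤ wide x F
  0≤wide = 0≤∑ (subsets n) 0≤wide-term

  cut-colourSplit : ∀ S → IsCut F S → x ℕ.≤ ∣ ⋃ ⊥ S F ∣ → x ℕ.≤ ∣ ⋃ ⊥ (∁ S) F ∣ → 1ℚ ≤ colourSplit x F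
  cut-colourSplit S cut x≤ x≤′ with two-halves {∣ ⋃ ⊥ S F ∣} {∣ ⋃ ⊥ (∁ S) F ∣} (ℕ.≤-trans (∣p∣+∣q∣≤∣p∪q∣ (⋃ ⊥ S F) (⋃ ⊥ (∁ S) F) apart) (∣p∣≤n (⋃ ⊥ S F ∪ ⋃ ⊥ (∁ S) F)))
    where
    apart : Empty (⋃ ⊥ S F ∩ ⋃ ⊥ (∁ S) F)
    apart (c , i) with c∈U , c∈U′ ← x∈p∩q⁻ (⋃ ⊥ S F) (⋃ ⊥ (∁ S) F) i with ∈-⋃⁻ ⊥ (∁ S) F c∈U′
    ... | inj₁ c∈⊥ = ∉⊥ c∈⊥
    ... | inj₂ (w , w∈∁S , c∈w) = cut-⋃ {F = F} {S} cut w (x∈∁p⇒x∉p w∈∁S) (c , x∈p∩q⁺ (c∈U , c∈w))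
  ... | inj₁ 2U≤m  = split-⋃ S cut x≤ 2U≤m
  ... | inj₂ 2U′≤m = split-⋃ (∁ S) (cut-∁ {F = F} cut) x≤′ 2U′≤m

  cut-wide : ∀ S → IsCut F S → x ℕ.≤ ∣ ⋃ ⊥ S F ∣ → x ℕ.≤ ∣ ⋃ ⊥ (∁ S) F ∣ → 1ℚ ≤ wide x F
  cut-wide S cut x≤ x≤′ with two-halves {∣ S ∣} {∣ ∁ S ∣} (ℕ.≤-reflexive (trans (cong (∣ S ∣ ℕ.+_) (∣∁p∣≡n∸∣p∣ S)) (ℕ.m+[n∸m]≡n (∣p∣≤n S))))
  ... | inj₁ 2S≤n  = wide-⋃ S cut x≤ 2S≤n
  ... | inj₂ 2∁S≤n = wide-⋃ (∁ S) (cut-∁ {F = F} cut) x≤′ 2∁S≤n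

∑∑-≤ : {A B : Set} (xs : List A) (ys : List B) {f : A → B → ℚ} {c b : B → ℚ} (N : ℚ) → (∀ y → 0ℚ ≤ c y) →
  (∀ y → ∑ xs (λ x → f x y) ≤ N * b y) → ∑ xs (λ x → ∑ ys (λ y → c y * f x y)) ≤ N * ∑ ys (λ y → c y * b y)
∑∑-≤ xs ys {f} {c} {b} N 0≤c f≤ = begin
  ∑ xs (λ x → ∑ ys (λ y → c y * f x y)) ≡⟨ ∑-swap xs ys _ ⟩
  ∑ ys (λ y → ∑ xs (λ x → c y * f x y)) ≡⟨ ∑-cong ys (λ y → ∑-*ˡ xs (c y) _) ⟩
  ∑ ys (λ y → c y * ∑ xs (λ x → f x y)) ≤⟨ ∑-mono ys (λ y → *-monoˡ (0≤c y) (f≤ y)) ⟩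
  ∑ ys (λ y → c y * (N * b y)) ≡⟨ ∑-cong ys (λ y → solve 3 (λ c n b → c :* (n :* b) := n :* (c :* b)) refl (c y) N (b y)) ⟩
  ∑ ys (λ y → N * (c y * b y)) ≡⟨ ∑-*ˡ ys N _ ⟩
  N * ∑ ys (λ y → c y * b y) ∎
  where open ≤-Reasoning

∑-subsets-const : ∀ m c → ∑ (subsets m) (λ _ → c) ≡ ι 2 ^ m * c
∑-subsets-const m c = trans (∑-cong (subsets m) λ S → sym (trans (cong (_* c) (1^ ∣ S ∣)) (*-identityˡ c)))
  (trans (∑-*ʳ (subsets m) (λ S → 1ℚ ^ ∣ S ∣) c) (cong (_* c) (∑-subsets-^ m 1ℚ)))

½ : ℚ
½ = ℚ.½

0≤½ : 0ℚ ≤ ½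
0≤½ = ℚ.*≤* (ℤ.+≤+ z≤n)

½≤1 : ½ ≤ 1ℚ
½≤1 = ℚ.*≤* (ℤ.+≤+ (s≤s z≤n))

2^*½^ : ∀ m → ι 2 ^ m * ½ ^ m ≡ 1ℚ
2^*½^ m = trans (sym (^-distrib-* (ι 2) ½ m)) (1^ m)

module _ {ρ : ℚ} (0≤ρ : 0ℚ ≤ ρ) (2ρ≤1 : ι 2 * ρ ≤ 1ℚ) where

  private
    ρ≤1-ρ : ρ ≤ 1ℚ - ρ
    ρ≤1-ρ = ≤-by (1ℚ - ι 2 * ρ) (≤⇒0≤- 2ρ≤1) (solve 1 (λ r → con 1ℚ :- r := r :+ (con 1ℚ :- con (ι 2) :* r)) refl ρ)

    0≤1-ρ : 0ℚ ≤ 1ℚ - ρ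
    0≤1-ρ = ≤-trans 0≤ρ ρ≤1-ρ

    1-ρ≤1 : 1ℚ - ρ ≤ 1ℚ
    1-ρ≤1 = a-b≤a 0≤ρ

  -- As ρ ≤ 1 - ρ, the sum is at most (ρ + (1 - ρ))(1 - ρ)^(k-1) = (1 - ρ)^(k-1), and 2(k - 1) ≥ k.
  -- For k = 1 the sum would be 1 and nothing would be gained.
  split-large : ∀ k → 2 ℕ.≤ k → (ρ ^ k + (1ℚ - ρ) ^ k) ^ 2 ≤ (1ℚ - ρ) ^ k
  split-large (suc zero) (s≤s ())
  split-large (suc (suc j)) _ = begin
    (ρ ^ k + w ^ k) ^ 2 ≤⟨ ^-mono 2 (0≤+ (0≤^ k 0≤ρ) (0≤^ k 0≤1-ρ)) base ⟩
    (w ^ suc j) ^ 2 ≡⟨ sym (^-* w (suc j) 2) ⟩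
    w ^ (suc j ℕ.* 2) ≤⟨ ^-anti 0≤1-ρ 1-ρ≤1 (s≤s (s≤s (ℕ.m≤m*n j 2))) ⟩
    w ^ k ∎
    where
    open ≤-Reasoning
    k = suc (suc j)
    w = 1ℚ - ρ
    base : ρ ^ k + w ^ k ≤ w ^ suc j
    base = ≤-trans (+-monoˡ-≤ (w ^ k) (*-monoˡ 0≤ρ (^-mono (suc j) 0≤ρ ρ≤1-ρ)))
      (≤-reflexive (solve 2 (λ r p → r :* p :+ (con 1ℚ :- r) :* p := p) refl ρ (w ^ suc j)))

  -- With w = 1 - ρ ≥ 1/2 and k ≥ 2, the summand ρ^k enlarges w^k only by the factor 1 + 4ρ², a
  -- second-order effect, while w^k itself is at most 1 - ρ. For 8qρ ≤ 1 one factor w^k therefore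
  -- pays for 2q such corrections, and a of them pay for all a + b ≤ 2qa.
  split-small : ∀ k q a b → 2 ℕ.≤ k → ι 8 * ι q * ρ ≤ 1ℚ → a ℕ.+ b ℕ.≤ 2 ℕ.* q ℕ.* a →
    (ρ ^ k + (1ℚ - ρ) ^ k) ^ (a ℕ.+ b) ≤ ((1ℚ - ρ) ^ k) ^ b
  split-small (suc zero) q a b (s≤s ())
  split-small k@(suc (suc j)) q a b _ 8qρ≤1 n≤2qa = begin
    (ρ ^ k + w ^ k) ^ (a ℕ.+ b) ≤⟨ ^-mono (a ℕ.+ b) (0≤+ (0≤^ k 0≤ρ) (0≤^ k 0≤1-ρ)) base ⟩
    (w ^ k * (1ℚ + s)) ^ (a ℕ.+ b) ≡⟨ ^-distrib-* (w ^ k) (1ℚ + s) (a ℕ.+ b) ⟩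
    (w ^ k) ^ (a ℕ.+ b) * (1ℚ + s) ^ (a ℕ.+ b) ≤⟨ *-monoˡ (0≤^ (a ℕ.+ b) (0≤^ k 0≤1-ρ)) (^-monoʳ (a≤a+b 0≤s) n≤2qa) ⟩
    (w ^ k) ^ (a ℕ.+ b) * (1ℚ + s) ^ (2 ℕ.* q ℕ.* a) ≡⟨ cong₂ _*_ (^-+ (w ^ k) a b) (^-* (1ℚ + s) (2 ℕ.* q) a) ⟩
    (w ^ k) ^ a * (w ^ k) ^ b * ((1ℚ + s) ^ (2 ℕ.* q)) ^ a
      ≡⟨ solve 3 (λ p u v → p :* u :* v := p :* v :* u) refl ((w ^ k) ^ a) ((w ^ k) ^ b) (((1ℚ + s) ^ (2 ℕ.* q)) ^ a) ⟩
    (w ^ k) ^ a * ((1ℚ + s) ^ (2 ℕ.* q)) ^ a * (w ^ k) ^ b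
      ≡⟨ cong (_* (w ^ k) ^ b) (sym (^-distrib-* (w ^ k) ((1ℚ + s) ^ (2 ℕ.* q)) a)) ⟩
    (w ^ k * (1ℚ + s) ^ (2 ℕ.* q)) ^ a * (w ^ k) ^ b
      ≤⟨ *-monoʳ (0≤^ b (0≤^ k 0≤1-ρ)) (^≤1 a (0≤*-pos (0≤^ k 0≤1-ρ) (0≤^ (2 ℕ.* q) (0≤+ 0≤1 0≤s))) bracket) ⟩
    1ℚ * (w ^ k) ^ b ≡⟨ *-identityˡ ((w ^ k) ^ b) ⟩
    (w ^ k) ^ b ∎
    where
    open ≤-Reasoning
    w = 1ℚ - ρ
    s = ι 4 * (ρ * ρ)
    0≤s : 0ℚ ≤ s
    0≤s = 0≤*-pos (0≤ι 4) (0≤*-pos 0≤ρ 0≤ρ)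
    1-ρ≥½ : 1ℚ ≤ ι 2 * w
    1-ρ≥½ = ≤-by (1ℚ - ι 2 * ρ) (≤⇒0≤- 2ρ≤1)
      (solve 1 (λ r → con (ι 2) :* (con 1ℚ :- r) := con 1ℚ :+ (con 1ℚ :- con (ι 2) :* r)) refl ρ)
    base : ρ ^ k + w ^ k ≤ w ^ k * (1ℚ + s)
    base = begin
      ρ ^ k + w ^ k ≤⟨ +-monoˡ-≤ (w ^ k) (*-monoˡ 0≤ρ (*-monoˡ 0≤ρ (^-mono j 0≤ρ ρ≤1-ρ))) ⟩
      ρ * (ρ * w ^ j) + w ^ k ≡⟨ cong (_+ w ^ k) (solve 2 (λ r p → r :* (r :* p) := con 1ℚ :* con 1ℚ :* (r :* r :* p)) refl ρ (w ^ j)) ⟩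
      1ℚ * 1ℚ * (ρ * ρ * w ^ j) + w ^ k
        ≤⟨ +-monoˡ-≤ (w ^ k) (*-monoʳ (0≤*-pos (0≤*-pos 0≤ρ 0≤ρ) (0≤^ j 0≤1-ρ)) (*-mono-≤ 0≤1 0≤1 1-ρ≥½ 1-ρ≥½)) ⟩
      ι 2 * w * (ι 2 * w) * (ρ * ρ * w ^ j) + w ^ k
        ≡⟨ solve 3 (λ w r p → con (ι 2) :* w :* (con (ι 2) :* w) :* (r :* r :* p) :+ w :* (w :* p) :=
             w :* (w :* p) :* (con 1ℚ :+ con (ι 4) :* (r :* r))) refl w ρ (w ^ j) ⟩
      w ^ k * (1ℚ + s) ∎
    s≤1 : s ≤ 1ℚ
    s≤1 = ≤-trans (≤-reflexive (solve 1 (λ r → con (ι 4) :* (r :* r) := con (ι 2) :* r :* (con (ι 2) :* r)) refl ρ))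
      (*-mono-≤ (0≤*-pos (0≤ι 2) 0≤ρ) (0≤*-pos (0≤ι 2) 0≤ρ) 2ρ≤1 2ρ≤1)
    w≤ : w ≤ (1ℚ - s) ^ (2 ℕ.* q)
    w≤ = begin
      1ℚ - ρ ≤⟨ ≤-by (ρ * (1ℚ - ι 8 * ι q * ρ)) (0≤*-pos 0≤ρ (≤⇒0≤- 8qρ≤1))
        (solve 2 (λ r q → con 1ℚ :- con (ι 2) :* q :* (con (ι 4) :* (r :* r)) := con 1ℚ :- r :+ r :* (con 1ℚ :- con (ι 8) :* q :* r)) refl ρ (ι q)) ⟩
      1ℚ - ι 2 * ι q * s ≡⟨ cong (λ u → 1ℚ - u * s) (sym (ι-* 2 q)) ⟩
      1ℚ - ι (2 ℕ.* q) * s ≤⟨ bernoulli⁻ (2 ℕ.* q) s≤1 ⟩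
      (1ℚ - s) ^ (2 ℕ.* q) ∎
    bracket : w ^ k * (1ℚ + s) ^ (2 ℕ.* q) ≤ 1ℚ
    bracket = begin
      w ^ k * (1ℚ + s) ^ (2 ℕ.* q) ≤⟨ *-monoʳ (0≤^ (2 ℕ.* q) (0≤+ 0≤1 0≤s)) (≤-trans (^≤ k 0≤1-ρ 1-ρ≤1 (s≤s z≤n)) w≤) ⟩
      (1ℚ - s) ^ (2 ℕ.* q) * (1ℚ + s) ^ (2 ℕ.* q) ≡⟨ *-comm ((1ℚ - s) ^ (2 ℕ.* q)) _ ⟩
      (1ℚ + s) ^ (2 ℕ.* q) * (1ℚ - s) ^ (2 ℕ.* q) ≤⟨ [1+x]^[1-x]^≤1 (2 ℕ.* q) 0≤s s≤1 ⟩
      1ℚ ∎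

-- Counting disconnected assignments for given parameters

module Connectivity {n m k a e q : ℕ} {r δ : ℚ}
  (2≤k : 2 ℕ.≤ k) (2k≤m : 2 ℕ.* k ℕ.≤ m) (mr≡1 : ι m * r ≡ 1ℚ) (0<r : 0ℚ < r)
  (2≤a : 2 ℕ.≤ a) (n≡e+6a : n ≡ e ℕ.+ 6 ℕ.* a) (1≤q : 1 ℕ.≤ q) (n≤2qa : n ℕ.≤ 2 ℕ.* q ℕ.* a)
  (nz^ke≤1 : ι n * ((1ℚ - r) ^ k) ^ (k ℕ.* e) ≤ 1ℚ)
  (0<δ : 0ℚ < δ) (2δ≤1 : ι 2 * δ ≤ 1ℚ) (ω≤δ : ((1ℚ - r) ^ k) ^ (a ℕ.* k) ≤ δ) where

  k≤m : k ℕ.≤ m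
  k≤m = ℕ.≤-trans (ℕ.m≤m+n k (k ℕ.+ 0)) 2k≤m

  0≤r : 0ℚ ≤ r
  0≤r = <⇒≤ 0<r

  2r≤1 : ι 2 * r ≤ 1ℚ
  2r≤1 = ≤-trans (*-monoʳ 0≤r (ι-mono-≤ (ℕ.≤-trans 2≤k k≤m))) (≤-reflexive mr≡1)

  r≤1-r : r ≤ 1ℚ - r
  r≤1-r = ≤-by (1ℚ - ι 2 * r) (≤⇒0≤- 2r≤1) (solve 1 (λ r → con 1ℚ :- r := r :+ (con 1ℚ :- con (ι 2) :* r)) refl r)

  0<1-r : 0ℚ < 1ℚ - r
  0<1-r = <-≤-trans 0<r r≤1-r

  r≤1 : r ≤ 1ℚ
  r≤1 = ≤-trans r≤1-r (a-b≤a 0≤r)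

  open Avoidance {m} {k} {r} mr≡1 0≤r r≤1 k≤m public

  -- How n = e + 6a is spent: b = n - a, because up to t ≤ a vertices belong to S; c = b - a, to
  -- make room for repeated colours; and the 4a left above e turn n z^(ke) ≤ 1 into ng ≤ ω^4. One
  -- factor ω pays for the weight v = 1/ω in Markov's inequality, and the others still give a bound
  -- by δ.
  b c : ℕ
  b = e ℕ.+ 5 ℕ.* a
  c = e ℕ.+ 4 ℕ.* a

  y γ g ω N : ℚ
  y = z ^ b
  γ = z ^ c
  g = γ ^ k
  ω = z ^ (a ℕ.* k)
  N = binom m k

  0<z : 0ℚ < z
  0<z = 0<^ k 0<1-r

  0≤y : 0ℚ ≤ y
  0≤y = 0≤^ b 0≤z

  y≤1 : y ≤ 1ℚ
  y≤1 = ^≤1 b 0≤z z≤1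

  0≤γ : 0ℚ ≤ γ
  0≤γ = 0≤^ c 0≤z

  γ≤1 : γ ≤ 1ℚ
  γ≤1 = ^≤1 c 0≤z z≤1

  0≤g : 0ℚ ≤ g
  0≤g = 0≤^ k 0≤γ

  0<ω : 0ℚ < ω
  0<ω = 0<^ (a ℕ.* k) 0<z

  ω≤1 : ω ≤ 1ℚ
  ω≤1 = ^≤1 (a ℕ.* k) 0≤z z≤1

  ω⁻¹ : ∃ λ v → 0ℚ < v × ω * v ≡ 1ℚ
  ω⁻¹ = recip 0<ω

  v : ℚ
  v = proj₁ ω⁻¹

  0≤v : 0ℚ ≤ v
  0≤v = <⇒≤ (proj₁ (proj₂ ω⁻¹))

  ωv≡1 : ω * v ≡ 1ℚ
  ωv≡1 = proj₂ (proj₂ ω⁻¹)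

  1≤a : 1 ℕ.≤ a
  1≤a = ℕ.≤-trans (s≤s z≤n) 2≤a

  a≤n : a ℕ.≤ n
  a≤n = ℕ.≤-trans (ℕ.m≤n+m a (e ℕ.+ 5 ℕ.* a)) (ℕ.≤-reflexive (trans (arith e a) (sym n≡e+6a)))
    where
    arith : ∀ e a → e ℕ.+ 5 ℕ.* a ℕ.+ a ≡ e ℕ.+ 6 ℕ.* a
    arith = ℕ-Ring.solve-∀

  1≤n : 1 ℕ.≤ n
  1≤n = ℕ.≤-trans 1≤a a≤n

  ng≤ω⁴ : ι n * g ≤ ω ^ 4
  ng≤ω⁴ = begin
    ι n * g ≡⟨ cong (ι n *_) (trans (sym (^-* z c k)) (trans (cong (z ^_) (arith e a k)) (^-+ z (k ℕ.* e) (a ℕ.* k ℕ.* 4)))) ⟩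
    ι n * (z ^ (k ℕ.* e) * z ^ (a ℕ.* k ℕ.* 4)) ≡⟨ trans (sym (*-assoc (ι n) (z ^ (k ℕ.* e)) _)) (cong (ι n * z ^ (k ℕ.* e) *_) (^-* z (a ℕ.* k) 4)) ⟩
    ι n * z ^ (k ℕ.* e) * ω ^ 4 ≤⟨ *-monoʳ (0≤^ 4 (<⇒≤ 0<ω)) nz^ke≤1 ⟩
    1ℚ * ω ^ 4 ≡⟨ *-identityˡ (ω ^ 4) ⟩
    ω ^ 4 ∎
    where
    open ≤-Reasoning
    arith : ∀ e a k → (e ℕ.+ 4 ℕ.* a) ℕ.* k ≡ k ℕ.* e ℕ.+ a ℕ.* k ℕ.* 4
    arith = ℕ-Ring.solve-∀

  ng≤δ : ι n * g ≤ δ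
  ng≤δ = ≤-trans ng≤ω⁴ (≤-trans (^≤ 4 (<⇒≤ 0<ω) ω≤1 (s≤s z≤n)) ω≤δ)

  nvg≤δ : ι n * (v * g) ≤ δ
  nvg≤δ = begin
    ι n * (v * g) ≡⟨ solve 3 (λ n v g → n :* (v :* g) := v :* (n :* g)) refl (ι n) v g ⟩
    v * (ι n * g) ≤⟨ *-monoˡ 0≤v ng≤ω⁴ ⟩
    v * (ω * ω ^ 3) ≡⟨ solve 3 (λ v ω p → v :* (ω :* p) := ω :* v :* p) refl v ω (ω ^ 3) ⟩
    ω * v * ω ^ 3 ≡⟨ trans (cong (_* ω ^ 3) ωv≡1) (*-identityˡ (ω ^ 3)) ⟩
    ω ^ 3 ≤⟨ ^≤ 3 (<⇒≤ 0<ω) ω≤1 (s≤s z≤n) ⟩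
    ω ≤⟨ ω≤δ ⟩
    δ ∎
    where open ≤-Reasoning

  δ≤1 : δ ≤ 1ℚ
  δ≤1 = ≤-trans (≤-by δ (<⇒≤ 0<δ) (solve 1 (λ d → con (ι 2) :* d := d :+ d) refl δ)) 2δ≤1

  vg≤1 : v * g ≤ 1ℚ
  vg≤1 = ≤-trans (≤-trans (≤-reflexive (sym (*-identityˡ (v * g)))) (*-monoʳ (0≤*-pos 0≤v 0≤g) (ι-mono-≤ 1≤n))) (≤-trans nvg≤δ δ≤1)

  y≡γz^a : y ≡ γ * z ^ a
  y≡γz^a = trans (cong (z ^_) (arith e a)) (^-+ z c a)
    where
    arith : ∀ e a → e ℕ.+ 5 ℕ.* a ≡ e ℕ.+ 4 ℕ.* a ℕ.+ a
    arith = ℕ-Ring.solve-∀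

  γ-y≡ : γ - y ≡ γ * (1ℚ - z ^ a)
  γ-y≡ = trans (cong (λ s → γ - s) y≡γz^a) (solve 2 (λ γ s → γ :- γ :* s := γ :* (con 1ℚ :- s)) refl γ (z ^ a))

  0≤1-z^a : 0ℚ ≤ 1ℚ - z ^ a
  0≤1-z^a = ≤⇒0≤- (^≤1 a 0≤z z≤1)

  0≤γ-y : 0ℚ ≤ γ - y
  0≤γ-y = ≤-trans (0≤*-pos 0≤γ 0≤1-z^a) (≤-reflexive (sym γ-y≡))

  0<kr : 0ℚ < ι k * r
  0<kr = 0<*-pos (ι-mono-< {0} (ℕ.≤-trans (s≤s z≤n) 2≤k)) 0<r

  -- t is the largest size for which the induction of ∑-y^⋃ works.
  τ-floor : ∃ λ τ → ι τ * (ι 2 * (ι k * r)) ≤ γ - y × γ - y < ι (suc τ) * (ι 2 * (ι k * r))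
  τ-floor = floor (0<*-pos (ι-mono-< {0} {2} (s≤s z≤n)) 0<kr) 0≤γ-y

  τ t : ℕ
  τ = proj₁ τ-floor
  -- The last of t vertices is added to the union of at most τ others, so the step bound is needed
  -- only for unions of at most τk colours.
  t = suc τ

  τ≤ : ι τ * (ι 2 * (ι k * r)) ≤ γ - y
  τ≤ = proj₁ (proj₂ τ-floor)

  -- By Bernoulli's inequality γ - y ≤ 1 - z^a ≤ ak/m, which forces 2τ ≤ a. It leaves at least b
  -- vertices outside any set of at most t vertices.
  t≤a : t ℕ.≤ a
  t≤a = go τ 2τ≤a
    where
    open ≤-Reasoning
    2τ≤a : τ ℕ.+ τ ℕ.≤ a
    2τ≤a = ι-cancel-≤ (*-cancelʳ-≤ 0<kr (begin
      ι (τ ℕ.+ τ) * (ι k * r) ≡⟨ cong (_* (ι k * r)) (ι-+ τ τ) ⟩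
      (ι τ + ι τ) * (ι k * r) ≡⟨ solve 2 (λ t k → (t :+ t) :* k := t :* (con (ι 2) :* k)) refl (ι τ) (ι k * r) ⟩
      ι τ * (ι 2 * (ι k * r)) ≤⟨ τ≤ ⟩
      γ - y ≡⟨ γ-y≡ ⟩
      γ * (1ℚ - z ^ a) ≤⟨ *-monoʳ 0≤1-z^a γ≤1 ⟩
      1ℚ * (1ℚ - z ^ a) ≡⟨ *-identityˡ (1ℚ - z ^ a) ⟩
      1ℚ - z ^ a ≤⟨ +-monoʳ-≤ 1ℚ (neg-antimono-≤ (≤-trans (bernoulli⁻ (k ℕ.* a) r≤1) (≤-reflexive (^-* (1ℚ - r) k a)))) ⟩
      1ℚ - (1ℚ - ι (k ℕ.* a) * r) ≡⟨ cong (λ s → 1ℚ - (1ℚ - s * r)) (ι-* k a) ⟩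
      1ℚ - (1ℚ - ι k * ι a * r) ≡⟨ solve 3 (λ k a r → con 1ℚ :- (con 1ℚ :- k :* a :* r) := a :* (k :* r)) refl (ι k) (ι a) r ⟩
      ι a * (ι k * r) ∎))
    go : ∀ τ → τ ℕ.+ τ ℕ.≤ a → suc τ ℕ.≤ a
    go zero    _ = 1≤a
    go (suc τ) p = ℕ.≤-trans (s≤s (s≤s (ℕ.m≤m+n τ τ))) (ℕ.≤-trans (ℕ.≤-reflexive (cong suc (sym (ℕ.+-suc τ τ)))) p)

  -- Without repetitions t vertices have kt colours; having at most x, about kt/(2q), counts as
  -- unusually few. Since b ≤ n ≤ 2qa, this x satisfies bx ≤ akt, that is y^x ≥ ω^t = v^(-t).
  x-floor : ∃ λ x → ι x * ι (2 ℕ.* q) ≤ ι (k ℕ.* t) × ι (k ℕ.* t) < ι (suc x) * ι (2 ℕ.* q)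
  x-floor = floor (ι-mono-< {0} (ℕ.≤-trans 1≤q (ℕ.m≤m+n q (q ℕ.+ 0)))) (0≤ι (k ℕ.* t))

  x : ℕ
  x = proj₁ x-floor

  -- Undoes both roundings: x + 1 colours are at least the fraction (γ - y)/(4q) of all colours.
  -- Both union bounds for large sides start from this.
  γ-y≤ : γ - y ≤ ι 4 * ι q * (ι (suc x) * r)
  γ-y≤ = begin
    γ - y ≤⟨ <⇒≤ (proj₂ (proj₂ τ-floor)) ⟩
    ι t * (ι 2 * (ι k * r)) ≡⟨ solve 3 (λ t k r → t :* (con (ι 2) :* (k :* r)) := con (ι 2) :* r :* (k :* t)) refl (ι t) (ι k) r ⟩
    ι 2 * r * (ι k * ι t) ≡⟨ cong (ι 2 * r *_) (sym (ι-* k t)) ⟩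
    ι 2 * r * ι (k ℕ.* t) ≤⟨ *-monoˡ (0≤*-pos (0≤ι 2) 0≤r) (<⇒≤ (proj₂ (proj₂ x-floor))) ⟩
    ι 2 * r * (ι (suc x) * ι (2 ℕ.* q)) ≡⟨ cong (λ s → ι 2 * r * (ι (suc x) * s)) (ι-* 2 q) ⟩
    ι 2 * r * (ι (suc x) * (ι 2 * ι q))
      ≡⟨ solve 3 (λ r x q → con (ι 2) :* r :* (x :* (con (ι 2) :* q)) := con (ι 4) :* q :* (x :* r)) refl r (ι (suc x)) (ι q) ⟩
    ι 4 * ι q * (ι (suc x) * r) ∎
    where open ≤-Reasoning

  1≤v^ty^x : 1ℚ ≤ v ^ t * y ^ x
  1≤v^ty^x = begin
    1ℚ ≡⟨ sym (trans (cong (_^ t) ωv≡1) (1^ t)) ⟩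
    (ω * v) ^ t ≡⟨ trans (^-distrib-* ω v t) (*-comm (ω ^ t) (v ^ t)) ⟩
    v ^ t * ω ^ t ≡⟨ cong (v ^ t *_) (sym (^-* z (a ℕ.* k) t)) ⟩
    v ^ t * z ^ (a ℕ.* k ℕ.* t) ≤⟨ *-monoˡ (0≤^ t 0≤v) (^-anti 0≤z z≤1 bx≤) ⟩
    v ^ t * z ^ (b ℕ.* x) ≡⟨ cong (v ^ t *_) (^-* z b x) ⟩
    v ^ t * y ^ x ∎
    where
    open ≤-Reasoning
    arith₁ : ∀ e a → e ℕ.+ 5 ℕ.* a ℕ.+ a ≡ e ℕ.+ 6 ℕ.* a
    arith₁ = ℕ-Ring.solve-∀
    arith₂ : ∀ q a x → 2 ℕ.* q ℕ.* a ℕ.* x ≡ a ℕ.* (x ℕ.* (2 ℕ.* q))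
    arith₂ = ℕ-Ring.solve-∀
    x2q≤kt : x ℕ.* (2 ℕ.* q) ℕ.≤ k ℕ.* t
    x2q≤kt = ι-cancel-≤ (≤-trans (≤-reflexive (ι-* x (2 ℕ.* q))) (proj₁ (proj₂ x-floor)))
    b≤n : b ℕ.≤ n
    b≤n = ℕ.≤-trans (ℕ.m≤m+n b a) (ℕ.≤-reflexive (trans (arith₁ e a) (sym n≡e+6a)))
    bx≤ : b ℕ.* x ℕ.≤ a ℕ.* k ℕ.* t
    bx≤ = ℕ.≤-trans (ℕ.*-monoˡ-≤ x (ℕ.≤-trans b≤n n≤2qa)) (ℕ.≤-trans (ℕ.≤-reflexive (arith₂ q a x))
      (ℕ.≤-trans (ℕ.*-monoʳ-≤ a x2q≤kt) (ℕ.≤-reflexive (sym (ℕ.*-assoc a k t)))))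

  Ωⁿ : List (Vec (Subset m) n)
  Ωⁿ = assignments n m k

  ∑-y^⋃ : ∀ (S : Subset n) → ∣ S ∣ ℕ.≤ t → ∑ Ωⁿ (λ F → y ^ ∣ ⋃ ⊥ S F ∣) ≤ N ^ n * g ^ ∣ S ∣
  ∑-y^⋃ S S≤t = ≤-trans (∑-^-⋃ 0≤y 0≤g step n 0 ⊥ S (ℕ.≤-reflexive (∣⊥∣≡0 m)) S≤t)
    (≤-reflexive (cong (N ^ n *_) (trans (cong (λ s → y ^ s * g ^ ∣ S ∣) (∣⊥∣≡0 m)) (*-identityˡ (g ^ ∣ S ∣)))))
    where
    open ≤-Reasoning
    step : ∀ i (V : Subset m) → suc i ℕ.≤ t → ∣ V ∣ ℕ.≤ i ℕ.* k → unionSum y k V ≤ N * (y ^ ∣ V ∣ * g)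
    step i V (s≤s i≤τ) V≤ = unionSum-≤ 0≤y {r = r} mr≡1 V y+≤γ 0≤γ k 2k≤m
      where
      y+≤γ : y + ι 2 * ι ∣ V ∣ * r ≤ γ
      y+≤γ = begin
        y + ι 2 * ι ∣ V ∣ * r ≤⟨ +-monoʳ-≤ y (*-monoʳ 0≤r (*-monoˡ (0≤ι 2) (ι-mono-≤ (ℕ.≤-trans V≤ (ℕ.*-monoˡ-≤ k i≤τ))))) ⟩
        y + ι 2 * ι (τ ℕ.* k) * r ≡⟨ cong (λ s → y + ι 2 * s * r) (ι-* τ k) ⟩
        y + ι 2 * (ι τ * ι k) * r ≡⟨ solve 4 (λ y t k r → y :+ con (ι 2) :* (t :* k) :* r := y :+ t :* (con (ι 2) :* (k :* r))) refl y (ι τ) (ι k) r ⟩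
        y + ι τ * (ι 2 * (ι k * r)) ≤⟨ +-monoʳ-≤ y τ≤ ⟩
        y + (γ - y) ≡⟨ solve 2 (λ y γ → y :+ (γ :- y) := γ) refl y γ ⟩
        γ ∎

  -- If S has at most t vertices and union U, at least b others have to avoid U, each with
  -- probability at most z^∣U∣. So S is isolated with conditional probability at most y^∣U∣, whose
  -- mean is at most g^∣S∣.
  ∑-small : ∑ Ωⁿ (small t) ≤ N ^ n * (ι 2 * δ)
  ∑-small = ≤-trans (∑∑-≤ Ωⁿ (subsets n) (N ^ n) (λ S → 0≤𝟙 (1 ℕ.≤? ∣ S ∣)) bound)
    (*-monoˡ (0≤^ n (0≤binom m k)) (≤-trans (nonempty-sum-≤ n 0≤g (^≤1 k 0≤γ γ≤1) (≤-trans (*-monoˡ (0≤ι 2) ng≤δ) 2δ≤1)) (*-monoˡ (0≤ι 2) ng≤δ)))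
    where
    open ≤-Reasoning
    bound : ∀ S → ∑ Ωⁿ (λ F → 𝟙 (∣ S ∣ ℕ.≤? t) * isolation S F) ≤ N ^ n * g ^ ∣ S ∣
    bound S = ≤-trans (≤-reflexive (∑-*ˡ Ωⁿ (𝟙 (∣ S ∣ ℕ.≤? t)) (isolation S)))
      (𝟙*-≤ (∣ S ∣ ℕ.≤? t) (0≤*-pos (0≤^ n (0≤binom m k)) (0≤^ ∣ S ∣ 0≤g)) by-size)
      where
      n∸S≥b : ∣ S ∣ ℕ.≤ t → b ℕ.≤ n ℕ.∸ ∣ S ∣
      n∸S≥b S≤t = ℕ.≤-trans (ℕ.≤-reflexive (trans (sym (ℕ.m+n∸n≡m b a)) (cong (ℕ._∸ a) (trans (arith e a) (sym n≡e+6a)))))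
        (ℕ.∸-monoʳ-≤ n (ℕ.≤-trans S≤t t≤a))
        where
        arith : ∀ e a → e ℕ.+ 5 ℕ.* a ℕ.+ a ≡ e ℕ.+ 6 ℕ.* a
        arith = ℕ-Ring.solve-∀
      avoidance^≤ : ∣ S ∣ ℕ.≤ t → ∀ V → avoidance V ^ (n ℕ.∸ ∣ S ∣) ≤ y ^ ∣ V ∣
      avoidance^≤ S≤t V = ≤-trans (^-mono (n ℕ.∸ ∣ S ∣) (0≤avoidance V) (avoidance≤z^ V))
        (≤-trans (^-anti (0≤^ ∣ V ∣ 0≤z) (^≤1 ∣ V ∣ 0≤z z≤1) (n∸S≥b S≤t)) (≤-reflexive (^-comm z ∣ V ∣ b)))
      by-size : ∣ S ∣ ℕ.≤ t → ∑ Ωⁿ (isolation S) ≤ N ^ n * g ^ ∣ S ∣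
      by-size S≤t = begin
        ∑ Ωⁿ (isolation S) ≡⟨ ∑-cong Ωⁿ (λ F → sym (*-identityˡ (isolation S F))) ⟩
        ∑ Ωⁿ (λ F → 1ℚ * isolation S F) ≡⟨ ∑-isolation n S (λ _ → 1ℚ) ⟩
        ∑ Ωⁿ (λ F → 1ℚ * avoidance (⋃ ⊥ S F) ^ (n ℕ.∸ ∣ S ∣))
          ≤⟨ ∑-mono Ωⁿ (λ F → ≤-trans (≤-reflexive (*-identityˡ _)) (avoidance^≤ S≤t (⋃ ⊥ S F))) ⟩
        ∑ Ωⁿ (λ F → y ^ ∣ ⋃ ⊥ S F ∣) ≤⟨ ∑-y^⋃ S S≤t ⟩
        N ^ n * g ^ ∣ S ∣ ∎

  -- A set of t vertices costs (vg)^t on average. Enlarging the sum to all nonempty sets loses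
  -- nothing essential, as n v g ≤ δ.
  ∑-narrow : ∑ Ωⁿ (narrow t v y) ≤ N ^ n * (ι 2 * δ)
  ∑-narrow = begin
    ∑ Ωⁿ (narrow t v y) ≡⟨ ∑-swap Ωⁿ (subsets n) _ ⟩
    ∑ (subsets n) (λ T → ∑ Ωⁿ (λ F → 𝟙 (∣ T ∣ ℕ.≟ t) * (v ^ ∣ T ∣ * y ^ ∣ ⋃ ⊥ T F ∣))) ≤⟨ ∑-mono (subsets n) bound ⟩
    ∑ (subsets n) (λ T → N ^ n * (𝟙 (1 ℕ.≤? ∣ T ∣) * (v * g) ^ ∣ T ∣)) ≡⟨ ∑-*ˡ (subsets n) (N ^ n) _ ⟩
    N ^ n * ∑ (subsets n) (λ T → 𝟙 (1 ℕ.≤? ∣ T ∣) * (v * g) ^ ∣ T ∣)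
      ≤⟨ *-monoˡ (0≤^ n (0≤binom m k)) (≤-trans (nonempty-sum-≤ n 0≤vg vg≤1 (≤-trans (*-monoˡ (0≤ι 2) nvg≤δ) 2δ≤1)) (*-monoˡ (0≤ι 2) nvg≤δ)) ⟩
    N ^ n * (ι 2 * δ) ∎
    where
    open ≤-Reasoning
    0≤vg : 0ℚ ≤ v * g
    0≤vg = 0≤*-pos 0≤v 0≤g
    bound : ∀ T → ∑ Ωⁿ (λ F → 𝟙 (∣ T ∣ ℕ.≟ t) * (v ^ ∣ T ∣ * y ^ ∣ ⋃ ⊥ T F ∣)) ≤ N ^ n * (𝟙 (1 ℕ.≤? ∣ T ∣) * (v * g) ^ ∣ T ∣)
    bound T = ≤-trans (≤-reflexive (∑-*ˡ Ωⁿ (𝟙 (∣ T ∣ ℕ.≟ t)) _))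
      (𝟙*-≤ (∣ T ∣ ℕ.≟ t) (0≤*-pos (0≤^ n (0≤binom m k)) (0≤*-pos (0≤𝟙 (1 ℕ.≤? ∣ T ∣)) (0≤^ ∣ T ∣ 0≤vg))) by-size)
      where
      s = ∑ Ωⁿ (λ F → v ^ ∣ T ∣ * y ^ ∣ ⋃ ⊥ T F ∣)
      by-size : ∣ T ∣ ≡ t → s ≤ N ^ n * (𝟙 (1 ℕ.≤? ∣ T ∣) * (v * g) ^ ∣ T ∣)
      by-size T≡t = begin
        s ≡⟨ ∑-*ˡ Ωⁿ (v ^ ∣ T ∣) _ ⟩
        v ^ ∣ T ∣ * ∑ Ωⁿ (λ F → y ^ ∣ ⋃ ⊥ T F ∣) ≤⟨ *-monoˡ (0≤^ ∣ T ∣ 0≤v) (∑-y^⋃ T (ℕ.≤-reflexive T≡t)) ⟩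
        v ^ ∣ T ∣ * (N ^ n * g ^ ∣ T ∣) ≡⟨ solve 3 (λ v n g → v :* (n :* g) := n :* (con 1ℚ :* (v :* g))) refl (v ^ ∣ T ∣) (N ^ n) (g ^ ∣ T ∣) ⟩
        N ^ n * (1ℚ * (v ^ ∣ T ∣ * g ^ ∣ T ∣)) ≡⟨ cong₂ (λ i j → N ^ n * (i * j))
          (sym (𝟙-yes (1 ℕ.≤? ∣ T ∣) (ℕ.≤-trans (s≤s z≤n) (ℕ.≤-reflexive (sym T≡t))))) (sym (^-distrib-* v g ∣ T ∣)) ⟩
        N ^ n * (𝟙 (1 ℕ.≤? ∣ T ∣) * (v * g) ^ ∣ T ∣) ∎

  ∑-disconnected : ∀ {big : Vec (Subset m) n → ℚ} {η} → (∀ F → 0ℚ ≤ big F) →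
    (∀ F S → IsCut F S → suc x ℕ.≤ ∣ ⋃ ⊥ S F ∣ → suc x ℕ.≤ ∣ ⋃ ⊥ (∁ S) F ∣ → 1ℚ ≤ big F) →
    ∑ Ωⁿ big ≤ N ^ n * η →
    ∑ Ωⁿ (λ F → 𝟙 (¬? (connected? (intersection? F)))) ≤ N ^ n * (ι 2 * δ + (ι 2 * δ + η))
  ∑-disconnected {big} {η} 0≤big big-cut ∑big≤ = begin
    ∑ Ωⁿ (λ F → 𝟙 (¬? (connected? (intersection? F))))
      ≤⟨ ∑-mono Ωⁿ (λ F → disconnected-≤ t x 0≤v 0≤y y≤1 1≤v^ty^x F (big F) (0≤big F) (big-cut F)) ⟩
    ∑ Ωⁿ (λ F → small t F + (narrow t v y F + big F)) ≡⟨ trans (∑-+ Ωⁿ (small t) _) (cong (∑ Ωⁿ (small t) +_) (∑-+ Ωⁿ (narrow t v y) big)) ⟩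
    ∑ Ωⁿ (small t) + (∑ Ωⁿ (narrow t v y) + ∑ Ωⁿ big) ≤⟨ +-mono-≤ ∑-small (+-mono-≤ ∑-narrow ∑big≤) ⟩
    N ^ n * (ι 2 * δ) + (N ^ n * (ι 2 * δ) + N ^ n * η)
      ≡⟨ solve 3 (λ n d e → n :* d :+ (n :* d :+ n :* e) := n :* (d :+ (d :+ e))) refl (N ^ n) (ι 2 * δ) η ⟩
    N ^ n * (ι 2 * δ + (ι 2 * δ + η)) ∎
    where open ≤-Reasoning

  private
    0≤N^n : 0ℚ ≤ N ^ n
    0≤N^n = 0≤^ n (0≤binom m k)

    ∑-Ωⁿ-const : ∀ u → ∑ Ωⁿ (λ _ → u) ≡ N ^ n * u
    ∑-Ωⁿ-const u = trans (∑-const Ωⁿ u) (cong (_* u) (length-vectors n (subsetsOfSize m k)))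

  -- The hypotheses say that z^(x+1) ≤ δ/4, by taking a root of order M + 1. At least j ≥ n/2
  -- vertices have to avoid x + 1 or more colours, with total probability at most (δ/4)^j ≤ δ
  -- 2^(-n); this beats the 2^n choices of S.
  ∑-wide : ∀ M → a ℕ.* k ℕ.≤ suc x ℕ.* suc M → ω ≤ (δ * (½ * ½)) ^ suc M → ∑ Ωⁿ (wide (suc x)) ≤ N ^ n * δ
  ∑-wide M ak≤ ω≤ = begin
    ∑ Ωⁿ (wide (suc x)) ≡⟨ ∑-swap Ωⁿ (subsets n) _ ⟩
    ∑ (subsets n) (λ S → ∑ Ωⁿ (λ F → 𝟙 (2 ℕ.* ∣ S ∣ ℕ.≤? n) * (𝟙 (suc x ℕ.≤? ∣ ⋃ ⊥ S F ∣) * isolation S F))) ≤⟨ ∑-mono (subsets n) bound ⟩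
    ∑ (subsets n) (λ _ → N ^ n * (½ ^ n * δ)) ≡⟨ ∑-subsets-const n _ ⟩
    ι 2 ^ n * (N ^ n * (½ ^ n * δ)) ≡⟨ solve 4 (λ t n h d → t :* (n :* (h :* d)) := t :* h :* (n :* d)) refl (ι 2 ^ n) (N ^ n) (½ ^ n) δ ⟩
    ι 2 ^ n * ½ ^ n * (N ^ n * δ) ≡⟨ trans (cong (_* (N ^ n * δ)) (2^*½^ n)) (*-identityˡ (N ^ n * δ)) ⟩
    N ^ n * δ ∎
    where
    open ≤-Reasoning
    θ = δ * (½ * ½)
    ζ = z ^ suc x
    0≤δ = <⇒≤ 0<δ
    0≤θ : 0ℚ ≤ θ
    0≤θ = 0≤*-pos 0≤δ (0≤*-pos 0≤½ 0≤½)
    ζ≤θ : ζ ≤ θ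
    ζ≤θ = ^-cancel-≤ M 0≤θ (≤-trans (≤-reflexive (sym (^-* z (suc x) (suc M)))) (≤-trans (^-anti 0≤z z≤1 ak≤) ω≤))
    bound : ∀ S → ∑ Ωⁿ (λ F → 𝟙 (2 ℕ.* ∣ S ∣ ℕ.≤? n) * (𝟙 (suc x ℕ.≤? ∣ ⋃ ⊥ S F ∣) * isolation S F)) ≤ N ^ n * (½ ^ n * δ)
    bound S = ≤-trans (≤-reflexive (∑-*ˡ Ωⁿ (𝟙 (2 ℕ.* ∣ S ∣ ℕ.≤? n)) _))
      (𝟙*-≤ (2 ℕ.* ∣ S ∣ ℕ.≤? n) (0≤*-pos 0≤N^n 0≤½^nδ) by-size)
      where
      j = n ℕ.∸ ∣ S ∣
      s = ∑ Ωⁿ (λ F → 𝟙 (suc x ℕ.≤? ∣ ⋃ ⊥ S F ∣) * isolation S F)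
      0≤½^nδ : 0ℚ ≤ ½ ^ n * δ
      0≤½^nδ = 0≤*-pos (0≤^ n 0≤½) 0≤δ
      by-size : 2 ℕ.* ∣ S ∣ ℕ.≤ n → s ≤ N ^ n * (½ ^ n * δ)
      by-size 2S≤n = begin
        s ≡⟨ ∑-isolation n S (λ V → 𝟙 (suc x ℕ.≤? ∣ V ∣)) ⟩
        ∑ Ωⁿ (λ F → 𝟙 (suc x ℕ.≤? ∣ ⋃ ⊥ S F ∣) * avoidance (⋃ ⊥ S F) ^ j) ≤⟨ ∑-mono Ωⁿ (λ F → 𝟙*-≤ (suc x ℕ.≤? ∣ ⋃ ⊥ S F ∣) 0≤½^nδ (pointwise (⋃ ⊥ S F))) ⟩
        ∑ Ωⁿ (λ _ → ½ ^ n * δ) ≡⟨ ∑-Ωⁿ-const (½ ^ n * δ) ⟩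
        N ^ n * (½ ^ n * δ) ∎
        where
        S+j≡n : ∣ S ∣ ℕ.+ j ≡ n
        S+j≡n = ℕ.m+[n∸m]≡n (∣p∣≤n S)
        n≤2j : n ℕ.≤ 2 ℕ.* j
        n≤2j = ℕ.+-cancelʳ-≤ n n (2 ℕ.* j) (ℕ.≤-trans (ℕ.≤-reflexive (trans (cong (λ s → s ℕ.+ s) (sym S+j≡n)) (arith ∣ S ∣ j)))
          (ℕ.+-monoʳ-≤ (2 ℕ.* j) 2S≤n))
          where
          arith : ∀ s j → s ℕ.+ j ℕ.+ (s ℕ.+ j) ≡ 2 ℕ.* j ℕ.+ 2 ℕ.* s
          arith = ℕ-Ring.solve-∀
        1≤j : 1 ℕ.≤ j
        1≤j = ℕ.n≢0⇒n>0 λ j≡0 → ℕ.<⇒≱ 1≤n (ℕ.≤-trans n≤2j (ℕ.≤-reflexive (cong (2 ℕ.*_) j≡0)))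
        ζ^j≤ : ζ ^ j ≤ ½ ^ n * δ
        ζ^j≤ = begin
          ζ ^ j ≤⟨ ^-mono j (0≤^ (suc x) 0≤z) ζ≤θ ⟩
          (δ * (½ * ½)) ^ j ≡⟨ trans (^-distrib-* δ (½ * ½) j) (*-comm (δ ^ j) _) ⟩
          (½ * ½) ^ j * δ ^ j ≡⟨ cong (_* δ ^ j) (sym (^-* ½ 2 j)) ⟩
          ½ ^ (2 ℕ.* j) * δ ^ j ≤⟨ *-mono-≤ (0≤^ (2 ℕ.* j) 0≤½) (0≤^ j 0≤δ) (^-anti 0≤½ ½≤1 n≤2j) (^≤ j 0≤δ δ≤1 1≤j) ⟩
          ½ ^ n * δ ∎
        pointwise : ∀ V → suc x ℕ.≤ ∣ V ∣ → avoidance V ^ j ≤ ½ ^ n * δ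
        pointwise V x≤ = ≤-trans (^-mono j (0≤avoidance V) (≤-trans (avoidance≤z^ V) (^-anti 0≤z z≤1 x≤))) ζ^j≤

  module _ {κ : ℚ} (0≤κ : 0ℚ ≤ κ) (2κ≤1 : ι 2 * κ ≤ 1ℚ) (64qκ≤δ : ι 64 * ι q * κ ≤ δ)
    (κ≤ : κ ≤ (δ * ½) ^ (16 ℕ.* q)) (z^a≤κ : z ^ a ≤ κ) where

    private
      0≤δ = <⇒≤ 0<δ
      s = ι (suc x) * r
      η = ι 8 * ι q * κ

      0≤s : 0ℚ ≤ s
      0≤s = 0≤*-pos (0≤ι (suc x)) 0≤r

      0≤η : 0ℚ ≤ η
      0≤η = 0≤*-pos (0≤*-pos (0≤ι 8) (0≤ι q)) 0≤κ

      8η≡ : ι 8 * η ≡ ι 64 * ι q * κ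
      8η≡ = solve 2 (λ q k → con (ι 8) :* (con (ι 8) :* q :* k) := con (ι 64) :* q :* k) refl (ι q) κ

      8η≤δ : ι 8 * η ≤ δ
      8η≤δ = ≤-trans (≤-reflexive 8η≡) 64qκ≤δ

      η≤1 : η ≤ 1ℚ
      η≤1 = ≤-trans (≤-by (ι 7 * η) (0≤*-pos (0≤ι 7) 0≤η) (solve 1 (λ h → con (ι 8) :* h := h :+ con (ι 7) :* h) refl η)) (≤-trans 8η≤δ δ≤1)

      -- As z^a ≤ 1/2, γ is at most twice the gap γ - y and hence at most 8qs, where s is the least
      -- density of the colours of a large side. A further factor z^a ≤ κ leads from γ to y.
      y≤ηs : y ≤ η * s
      y≤ηs = begin
        y ≡⟨ trans y≡γz^a (*-comm γ (z ^ a)) ⟩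
        z ^ a * γ ≤⟨ *-monoʳ 0≤γ z^a≤κ ⟩
        κ * γ ≤⟨ *-monoˡ 0≤κ γ≤ ⟩
        κ * (ι 8 * ι q * s) ≡⟨ solve 3 (λ k q s → k :* (con (ι 8) :* q :* s) := con (ι 8) :* q :* k :* s) refl κ (ι q) s ⟩
        η * s ∎
        where
        open ≤-Reasoning
        γ≤ : γ ≤ ι 8 * ι q * s
        γ≤ = begin
          γ ≤⟨ ≤-by (γ * (1ℚ - ι 2 * z ^ a)) (0≤*-pos 0≤γ (≤⇒0≤- (≤-trans (*-monoˡ (0≤ι 2) z^a≤κ) 2κ≤1)))
            (solve 2 (λ g p → con (ι 2) :* (g :* (con 1ℚ :- p)) := g :+ g :* (con 1ℚ :- con (ι 2) :* p)) refl γ (z ^ a)) ⟩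
          ι 2 * (γ * (1ℚ - z ^ a)) ≡⟨ cong (ι 2 *_) (sym γ-y≡) ⟩
          ι 2 * (γ - y) ≤⟨ *-monoˡ (0≤ι 2) γ-y≤ ⟩
          ι 2 * (ι 4 * ι q * s) ≡⟨ solve 2 (λ q s → con (ι 2) :* (con (ι 4) :* q :* s) := con (ι 8) :* q :* s) refl (ι q) s ⟩
          ι 8 * ι q * s ∎

      -- The weights s^∣X∣, with s = (x+1)/m, sum to (1 + s)^m, and the
      -- remaining factor η^∣X∣ is at most η^(x+1).
      ∑-y^ : ∑ (subsets m) (λ X → 𝟙 (suc x ℕ.≤? ∣ X ∣) * y ^ ∣ X ∣) ≤ δ
      ∑-y^ = begin
        ∑ (subsets m) (λ X → 𝟙 (suc x ℕ.≤? ∣ X ∣) * y ^ ∣ X ∣) ≤⟨ ∑-mono (subsets m) (λ X → 𝟙*-≤ (suc x ℕ.≤? ∣ X ∣) (0≤*-pos (0≤^ (suc x) 0≤η) (0≤^ ∣ X ∣ 0≤s)) (term X)) ⟩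
        ∑ (subsets m) (λ X → η ^ suc x * s ^ ∣ X ∣) ≡⟨ trans (∑-*ˡ (subsets m) (η ^ suc x) _) (cong (η ^ suc x *_) (∑-subsets-^ m s)) ⟩
        η ^ suc x * (1ℚ + s) ^ m ≤⟨ *-monoˡ (0≤^ (suc x) 0≤η) (^-mono m (0≤+ 0≤1 0≤s) (bernoulli (suc x) (0≤+ 0≤1 0≤r))) ⟩
        η ^ suc x * ((1ℚ + r) ^ suc x) ^ m ≡⟨ cong (η ^ suc x *_) (^-comm (1ℚ + r) (suc x) m) ⟩
        η ^ suc x * ((1ℚ + r) ^ m) ^ suc x
          ≤⟨ *-monoˡ (0≤^ (suc x) 0≤η) (^-mono (suc x) (0≤^ m (0≤+ 0≤1 0≤r)) ([1+1/m]^m≤8 {m} {r} mr≡1 0≤r r≤1)) ⟩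
        η ^ suc x * ι 8 ^ suc x ≡⟨ trans (sym (^-distrib-* η (ι 8) (suc x))) (cong (_^ suc x) (*-comm η (ι 8))) ⟩
        (ι 8 * η) ^ suc x ≤⟨ ^≤ (suc x) (0≤*-pos (0≤ι 8) 0≤η) (≤-trans 8η≤δ δ≤1) (s≤s z≤n) ⟩
        ι 8 * η ≤⟨ 8η≤δ ⟩
        δ ∎
        where
        open ≤-Reasoning
        term : ∀ X → suc x ℕ.≤ ∣ X ∣ → y ^ ∣ X ∣ ≤ η ^ suc x * s ^ ∣ X ∣
        term X x≤ = begin
          y ^ ∣ X ∣ ≤⟨ ^-mono ∣ X ∣ 0≤y y≤ηs ⟩
          (η * s) ^ ∣ X ∣ ≡⟨ ^-distrib-* η s ∣ X ∣ ⟩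
          η ^ ∣ X ∣ * s ^ ∣ X ∣ ≤⟨ *-monoʳ (0≤^ ∣ X ∣ 0≤s) (^-anti 0≤η η≤1 x≤) ⟩
          η ^ suc x * s ^ ∣ X ∣ ∎

      splitProbability : Subset m → ℚ
      splitProbability X = avoidance X + avoidance (∁ X)

      ∑-splitBy : ∀ X → ∑ Ωⁿ (splitBy X) ≡ N ^ n * splitProbability X ^ n
      ∑-splitBy X = begin
        ∑ Ωⁿ (splitBy X) ≡⟨ ∑-cong Ωⁿ (λ F → sym (*-identityˡ (splitBy X F))) ⟩
        ∑ Ωⁿ (λ F → 1ℚ * splitBy X F)
          ≡⟨ ∑-assignments (subsetsOfSize m k) {h = λ _ A → 𝟙 (disjoint? X A) + 𝟙 (disjoint? (∁ X) A)} {d = λ _ → splitProbability X}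
               (λ _ → trans (∑-+ (subsetsOfSize m k) _ _) (trans (cong₂ _+_ (∑-avoidance X) (∑-avoidance (∁ X)))
                 (sym (*-distribˡ-+ N (avoidance X) (avoidance (∁ X)))))) n ⊥ ⊥ (λ _ → 1ℚ) ⟩
        ∑ Ωⁿ (λ F → 1ℚ * splitProbability X ^ (n ℕ.∸ ∣ ⊥ {n = n} ∣)) ≡⟨ ∑-Ωⁿ-const _ ⟩
        N ^ n * (1ℚ * splitProbability X ^ (n ℕ.∸ ∣ ⊥ {n = n} ∣))
          ≡⟨ cong (N ^ n *_) (trans (*-identityˡ _) (cong (λ i → splitProbability X ^ (n ℕ.∸ i)) (∣⊥∣≡0 n))) ⟩
        N ^ n * splitProbability X ^ n ∎
        where open ≡-Reasoning

      0≤splitProbability : ∀ X → 0ℚ ≤ splitProbability X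
      0≤splitProbability X = 0≤+ (0≤avoidance X) (0≤avoidance (∁ X))

      splitProbability-≤ : ∀ X → splitProbability X ≤ (ι ∣ X ∣ * r) ^ k + (1ℚ - ι ∣ X ∣ * r) ^ k
      splitProbability-≤ X = ≤-trans (+-mono-≤ (avoidance-≤ X) (≤-trans
          (≤-reflexive (cong (λ i → binom i k * proj₁ (recip (0<binom k≤m))) (trans (cong (m ℕ.∸_) (∣∁p∣≡n∸∣p∣ X)) (ℕ.m∸[m∸n]≡n (∣p∣≤n X)))))
          (binom-≤-^′ ∣ X ∣ (∣p∣≤n X))))
        (≤-reflexive (+-comm ((1ℚ - ι ∣ X ∣ * r) ^ k) _))

      module _ (X : Subset m) (2X≤m : 2 ℕ.* ∣ X ∣ ℕ.≤ m) where

        private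
          p ρ : ℚ
          p = splitProbability X
          ρ = ι ∣ X ∣ * r

          0≤ρ : 0ℚ ≤ ρ
          0≤ρ = 0≤*-pos (0≤ι ∣ X ∣) 0≤r

          2ρ≤1 : ι 2 * ρ ≤ 1ℚ
          2ρ≤1 = ≤-trans (≤-reflexive (trans (sym (*-assoc (ι 2) (ι ∣ X ∣) r)) (cong (_* r) (sym (ι-* 2 ∣ X ∣))))) (xr≤1 2X≤m)

        -- Of the n = a + b factors, a are spent on removing the possibility of lying inside X; the
        -- other b give z^(b∣X∣).
        few-colours : 8 ℕ.* q ℕ.* ∣ X ∣ ℕ.≤ m → p ^ n ≤ y ^ ∣ X ∣
        few-colours 8qX≤m = begin
          p ^ n ≤⟨ ^-mono n (0≤splitProbability X) (splitProbability-≤ X) ⟩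
          (ρ ^ k + (1ℚ - ρ) ^ k) ^ n ≡⟨ cong ((ρ ^ k + (1ℚ - ρ) ^ k) ^_) n≡a+b ⟩
          (ρ ^ k + (1ℚ - ρ) ^ k) ^ (a ℕ.+ b) ≤⟨ split-small 0≤ρ 2ρ≤1 k q a b 2≤k 8qρ≤1 (ℕ.≤-trans (ℕ.≤-reflexive (sym n≡a+b)) n≤2qa) ⟩
          ((1ℚ - ρ) ^ k) ^ b ≤⟨ ^-mono b (0≤^ k (≤⇒0≤- (xr≤1 (∣p∣≤n X)))) ([1-xr]^k≤z^x (∣p∣≤n X)) ⟩
          (z ^ ∣ X ∣) ^ b ≡⟨ ^-comm z ∣ X ∣ b ⟩
          y ^ ∣ X ∣ ∎
          where
          open ≤-Reasoning
          8qρ≤1 : ι 8 * ι q * ρ ≤ 1ℚ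
          8qρ≤1 = ≤-trans (≤-reflexive (trans (sym (*-assoc (ι 8 * ι q) (ι ∣ X ∣) r))
            (cong (_* r) (trans (cong (_* ι ∣ X ∣) (sym (ι-* 8 q))) (sym (ι-* (8 ℕ.* q) ∣ X ∣)))))) (xr≤1 8qX≤m)
          n≡a+b : n ≡ a ℕ.+ b
          n≡a+b = trans n≡e+6a (arith e a)
            where
            arith : ∀ e a → e ℕ.+ 6 ℕ.* a ≡ a ℕ.+ (e ℕ.+ 5 ℕ.* a)
            arith = ℕ-Ring.solve-∀

        -- The bound is proved for powers of order 16q: a factor 2 comes from p² ≤ z^∣X∣ and a
        -- factor 8q from ∣X∣ ≥ m/(8q). The result (δ/2)^m is small enough for all 2^m sets X.
        many-colours : m ℕ.≤ 8 ℕ.* q ℕ.* ∣ X ∣ → p ^ n ≤ (δ * ½) ^ m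
        many-colours m≤8qX = root (16 ℕ.* q) (ℕ.≤-trans 1≤q (ℕ.m≤m+n q (15 ℕ.* q))) (begin
          (p ^ n) ^ (16 ℕ.* q) ≡⟨ trans (sym (^-* p n (16 ℕ.* q))) (trans (cong (p ^_) (arith₁ n q)) (^-* p 2 (8 ℕ.* q ℕ.* n))) ⟩
          (p ^ 2) ^ (8 ℕ.* q ℕ.* n) ≤⟨ ^-mono (8 ℕ.* q ℕ.* n) (0≤^ 2 (0≤splitProbability X)) p²≤ ⟩
          (z ^ ∣ X ∣) ^ (8 ℕ.* q ℕ.* n) ≡⟨ trans (sym (^-* z ∣ X ∣ (8 ℕ.* q ℕ.* n))) (cong (z ^_) (arith₂ ∣ X ∣ q n)) ⟩
          z ^ (n ℕ.* (8 ℕ.* q ℕ.* ∣ X ∣)) ≤⟨ ^-anti {z} {a ℕ.* m} {n ℕ.* (8 ℕ.* q ℕ.* ∣ X ∣)} 0≤z z≤1 (ℕ.*-mono-≤ a≤n m≤8qX) ⟩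
          z ^ (a ℕ.* m) ≡⟨ ^-* z a m ⟩
          (z ^ a) ^ m ≤⟨ ^-mono m (0≤^ a 0≤z) z^a≤κ ⟩
          κ ^ m ≤⟨ ^-mono m 0≤κ κ≤ ⟩
          ((δ * ½) ^ (16 ℕ.* q)) ^ m ≡⟨ ^-comm (δ * ½) (16 ℕ.* q) m ⟩
          ((δ * ½) ^ m) ^ (16 ℕ.* q) ∎)
          where
          open ≤-Reasoning
          p²≤ : p ^ 2 ≤ z ^ ∣ X ∣
          p²≤ = ≤-trans (^-mono 2 (0≤splitProbability X) (splitProbability-≤ X))
            (≤-trans (split-large 0≤ρ 2ρ≤1 k 2≤k) ([1-xr]^k≤z^x (∣p∣≤n X)))
          arith₁ : ∀ n q → n ℕ.* (16 ℕ.* q) ≡ 2 ℕ.* (8 ℕ.* q ℕ.* n)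
          arith₁ = ℕ-Ring.solve-∀
          arith₂ : ∀ x q n → x ℕ.* (8 ℕ.* q ℕ.* n) ≡ n ℕ.* (8 ℕ.* q ℕ.* x)
          arith₂ = ℕ-Ring.solve-∀
          root : ∀ i → 1 ℕ.≤ i → (p ^ n) ^ i ≤ ((δ * ½) ^ m) ^ i → p ^ n ≤ (δ * ½) ^ m
          root (suc i) _ = ^-cancel-≤ i (0≤^ m (0≤*-pos 0≤δ 0≤½))

        split-term : Dec (8 ℕ.* q ℕ.* ∣ X ∣ ℕ.≤ m) → p ^ n ≤ y ^ ∣ X ∣ ⊎ p ^ n ≤ (δ * ½) ^ m
        split-term (yes 8qX≤m) = inj₁ (few-colours 8qX≤m)
        split-term (no 8qX≰m)  = inj₂ (many-colours (ℕ.<⇒≤ (ℕ.≰⇒> 8qX≰m)))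

    ∑-colourSplit : ∑ Ωⁿ (colourSplit (suc x)) ≤ N ^ n * (δ + δ)
    ∑-colourSplit = ≤-trans (∑∑-≤ Ωⁿ (subsets m) (N ^ n) (λ X → 0≤𝟙 (suc x ℕ.≤? ∣ X ∣)) bound)
      (*-monoˡ 0≤N^n (begin
        ∑ (subsets m) (λ X → 𝟙 (suc x ℕ.≤? ∣ X ∣) * (y ^ ∣ X ∣ + (δ * ½) ^ m))
          ≤⟨ ∑-mono (subsets m) (λ X → ≤-trans (≤-reflexive (*-distribˡ-+ (𝟙 (suc x ℕ.≤? ∣ X ∣)) (y ^ ∣ X ∣) _))
               (+-monoʳ-≤ (𝟙 (suc x ℕ.≤? ∣ X ∣) * y ^ ∣ X ∣) (≤-trans (*-monoʳ 0≤[δ½]^m (𝟙≤1 (suc x ℕ.≤? ∣ X ∣))) (≤-reflexive (*-identityˡ ((δ * ½) ^ m)))))) ⟩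
        ∑ (subsets m) (λ X → 𝟙 (suc x ℕ.≤? ∣ X ∣) * y ^ ∣ X ∣ + (δ * ½) ^ m) ≡⟨ trans (∑-+ (subsets m) _ _) (cong (∑ (subsets m) (λ X → 𝟙 (suc x ℕ.≤? ∣ X ∣) * y ^ ∣ X ∣) +_) (∑-subsets-const m ((δ * ½) ^ m))) ⟩
        ∑ (subsets m) (λ X → 𝟙 (suc x ℕ.≤? ∣ X ∣) * y ^ ∣ X ∣) + ι 2 ^ m * (δ * ½) ^ m ≤⟨ +-mono-≤ ∑-y^ second ⟩
        δ + δ ∎))
      where
      open ≤-Reasoning
      0≤[δ½]^m : 0ℚ ≤ (δ * ½) ^ m
      0≤[δ½]^m = 0≤^ m (0≤*-pos 0≤δ 0≤½)
      second : ι 2 ^ m * (δ * ½) ^ m ≤ δ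
      second = begin
        ι 2 ^ m * (δ * ½) ^ m ≡⟨ cong (ι 2 ^ m *_) (^-distrib-* δ ½ m) ⟩
        ι 2 ^ m * (δ ^ m * ½ ^ m) ≡⟨ solve 3 (λ t d h → t :* (d :* h) := t :* h :* d) refl (ι 2 ^ m) (δ ^ m) (½ ^ m) ⟩
        ι 2 ^ m * ½ ^ m * δ ^ m ≡⟨ trans (cong (_* δ ^ m) (2^*½^ m)) (*-identityˡ (δ ^ m)) ⟩
        δ ^ m ≤⟨ ^≤ m 0≤δ δ≤1 (ℕ.≤-trans (s≤s z≤n) (ℕ.≤-trans 2≤k k≤m)) ⟩
        δ ∎
      bound : ∀ X → ∑ Ωⁿ (λ F → 𝟙 (2 ℕ.* ∣ X ∣ ℕ.≤? m) * splitBy X F) ≤ N ^ n * (y ^ ∣ X ∣ + (δ * ½) ^ m)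
      bound X = ≤-trans (≤-reflexive (∑-*ˡ Ωⁿ (𝟙 (2 ℕ.* ∣ X ∣ ℕ.≤? m)) (splitBy X)))
        (𝟙*-≤ (2 ℕ.* ∣ X ∣ ℕ.≤? m) (0≤*-pos 0≤N^n (0≤+ (0≤^ ∣ X ∣ 0≤y) 0≤[δ½]^m)) by-size)
        where
        by-size : 2 ℕ.* ∣ X ∣ ℕ.≤ m → ∑ Ωⁿ (splitBy X) ≤ N ^ n * (y ^ ∣ X ∣ + (δ * ½) ^ m)
        by-size 2X≤m = ≤-trans (≤-reflexive (∑-splitBy X)) (*-monoˡ 0≤N^n (either (split-term X 2X≤m (8 ℕ.* q ℕ.* ∣ X ∣ ℕ.≤? m))))
          where
          either : splitProbability X ^ n ≤ y ^ ∣ X ∣ ⊎ splitProbability X ^ n ≤ (δ * ½) ^ m → splitProbability X ^ n ≤ y ^ ∣ X ∣ + (δ * ½) ^ m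
          either (inj₁ ≤y) = ≤-trans ≤y (a≤a+b 0≤[δ½]^m)
          either (inj₂ ≤δ) = ≤-trans ≤δ (≤-by (y ^ ∣ X ∣) (0≤^ ∣ X ∣ 0≤y) (+-comm (y ^ ∣ X ∣) _))

-- From counts to probabilities

module _ {A : Set} {P : A → Set} (P? : Decidable₁ P) (Ω : List A) (0<Ω : 0ℚ < ι (length Ω)) where

  private
    L = ι (length Ω)
    p = uniformProbability Ω P?
    bad = ∑ Ω (λ ω → 𝟙 (¬? (P? ω)))

    proportion-* : ∀ a b → 0ℚ < ι b → proportion a b * ι b ≡ ι a
    proportion-* a zero    0<0 = ⊥-elim (<-irrefl refl 0<0)
    proportion-* a (suc b) _   = /-* a (suc b)

    L-pL≡bad : L * (1ℚ - p) ≡ bad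
    L-pL≡bad = begin
      L * (1ℚ - p) ≡⟨ solve 2 (λ l p → l :* (con 1ℚ :- p) := l :- p :* l) refl L p ⟩
      L - p * L ≡⟨ cong (λ s → L - s) (trans (proportion-* (length (filter P? Ω)) (length Ω) 0<Ω) (length-filter P? Ω)) ⟩
      L - ∑ Ω (λ ω → 𝟙 (P? ω)) ≡⟨ cong (_- ∑ Ω (λ ω → 𝟙 (P? ω))) (trans (sym (∑-1 Ω)) (trans (∑-cong Ω λ ω → sym (𝟙-¬ (P? ω))) (∑-+ Ω _ _))) ⟩
      ∑ Ω (λ ω → 𝟙 (P? ω)) + bad - ∑ Ω (λ ω → 𝟙 (P? ω)) ≡⟨ solve 2 (λ g b → g :+ b :- g := b) refl (∑ Ω (λ ω → 𝟙 (P? ω))) bad ⟩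
      bad ∎
      where open ≡-Reasoning

  probability-near-1 : ∀ {η ε} → bad ≤ L * η → η < ε → abs (p - 1ℚ) < ε
  probability-near-1 {η} bad≤ η<ε = ≤-<-trans (≤-trans (≤-reflexive abs≡) 1-p≤η) η<ε
    where
    0≤1-p : 0ℚ ≤ 1ℚ - p
    0≤1-p = *-cancelˡ-≤ 0<Ω (≤-trans (≤-reflexive (*-zeroʳ L)) (≤-trans (0≤∑ Ω λ ω → 0≤𝟙 (¬? (P? ω))) (≤-reflexive (sym L-pL≡bad))))
    1-p≤η : 1ℚ - p ≤ η
    1-p≤η = *-cancelˡ-≤ 0<Ω (≤-trans (≤-reflexive L-pL≡bad) bad≤)
    abs≡ : abs (p - 1ℚ) ≡ 1ℚ - p
    abs≡ = trans (sym (∣-p∣≡∣p∣ (p - 1ℚ))) (trans (cong abs (solve 1 (λ p → :- (p :- con 1ℚ) := con 1ℚ :- p) refl p)) (0≤p⇒∣p∣≡p 0≤1-p))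

length-assignments : ∀ n m k → ι (length (assignments n m k)) ≡ binom m k ^ n
length-assignments n m k = length-vectors n (subsetsOfSize m k)

-- The witness is an eighth of η/(η + 1), a quantity below both 1 and η. Six times δ is then
-- strictly less than η.
small-fraction : ∀ {η} → 0ℚ < η → ∃ λ δ → 0ℚ < δ × ι 2 * δ ≤ 1ℚ × ι 2 * δ + (ι 2 * δ + (δ + δ)) < η
small-fraction {η} 0<η = δ , 0<δ , 2δ≤1 , 6δ<η
  where
  s = proj₁ (recip 0<η)
  0<s = proj₁ (proj₂ (recip 0<η))
  0<1+s : 0ℚ < 1ℚ + s
  0<1+s = <-≤-trans 0<1 (a≤a+b (<⇒≤ 0<s))
  w = proj₁ (recip 0<1+s)
  0<w = proj₁ (proj₂ (recip 0<1+s))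
  [1+s]w≡1 = proj₂ (proj₂ (recip 0<1+s))
  ⅛ = ½ * ½ * ½
  δ = w * ⅛
  0<⅛ : 0ℚ < ⅛
  0<⅛ = *<* (ℤ.+<+ (s≤s z≤n))
  0<δ : 0ℚ < δ
  0<δ = 0<*-pos 0<w 0<⅛
  w≤1 : w ≤ 1ℚ
  w≤1 = ≤-trans (≤-by (s * w) (0≤*-pos (<⇒≤ 0<s) (<⇒≤ 0<w)) (solve 2 (λ s w → (con 1ℚ :+ s) :* w := w :+ s :* w) refl s w)) (≤-reflexive [1+s]w≡1)
  w≤η : w ≤ η
  w≤η = ≤-by (η * w) (0≤*-pos (<⇒≤ 0<η) (<⇒≤ 0<w)) (begin
    η ≡⟨ sym (trans (cong (η *_) [1+s]w≡1) (*-identityʳ η)) ⟩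
    η * ((1ℚ + s) * w) ≡⟨ solve 3 (λ e s w → e :* ((con 1ℚ :+ s) :* w) := e :* s :* w :+ e :* w) refl η s w ⟩
    η * s * w + η * w ≡⟨ cong (_+ η * w) (trans (cong (_* w) (proj₂ (proj₂ (recip 0<η)))) (*-identityˡ w)) ⟩
    w + η * w ∎)
    where open ≡-Reasoning
  2δ≤1 : ι 2 * δ ≤ 1ℚ
  2δ≤1 = ≤-trans (≤-by (ι 6 * δ) (0≤*-pos (0≤ι 6) (<⇒≤ 0<δ))
    (solve 1 (λ w → w := con (ι 2) :* (w :* con ⅛) :+ con (ι 6) :* (w :* con ⅛)) refl w)) w≤1
  6δ<η : ι 2 * δ + (ι 2 * δ + (δ + δ)) < η
  6δ<η = <-≤-trans (subst₂ _<_ refl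
      (solve 1 (λ w → con (ι 6) :* (w :* con ⅛) :+ con (ι 2) :* (w :* con ⅛) := w) refl w)
      (≤-<-trans (≤-reflexive (solve 1 (λ w → con (ι 2) :* (w :* con ⅛) :+ (con (ι 2) :* (w :* con ⅛) :+ (w :* con ⅛ :+ w :* con ⅛)) :=
          con (ι 6) :* (w :* con ⅛) :+ con 0ℚ) refl w))
        (+-monoʳ-< (ι 6 * δ) (0<*-pos (ι-mono-< {0} {2} (s≤s z≤n)) 0<δ)))) w≤η

-- Two sets of more than m/2 colours meet, so the graph is complete. This settles the range of k in
-- which unions of k-sets were not estimated.
dense-connected : ∀ {m n k} → m ℕ.< 2 ℕ.* k → ∀ {F} → F ∈ˡ assignments n m k → Connected (Intersection F)
dense-connected {m} {n} {k} m<2k {F} F∈ u v with u Fin.≟ v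
... | yes refl = ε
... | no  u≢v  = (u≢v , decidable-stable (nonempty? (lookup F u ∩ lookup F v)) meet) ◅ ε
  where
  size : ∀ w → ∣ lookup F w ∣ ≡ k
  size w = ∈-subsetsOfSize (∈-vectors n (subsetsOfSize m k) F∈ w)
  meet : ¬ Empty (lookup F u ∩ lookup F v)
  meet e = ℕ.<⇒≱ m<2k (ℕ.≤-trans (ℕ.≤-reflexive (cong₂ ℕ._+_ (sym (size u)) (trans (ℕ.+-identityʳ k) (sym (size v)))))
    (ℕ.≤-trans (∣p∣+∣q∣≤∣p∪q∣ (lookup F u) (lookup F v) e) (∣p∣≤n (lookup F u ∪ lookup F v))))

-- Choice of the parameters for connectivity

disconnections : ℕ → ℕ → ℕ → ℚ
disconnections n m k = ∑ (assignments n m k) (λ F → 𝟙 (¬? (connected? (intersection? F))))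

module _ {c δ : ℚ} (1<c : 1ℚ < c) (0<δ : 0ℚ < δ) (2δ≤1 : ι 2 * δ ≤ 1ℚ) where

  private
    0<c : 0ℚ < c
    0<c = <-trans 0<1 1<c

    0<c-1 : 0ℚ < c - 1ℚ
    0<c-1 = ≤-<-trans (≤-reflexive (sym (+-inverseʳ 1ℚ))) (+-monoˡ-< (- 1ℚ) 1<c)

    δ≤1 : δ ≤ 1ℚ
    δ≤1 = ≤-trans (≤-by δ (<⇒≤ 0<δ) (solve 1 (λ d → con (ι 2) :* d := d :+ d) refl δ)) 2δ≤1

    -- With a = n/q rounded down, q ≥ 6c/(c - 1) gives 6a ≤ (1 - 1/c)n: the six portions a cut off
    -- from n fit into the factor c by which the hypothesis exceeds the threshold.
    q₀ : ∃ λ q → ι 6 * c * proj₁ (recip 0<c-1) ≤ ι q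
    q₀ = archimedean (ι 6 * c * proj₁ (recip 0<c-1))

    q : ℕ
    q = 6 ℕ.+ proj₁ q₀

    6c≤[c-1]q : ι 6 * c ≤ (c - 1ℚ) * ι q
    6c≤[c-1]q = archimedean-* q (proj₂ (proj₂ (recip 0<c-1))) (<⇒≤ 0<c-1) (≤-trans (proj₂ q₀) (ι-mono-≤ (ℕ.m≤n+m (proj₁ q₀) 6)))

    0<64q : 0ℚ < ι 64 * ι q
    0<64q = 0<*-pos (ι-mono-< {0} {64} (s≤s z≤n)) (ι-mono-< {0} {q} (s≤s z≤n))

    σ : ℚ
    σ = proj₁ (recip 0<64q)

    0<σ : 0ℚ < σ
    0<σ = proj₁ (proj₂ (recip 0<64q))

    64qσ≡1 : ι 64 * ι q * σ ≡ 1ℚ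
    64qσ≡1 = proj₂ (proj₂ (recip 0<64q))

    σ≤1 : σ ≤ 1ℚ
    σ≤1 = ≤-trans (≤-trans (≤-reflexive (sym (*-identityˡ σ))) (*-monoʳ (<⇒≤ 0<σ) (≤-trans (ι-mono-≤ {1} {64 ℕ.* q} (s≤s z≤n)) (≤-reflexive (ι-* 64 q)))))
      (≤-reflexive 64qσ≡1)

    δ½ : ℚ
    δ½ = δ * ½

    0<δ½ : 0ℚ < δ½
    0<δ½ = 0<*-pos 0<δ (*<* (ℤ.+<+ (s≤s z≤n)))

    2δ½≡δ : ι 2 * δ½ ≡ δ
    2δ½≡δ = solve 1 (λ d → con (ι 2) :* (d :* con ½) := d) refl δ

    δ½≤δ : δ½ ≤ δ
    δ½≤δ = ≤-trans (*-monoˡ (<⇒≤ 0<δ) ½≤1) (≤-reflexive (*-identityʳ δ))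

    -- The value of z^a that separates the two union bounds. The power of δ/2 anticipates the root
    -- of order 16q in the bound for large X; the factor `σ` = 1/(64q) makes the sum over the other
    -- X at most δ.
    κ : ℚ
    κ = δ½ ^ (16 ℕ.* q) * σ

    0<κ : 0ℚ < κ
    0<κ = 0<*-pos (0<^ (16 ℕ.* q) 0<δ½) 0<σ

    δ½^≤δ½ : δ½ ^ (16 ℕ.* q) ≤ δ½
    δ½^≤δ½ = ^≤ (16 ℕ.* q) (<⇒≤ 0<δ½) (≤-trans δ½≤δ δ≤1) (s≤s z≤n)

    κ≤δ½^ : κ ≤ δ½ ^ (16 ℕ.* q)
    κ≤δ½^ = ≤-trans (*-monoˡ (0≤^ (16 ℕ.* q) (<⇒≤ 0<δ½)) σ≤1) (≤-reflexive (*-identityʳ _))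

    2κ≤1 : ι 2 * κ ≤ 1ℚ
    2κ≤1 = ≤-trans (*-monoˡ (0≤ι 2) (≤-trans κ≤δ½^ δ½^≤δ½)) (≤-trans (≤-reflexive 2δ½≡δ) δ≤1)

    64qκ≤δ : ι 64 * ι q * κ ≤ δ
    64qκ≤δ = begin
      ι 64 * ι q * (δ½ ^ (16 ℕ.* q) * σ) ≡⟨ solve 3 (λ a p s → a :* (p :* s) := a :* s :* p) refl (ι 64 * ι q) (δ½ ^ (16 ℕ.* q)) σ ⟩
      ι 64 * ι q * σ * δ½ ^ (16 ℕ.* q) ≡⟨ trans (cong (_* δ½ ^ (16 ℕ.* q)) 64qσ≡1) (*-identityˡ _) ⟩
      δ½ ^ (16 ℕ.* q) ≤⟨ ≤-trans δ½^≤δ½ δ½≤δ ⟩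
      δ ∎
      where open ≤-Reasoning

    κ′ : ℚ
    κ′ = κ ^ suc (2 ℕ.* q)

    0<κ′ : 0ℚ < κ′
    0<κ′ = 0<^ (suc (2 ℕ.* q)) 0<κ

    M₀ : ∃ λ M → ι 4 * ι q * proj₁ (recip 0<κ′) ≤ ι M
    M₀ = archimedean (ι 4 * ι q * proj₁ (recip 0<κ′))

    M : ℕ
    M = proj₁ M₀

    4q≤κ′M : ι 4 * ι q ≤ κ′ * ι (suc M)
    4q≤κ′M = archimedean-* (suc M) (proj₂ (proj₂ (recip 0<κ′))) (<⇒≤ 0<κ′) (≤-trans (proj₂ M₀) (ι-mono-≤ (ℕ.n≤1+n M)))

    θ θ′ : ℚ
    θ = δ * (½ * ½)
    θ′ = θ ^ suc M

    0<θ : 0ℚ < θ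
    0<θ = 0<*-pos 0<δ (*<* (ℤ.+<+ (s≤s z≤n)))

    0<θ′^ : 0ℚ < θ′ ^ (2 ℕ.* q)
    0<θ′^ = 0<^ (2 ℕ.* q) (0<^ (suc M) 0<θ)

    θ≤δ : θ ≤ δ
    θ≤δ = ≤-trans (*-monoˡ (<⇒≤ 0<δ) (*≤* (ℤ.+≤+ (s≤s z≤n)))) (≤-reflexive (*-identityʳ δ))

    θ′≤δ : θ′ ≤ δ
    θ′≤δ = ≤-trans (^≤ (suc M) (<⇒≤ 0<θ) (≤-trans θ≤δ δ≤1) (s≤s z≤n)) θ≤δ

    N₁ : ∃ λ N → proj₁ (recip 0<θ′^) ≤ ι N
    N₁ = archimedean (proj₁ (recip 0<θ′^))

    -- The last choice: q depends on c, κ on q and δ, M on κ and q, θ′ on δ and M. None involves m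
    -- or k, so the final bound is uniform in both. The first summand ensures nθ′^(2q) > 1, the
    -- second a ≥ 2.
    N₀ : ℕ
    N₀ = suc (proj₁ N₁) ℕ.+ 2 ℕ.* q

    1<nθ′^ : ∀ {n} → N₀ ℕ.≤ n → 1ℚ < ι n * θ′ ^ (2 ℕ.* q)
    1<nθ′^ {n} N₀≤n = ≤-<-trans (≤-reflexive (sym (proj₂ (proj₂ (recip 0<θ′^)))))
      (subst₂ _<_ refl (*-comm (θ′ ^ (2 ℕ.* q)) (ι n)) (*-monoˡ-< 0<θ′^ (≤-<-trans (proj₂ N₁) (ι-mono-< (ℕ.≤-trans (ℕ.m≤m+n (suc (proj₁ N₁)) (2 ℕ.* q)) N₀≤n)))))

  module _ {n m k : ℕ} (N₀≤n : N₀ ℕ.≤ n) (2≤k : 2 ℕ.≤ k) (2k≤m : 2 ℕ.* k ℕ.≤ m)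
    {u : ℚ} (n<exp : ι n <ᶜ exp u) (cmu<k²n : c * (ι m * u) < ι (k ℕ.^ 2 ℕ.* n)) where

    private
      a e : ℕ
      a = n ℕ./ q
      e = n ℕ.∸ 6 ℕ.* a

      2q≤n : 2 ℕ.* q ℕ.≤ n
      2q≤n = ℕ.≤-trans (ℕ.m≤n+m (2 ℕ.* q) (suc (proj₁ N₁))) N₀≤n

      2≤a : 2 ℕ.≤ a
      2≤a = ℕ.≤-trans (ℕ.≤-reflexive (sym (m*n/n≡m 2 q))) (/-monoˡ-≤ q 2q≤n)

      aq≤n : a ℕ.* q ℕ.≤ n
      aq≤n = m/n*n≤m n q

      6a≤n : 6 ℕ.* a ℕ.≤ n
      6a≤n = ℕ.≤-trans (ℕ.≤-reflexive (ℕ.*-comm 6 a)) (ℕ.≤-trans (ℕ.*-monoʳ-≤ a (ℕ.m≤m+n 6 (proj₁ q₀))) aq≤n)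

      n≡e+6a : n ≡ e ℕ.+ 6 ℕ.* a
      n≡e+6a = sym (ℕ.m∸n+n≡m 6a≤n)

      n≤2qa : n ℕ.≤ 2 ℕ.* q ℕ.* a
      n≤2qa = n≤2q[n/q] n q (ℕ.≤-trans (s≤s z≤n) 2≤a)

      2≤n : 2 ℕ.≤ n
      2≤n = ℕ.≤-trans (ℕ.m≤m+n 2 (4 ℕ.+ proj₁ q₀)) (ℕ.≤-trans (ℕ.m≤m+n q (q ℕ.+ 0)) 2q≤n)

      0<m : 0ℚ < ι m
      0<m = ι-mono-< {0} {m} (ℕ.≤-trans (s≤s z≤n) (ℕ.≤-trans 2≤k (ℕ.≤-trans (ℕ.m≤m+n k (k ℕ.+ 0)) 2k≤m)))

      r : ℚ
      r = proj₁ (recip 0<m)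

      0<r : 0ℚ < r
      0<r = proj₁ (proj₂ (recip 0<m))

      mr≡1 : ι m * r ≡ 1ℚ
      mr≡1 = proj₂ (proj₂ (recip 0<m))

      r≤1 : r ≤ 1ℚ
      r≤1 = ≤-trans (≤-trans (≤-reflexive (sym (*-identityˡ r))) (*-monoʳ (<⇒≤ 0<r) (ι-mono-≤ {1} {m} (ℕ.≤-trans (s≤s z≤n) (ℕ.≤-trans 2≤k (ℕ.≤-trans (ℕ.m≤m+n k (k ℕ.+ 0)) 2k≤m))))))
        (≤-reflexive mr≡1)

      -- Here c > 1 is spent: cmu < k²n ≤ ck²e leaves mu ≤ k²e, although e falls short of n by 6a.
      n≤ce : ι n ≤ c * ι e
      n≤ce = begin
        ι n ≡⟨ solve 2 (λ n c → n := c :* n :- (c :- con 1ℚ) :* n) refl (ι n) c ⟩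
        c * ι n - (c - 1ℚ) * ι n ≤⟨ +-monoʳ-≤ (c * ι n) (neg-antimono-≤ (begin
          ι 6 * c * ι a ≤⟨ *-monoʳ (0≤ι a) 6c≤[c-1]q ⟩
          (c - 1ℚ) * ι q * ι a ≡⟨ trans (solve 3 (λ d q a → d :* q :* a := d :* (a :* q)) refl (c - 1ℚ) (ι q) (ι a)) (cong ((c - 1ℚ) *_) (sym (ι-* a q))) ⟩
          (c - 1ℚ) * ι (a ℕ.* q) ≤⟨ *-monoˡ (<⇒≤ 0<c-1) (ι-mono-≤ aq≤n) ⟩
          (c - 1ℚ) * ι n ∎)) ⟩
        c * ι n - ι 6 * c * ι a ≡⟨ solve 3 (λ n c a → c :* n :- con (ι 6) :* c :* a := c :* (n :- con (ι 6) :* a)) refl (ι n) c (ι a) ⟩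
        c * (ι n - ι 6 * ι a) ≡⟨ cong (c *_) (trans (cong (λ s → ι n - s) (sym (ι-* 6 a))) (sym (ι-∸ 6a≤n))) ⟩
        c * ι e ∎
        where open ≤-Reasoning

      mu≤k[ke] : ι m * u ≤ ι (k ℕ.* (k ℕ.* e))
      mu≤k[ke] = *-cancelˡ-≤ 0<c (begin
        c * (ι m * u) ≤⟨ <⇒≤ cmu<k²n ⟩
        ι (k ℕ.^ 2 ℕ.* n) ≡⟨ ι-* (k ℕ.^ 2) n ⟩
        ι (k ℕ.^ 2) * ι n ≤⟨ *-monoˡ (0≤ι (k ℕ.^ 2)) n≤ce ⟩
        ι (k ℕ.^ 2) * (c * ι e) ≡⟨ solve 3 (λ k c e → k :* (c :* e) := c :* (k :* e)) refl (ι (k ℕ.^ 2)) c (ι e) ⟩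
        c * (ι (k ℕ.^ 2) * ι e) ≡⟨ cong (c *_) (trans (sym (ι-* (k ℕ.^ 2) e)) (cong ι (arith k e))) ⟩
        c * ι (k ℕ.* (k ℕ.* e)) ∎)
        where
        open ≤-Reasoning
        arith : ∀ k e → k ℕ.* (k ℕ.* 1) ℕ.* e ≡ k ℕ.* (k ℕ.* e)
        arith = ℕ-Ring.solve-∀

      nz^ke≤1 : ι n * ((1ℚ - r) ^ k) ^ (k ℕ.* e) ≤ 1ℚ
      nz^ke≤1 = ≤-trans (≤-reflexive (cong (ι n *_) (sym (^-* (1ℚ - r) k (k ℕ.* e)))))
        (n[1-1/m]^W≤1 {n} {m} {u} {r} 2≤n n<exp mr≡1 (<⇒≤ 0<r) r≤1 (k ℕ.* (k ℕ.* e)) mu≤k[ke])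

      z : ℚ
      z = (1ℚ - r) ^ k

      0≤z : 0ℚ ≤ z
      0≤z = 0≤^ k (≤⇒0≤- r≤1)

      z≤1 : z ≤ 1ℚ
      z≤1 = ^≤1 k (≤⇒0≤- r≤1) (a-b≤a (<⇒≤ 0<r))

      e≤n : e ℕ.≤ n
      e≤n = ℕ.m∸n≤m n (6 ℕ.* a)

      -- Since 2qa ≥ n ≥ e, ω^(2q) ≤ z^(ke) ≤ 1/n; thus ω is at most n^(-1/(2q)) and falls below any
      -- constant.
      ω≤θ′ : z ^ (a ℕ.* k) ≤ θ′
      ω≤θ′ = ≮⇒≥ λ θ′<ω → <-irrefl refl (<-≤-trans (1<nθ′^ N₀≤n) (begin
        ι n * θ′ ^ (2 ℕ.* q) ≤⟨ *-monoˡ (0≤ι n) (^-mono (2 ℕ.* q) (0≤^ (suc M) (<⇒≤ 0<θ)) (<⇒≤ θ′<ω)) ⟩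
        ι n * (z ^ (a ℕ.* k)) ^ (2 ℕ.* q) ≡⟨ cong (ι n *_) (sym (^-* z (a ℕ.* k) (2 ℕ.* q))) ⟩
        ι n * z ^ (a ℕ.* k ℕ.* (2 ℕ.* q)) ≤⟨ *-monoˡ (0≤ι n) (^-anti {z} {k ℕ.* e} {a ℕ.* k ℕ.* (2 ℕ.* q)} 0≤z z≤1 ke≤) ⟩
        ι n * z ^ (k ℕ.* e) ≤⟨ nz^ke≤1 ⟩
        1ℚ ∎))
        where
        open ≤-Reasoning
        arith : ∀ k q a → k ℕ.* (2 ℕ.* q ℕ.* a) ≡ a ℕ.* k ℕ.* (2 ℕ.* q)
        arith = ℕ-Ring.solve-∀
        ke≤ : k ℕ.* e ℕ.≤ a ℕ.* k ℕ.* (2 ℕ.* q)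
        ke≤ = ℕ.≤-trans (ℕ.*-monoʳ-≤ k (ℕ.≤-trans e≤n n≤2qa)) (ℕ.≤-reflexive (arith k q a))

      module C = Connectivity {n} {m} {k} {a} {e} {q} {r} {δ} 2≤k 2k≤m mr≡1 0<r 2≤a n≡e+6a (s≤s z≤n) n≤2qa nz^ke≤1 0<δ 2δ≤1 (≤-trans ω≤θ′ θ′≤δ)

      -- The gap from both sides. As c ≤ n ≤ 2qa, γ is at least κ^(2q), and 1 - z^a is at least κ
      -- ak/m, so the gap is at least κ′ ak/m. It is at most 4q(x + 1)/m. Comparing the two dictates
      -- the choices of `κ′` and of M ≥ 4q/κ′.
      ak≤ : κ ≤ z ^ a → a ℕ.* k ℕ.≤ suc C.x ℕ.* suc M
      ak≤ κ≤z^a = ι-cancel-≤ (*-cancelˡ-≤ 0<κ′ (*-cancelʳ-≤ 0<r (begin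
        κ′ * ι (a ℕ.* k) * r ≡⟨ trans (*-assoc κ′ (ι (a ℕ.* k)) r) (*-assoc κ (κ ^ (2 ℕ.* q)) (ι (a ℕ.* k) * r)) ⟩
        κ * (κ ^ (2 ℕ.* q) * (ι (a ℕ.* k) * r)) ≡⟨ solve 3 (λ k p s → k :* (p :* s) := p :* (s :* k)) refl κ (κ ^ (2 ℕ.* q)) (ι (a ℕ.* k) * r) ⟩
        κ ^ (2 ℕ.* q) * (ι (a ℕ.* k) * r * κ) ≤⟨ *-mono-≤ (0≤^ (2 ℕ.* q) (<⇒≤ 0<κ)) (0≤*-pos 0≤akr (<⇒≤ 0<κ)) κ^≤γ (≤-trans (*-monoˡ 0≤akr κ≤z^a) akrz≤) ⟩
        C.γ * (1ℚ - z ^ a) ≡⟨ sym C.γ-y≡ ⟩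
        C.γ - C.y ≤⟨ C.γ-y≤ ⟩
        ι 4 * ι q * (ι (suc C.x) * r) ≤⟨ *-monoʳ (0≤*-pos (0≤ι (suc C.x)) (<⇒≤ 0<r)) 4q≤κ′M ⟩
        κ′ * ι (suc M) * (ι (suc C.x) * r) ≡⟨ solve 4 (λ k m x r → k :* m :* (x :* r) := k :* (x :* m) :* r) refl κ′ (ι (suc M)) (ι (suc C.x)) r ⟩
        κ′ * (ι (suc C.x) * ι (suc M)) * r ≡⟨ cong (λ s → κ′ * s * r) (sym (ι-* (suc C.x) (suc M))) ⟩
        κ′ * ι (suc C.x ℕ.* suc M) * r ∎)))
        where
        open ≤-Reasoning
        0≤akr : 0ℚ ≤ ι (a ℕ.* k) * r
        0≤akr = 0≤*-pos (0≤ι (a ℕ.* k)) (<⇒≤ 0<r)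
        arith : ∀ q a → 2 ℕ.* q ℕ.* a ≡ a ℕ.* (2 ℕ.* q)
        arith = ℕ-Ring.solve-∀
        c≤n : C.c ℕ.≤ n
        c≤n = ℕ.≤-trans (ℕ.+-monoʳ-≤ e (ℕ.*-monoˡ-≤ a {4} {6} (s≤s (s≤s (s≤s (s≤s z≤n)))))) (ℕ.≤-reflexive (sym n≡e+6a))
        κ^≤γ : κ ^ (2 ℕ.* q) ≤ C.γ
        κ^≤γ = begin
          κ ^ (2 ℕ.* q) ≤⟨ ^-mono (2 ℕ.* q) (<⇒≤ 0<κ) κ≤z^a ⟩
          (z ^ a) ^ (2 ℕ.* q) ≡⟨ sym (^-* z a (2 ℕ.* q)) ⟩
          z ^ (a ℕ.* (2 ℕ.* q)) ≤⟨ ^-anti {z} {C.c} {a ℕ.* (2 ℕ.* q)} 0≤z z≤1 (ℕ.≤-trans c≤n (ℕ.≤-trans n≤2qa (ℕ.≤-reflexive (arith q a)))) ⟩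
          z ^ C.c ∎
        -- Equivalent to (1 + akr) z^a ≤ 1, which holds because 1 + akr ≤ (1 + r)^(ak) and (1 + r)(1
        -- - r) ≤ 1.
        akrz≤ : ι (a ℕ.* k) * r * z ^ a ≤ 1ℚ - z ^ a
        akrz≤ = begin
          ι (a ℕ.* k) * r * z ^ a ≡⟨ solve 2 (λ s p → s :* p := (con 1ℚ :+ s) :* p :- p) refl (ι (a ℕ.* k) * r) (z ^ a) ⟩
          (1ℚ + ι (a ℕ.* k) * r) * z ^ a - z ^ a ≤⟨ +-monoˡ-≤ (- z ^ a) (begin
            (1ℚ + ι (a ℕ.* k) * r) * z ^ a ≤⟨ *-monoʳ (0≤^ a 0≤z) (bernoulli (a ℕ.* k) (0≤+ 0≤1 (<⇒≤ 0<r))) ⟩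
            (1ℚ + r) ^ (a ℕ.* k) * z ^ a ≡⟨ cong ((1ℚ + r) ^ (a ℕ.* k) *_) (trans (sym (^-* (1ℚ - r) k a)) (cong ((1ℚ - r) ^_) (ℕ.*-comm k a))) ⟩
            (1ℚ + r) ^ (a ℕ.* k) * (1ℚ - r) ^ (a ℕ.* k) ≤⟨ [1+x]^[1-x]^≤1 (a ℕ.* k) (<⇒≤ 0<r) r≤1 ⟩
            1ℚ ∎) ⟩
          1ℚ - z ^ a ∎

      0≤N^n : 0ℚ ≤ binom m k ^ n
      0≤N^n = 0≤^ n (0≤binom m k)

    sparse-disconnections-≤ : Dec (z ^ a ≤ κ) → disconnections n m k ≤ binom m k ^ n * (ι 2 * δ + (ι 2 * δ + (δ + δ)))
    sparse-disconnections-≤ (yes z^a≤κ) = C.∑-disconnected (0≤colourSplit (suc C.x)) (cut-colourSplit (suc C.x))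
      (C.∑-colourSplit (<⇒≤ 0<κ) 2κ≤1 64qκ≤δ κ≤δ½^ z^a≤κ)
    sparse-disconnections-≤ (no z^a≰κ) = C.∑-disconnected (0≤wide (suc C.x)) (cut-wide (suc C.x))
      (≤-trans (C.∑-wide M (ak≤ (<⇒≤ (≰⇒> z^a≰κ))) ω≤θ′) (*-monoˡ 0≤N^n (a≤a+b (<⇒≤ 0<δ))))

  disconnections-≤ : Eventually λ n → ∀ m k → 2 ℕ.≤ k → c <ᶜ (k ℕ.^ 2 ℕ.* n) ÷ m · log n →
    disconnections n m k ≤ binom m k ^ n * (ι 2 * δ + (ι 2 * δ + (δ + δ)))
  disconnections-≤ = N₀ , λ n N₀≤n m k 2≤k (U , (u , n<exp , mu<U) , cU<k²n) → case n m k N₀≤n 2≤k n<exp (<-trans (*-monoˡ-< 0<c mu<U) cU<k²n) (2 ℕ.* k ℕ.≤? m)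
    where
    0≤δ = <⇒≤ 0<δ
    case : ∀ n m k → N₀ ℕ.≤ n → 2 ℕ.≤ k → ∀ {u} → ι n <ᶜ exp u → c * (ι m * u) < ι (k ℕ.^ 2 ℕ.* n) → Dec (2 ℕ.* k ℕ.≤ m) →
      disconnections n m k ≤ binom m k ^ n * (ι 2 * δ + (ι 2 * δ + (δ + δ)))
    case n m k N₀≤n 2≤k {u} n<exp cmu<k²n (yes 2k≤m) = sparse-disconnections-≤ N₀≤n 2≤k 2k≤m {u} n<exp cmu<k²n (_ ℚ.≤? κ)
    case n m k N₀≤n 2≤k n<exp cmu<k²n (no 2k≰m) = ≤-trans
      (≤-reflexive (trans (∑-cong-∈ (assignments n m k) λ {F} F∈ → 𝟙-no (¬? (connected? (intersection? F))) λ ¬conn →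
          ¬conn (dense-connected (ℕ.≰⇒> 2k≰m) F∈)) (∑-0 (assignments n m k))))
      (0≤*-pos (0≤^ n (0≤binom m k)) (0≤+ (0≤*-pos (0≤ι 2) 0≤δ) (0≤+ (0≤*-pos (0≤ι 2) 0≤δ) (0≤+ 0≤δ 0≤δ))))

-- Isolated vertices

indices : ∀ n → List (Fin n)
indices zero    = []
indices (suc n) = zero ∷ map suc (indices n)

∑-indices-const : ∀ n c → ∑ (indices n) (λ _ → c) ≡ ι n * c
∑-indices-const zero    c = sym (*-zeroˡ c)
∑-indices-const (suc n) c = trans (cong (c +_) (trans (∑-map suc (indices n) _) (∑-indices-const n c)))
  (trans (+-comm c (ι n * c)) (sym (ι-suc-* n c)))

∑-indices-≟ : ∀ {n} (u : Fin n) → ∑ (indices n) (λ w → 𝟙 (u Fin.≟ w)) ≡ 1ℚ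
∑-indices-≟ {suc n} zero = trans (cong (1ℚ +_) (trans (∑-map suc (indices n) _)
  (trans (∑-cong (indices n) λ w → 𝟙-no (zero Fin.≟ suc w) λ ()) (∑-0 (indices n))))) refl
∑-indices-≟ {suc n} (suc u) = trans (cong₂ _+_ (𝟙-no (suc u Fin.≟ zero) λ ()) (trans (∑-map suc (indices n) _)
  (trans (∑-cong (indices n) λ w → 𝟙-⇔ (suc u Fin.≟ suc w) (u Fin.≟ w) (λ { refl → refl }) (cong suc)) (∑-indices-≟ u)))) refl

⋃-⁅⁆ : ∀ {m n} (u : Fin n) (F : Vec (Subset m) n) → ⋃ ⊥ ⁅ u ⁆ F ≡ lookup F u
⋃-⁅⁆ u F = ⊆-antisym ⊆₁ (λ x∈ → ∈-⋃⁺ ⊥ ⁅ u ⁆ F (inj₂ (u , x∈⁅x⁆ u , x∈)))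
  where
  ⊆₁ : ⋃ ⊥ ⁅ u ⁆ F ⊆ lookup F u
  ⊆₁ {x} x∈ with ∈-⋃⁻ ⊥ ⁅ u ⁆ F x∈
  ... | inj₁ x∈⊥              = ⊥-elim (∉⊥ x∈⊥)
  ... | inj₂ (w , w∈ , x∈Fw) = subst (λ w → x ∈ lookup F w) (x∈⁅y⁆⇒x≡y u w∈) x∈Fw

isolated : ∀ {m n} → Fin n → Vec (Subset m) n → ℚ
isolated u F = isolation ⁅ u ⁆ F

isolated-cases : ∀ {m n} (u : Fin n) (F : Vec (Subset m) n) →
  (isolated u F ≡ 1ℚ × (∀ w → w ≢ u → Empty (lookup F u ∩ lookup F w))) ⊎ isolated u F ≡ 0ℚ
isolated-cases {m} {n} u F = cases (∏∉-𝟙 (disjoint? (⋃ ⊥ ⁅ u ⁆ F)) ⁅ u ⁆ F)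
  where
  cases : (isolated u F ≡ 1ℚ × (∀ w → w ∉ ⁅ u ⁆ → Empty (⋃ ⊥ ⁅ u ⁆ F ∩ lookup F w))) ⊎ isolated u F ≡ 0ℚ →
    (isolated u F ≡ 1ℚ × (∀ w → w ≢ u → Empty (lookup F u ∩ lookup F w))) ⊎ isolated u F ≡ 0ℚ
  cases (inj₂ ≡0)       = inj₂ ≡0
  cases (inj₁ (≡1 , d)) = inj₁ (≡1 , λ w w≢u → subst (λ V → Empty (V ∩ lookup F w)) (⋃-⁅⁆ u F) (d w (w≢u ∘ x∈⁅y⁆⇒x≡y u)))

connected⇒¬isolated : ∀ {m n} → 2 ℕ.≤ n → (F : Vec (Subset m) n) → Connected (Intersection F) → ∀ u → isolated u F ≡ 0ℚ
connected⇒¬isolated {m} 2≤n F conn u = cases (isolated-cases u F)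
  where
  other : ∀ {n} → 2 ℕ.≤ n → (u : Fin n) → ∃ λ w → w ≢ u
  other (s≤s (s≤s _)) zero    = suc zero , λ ()
  other (s≤s (s≤s _)) (suc u) = zero , λ ()
  first-edge : ∀ {w} → w ≢ u → Star (Intersection F) u w → ∃ λ w → Intersection F u w
  first-edge w≢u ε       = ⊥-elim (w≢u refl)
  first-edge w≢u (e ◅ _) = _ , e
  cases : (isolated u F ≡ 1ℚ × (∀ w → w ≢ u → Empty (lookup F u ∩ lookup F w))) ⊎ isolated u F ≡ 0ℚ → isolated u F ≡ 0ℚ
  cases (inj₂ ≡0)      = ≡0
  cases (inj₁ (_ , d)) = ⊥-elim (no-edge (first-edge (proj₂ (other 2≤n u)) (conn u (proj₁ (other 2≤n u)))))
    where
    no-edge : ¬ ∃ λ w → Intersection F u w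
    no-edge (w , u≢w , ne) = d w (u≢w ∘ sym) ne

-- If both vertices are isolated, their colour sets are disjoint, so the union has the full 2k
-- colours and no third vertex meets it. In this form the independence of the other vertices, given
-- the union, is applicable.
isolated-pair : ∀ {m n k} {F : Vec (Subset m) n} → F ∈ˡ assignments n m k → ∀ {u w} → u ≢ w →
  isolated u F * isolated w F ≤ 𝟙 (2 ℕ.* k ℕ.≤? ∣ ⋃ ⊥ (⁅ u ⁆ ∪ ⁅ w ⁆) F ∣) * isolation (⁅ u ⁆ ∪ ⁅ w ⁆) F
isolated-pair {m} {n} {k} {F} F∈ {u} {w} u≢w = cases (isolated-cases u F) (isolated-cases w F)
  where
  P = ⁅ u ⁆ ∪ ⁅ w ⁆
  U = ⋃ ⊥ P F
  rhs = 𝟙 (2 ℕ.* k ℕ.≤? ∣ U ∣) * isolation P F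
  size : ∀ u → ∣ lookup F u ∣ ≡ k
  size u = ∈-subsetsOfSize (∈-vectors n (subsetsOfSize m k) F∈ u)
  0≤rhs : 0ℚ ≤ rhs
  0≤rhs = 0≤*-pos (0≤𝟙 (2 ℕ.* k ℕ.≤? ∣ U ∣)) (0≤isolation P F)
  member : ∀ {v x} → v ∈ P → x ∈ lookup F v → x ∈ U
  member v∈P x∈ = ∈-⋃⁺ ⊥ P F (inj₂ (_ , v∈P , x∈))
  union⊆U : lookup F u ∪ lookup F w ⊆ U
  union⊆U x∈ with x∈p∪q⁻ (lookup F u) (lookup F w) x∈
  ... | inj₁ x∈u = member (x∈p∪q⁺ (inj₁ (x∈⁅x⁆ u))) x∈u
  ... | inj₂ x∈w = member (x∈p∪q⁺ (inj₂ (x∈⁅x⁆ w))) x∈w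
  cases : (isolated u F ≡ 1ℚ × (∀ v → v ≢ u → Empty (lookup F u ∩ lookup F v))) ⊎ isolated u F ≡ 0ℚ →
    (isolated w F ≡ 1ℚ × (∀ v → v ≢ w → Empty (lookup F w ∩ lookup F v))) ⊎ isolated w F ≡ 0ℚ →
    isolated u F * isolated w F ≤ rhs
  cases (inj₂ ≡0) _         = ≤-trans (≤-reflexive (trans (cong (_* isolated w F) ≡0) (*-zeroˡ (isolated w F)))) 0≤rhs
  cases (inj₁ _)  (inj₂ ≡0) = ≤-trans (≤-reflexive (trans (cong (isolated u F *_) ≡0) (*-zeroʳ (isolated u F)))) 0≤rhs
  cases (inj₁ (≡1 , d)) (inj₁ (≡1′ , d′)) = ≤-trans (≤-reflexive (cong₂ _*_ ≡1 ≡1′))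
    (*-mono-≤ 0≤1 0≤1 (≤-reflexive (sym (𝟙-yes (2 ℕ.* k ℕ.≤? ∣ U ∣) 2k≤U)))
      (1≤∏∉ P F λ v v∉P → ≤-reflexive (sym (𝟙-yes (disjoint? U (lookup F v)) (avoids v∉P)))))
    where
    2k≤U : 2 ℕ.* k ℕ.≤ ∣ U ∣
    2k≤U = ℕ.≤-trans (ℕ.≤-reflexive (cong₂ ℕ._+_ (sym (size u)) (trans (ℕ.+-identityʳ k) (sym (size w)))))
      (ℕ.≤-trans (∣p∣+∣q∣≤∣p∪q∣ (lookup F u) (lookup F w) (d w (u≢w ∘ sym))) (p⊆q⇒∣p∣≤∣q∣ union⊆U))
    avoids : ∀ {v} → v ∉ P → Empty (U ∩ lookup F v)
    avoids {v} v∉P (x , i) with x∈U , x∈v ← x∈p∩q⁻ U (lookup F v) i with ∈-⋃⁻ ⊥ P F x∈U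
    ... | inj₁ x∈⊥ = ∉⊥ x∈⊥
    ... | inj₂ (v′ , v′∈P , x∈v′) with x∈p∪q⁻ ⁅ u ⁆ ⁅ w ⁆ v′∈P
    ...   | inj₁ v′∈u = d v (λ { refl → v∉P (x∈p∪q⁺ (inj₁ (x∈⁅x⁆ u))) })
            (x , x∈p∩q⁺ (subst (λ s → x ∈ lookup F s) (x∈⁅y⁆⇒x≡y u v′∈u) x∈v′ , x∈v))
    ...   | inj₂ v′∈w = d′ v (λ { refl → v∉P (x∈p∪q⁺ (inj₂ (x∈⁅x⁆ w))) })
            (x , x∈p∩q⁺ (subst (λ s → x ∈ lookup F s) (x∈⁅y⁆⇒x≡y w v′∈w) x∈v′ , x∈v))

-- Monotonicity and log-concavity of binomial coefficients

binom-mono : ∀ {a b} k → a ℕ.≤ b → binom a k ≤ binom b k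
binom-mono {a} {b} zero    a≤b = ≤-reflexive (trans (binom-0 a) (sym (binom-0 b)))
binom-mono {a} {b} (suc k) a≤b = go (ℕ.≤⇒≤′ a≤b)
  where
  go : ∀ {b} → a ℕ.≤′ b → binom a (suc k) ≤ binom b (suc k)
  go ℕ.≤′-refl           = ≤-refl
  go (ℕ.≤′-step {b} a≤b) = ≤-trans (go a≤b) (≤-trans (a≤a+b (0≤binom b k)) (≤-reflexive (sym (pascal b k))))

-- Passing from j to j + 1 multiplies the left side by (a - j)(c - j) and the right side by (b -
-- j)², up to a common denominator. With a + c = 2b this is the inequality of arithmetic and
-- geometric means.
binom-log-concave : ∀ {a b c} → ι a + ι c ≡ ι b + ι b → a ℕ.≤ b → b ℕ.≤ c → ∀ j → j ℕ.≤ a →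
  binom a j * binom c j ≤ binom b j * binom b j
binom-log-concave {a} {b} {c} a+c≡2b a≤b b≤c zero _ = ≤-reflexive (cong₂ _*_ (trans (binom-0 a) (sym (binom-0 b))) (trans (binom-0 c) (sym (binom-0 b))))
binom-log-concave {a} {b} {c} a+c≡2b a≤b b≤c (suc j) j<a = *-cancelˡ-≤ (0<*-pos 0<J₁ 0<J₁) (begin
  J₁ * J₁ * (binom a (suc j) * binom c (suc j)) ≡⟨ pull (binom a (suc j)) (binom c (suc j)) ⟩
  J₁ * binom a (suc j) * (J₁ * binom c (suc j)) ≡⟨ cong₂ _*_ (binom-absorb a j) (binom-absorb c j) ⟩
  (A - j′) * binom a j * ((C - j′) * binom c j) ≡⟨ mix (A - j′) (binom a j) (C - j′) (binom c j) ⟩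
  (A - j′) * (C - j′) * (binom a j * binom c j)
    ≤⟨ *-mono-≤ (0≤*-pos (≤⇒0≤- j≤A) (≤⇒0≤- (≤-trans j≤A (ι-mono-≤ (ℕ.≤-trans a≤b b≤c))))) (0≤*-pos (0≤binom a j) (0≤binom c j))
         factor (binom-log-concave {a} {b} {c} a+c≡2b a≤b b≤c j (ℕ.<⇒≤ j<a)) ⟩
  (B - j′) * (B - j′) * (binom b j * binom b j) ≡⟨ sym (mix (B - j′) (binom b j) (B - j′) (binom b j)) ⟩
  (B - j′) * binom b j * ((B - j′) * binom b j) ≡⟨ sym (cong₂ _*_ (binom-absorb b j) (binom-absorb b j)) ⟩
  J₁ * binom b (suc j) * (J₁ * binom b (suc j)) ≡⟨ sym (pull (binom b (suc j)) (binom b (suc j))) ⟩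
  J₁ * J₁ * (binom b (suc j) * binom b (suc j)) ∎)
  where
  open ≤-Reasoning
  A = ι a
  B = ι b
  C = ι c
  j′ = ι j
  J₁ = ι (suc j)
  0<J₁ : 0ℚ < J₁
  0<J₁ = ι-mono-< {0} {suc j} (s≤s z≤n)
  j≤A : j′ ≤ A
  j≤A = ι-mono-≤ (ℕ.<⇒≤ j<a)
  pull : ∀ s t → J₁ * J₁ * (s * t) ≡ J₁ * s * (J₁ * t)
  pull = solve 3 (λ j s t → j :* j :* (s :* t) := j :* s :* (j :* t)) refl J₁
  mix : ∀ s t u v → s * t * (u * v) ≡ s * u * (t * v)
  mix = solve 4 (λ s t u v → s :* t :* (u :* v) := s :* u :* (t :* v)) refl
  factor : (A - j′) * (C - j′) ≤ (B - j′) * (B - j′)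
  factor = ≤-by ((B - A) * (B - A)) (0≤*-pos (≤⇒0≤- (ι-mono-≤ a≤b)) (≤⇒0≤- (ι-mono-≤ a≤b)))
    (trans (solve 3 (λ a b j → (b :- j) :* (b :- j) := (a :- j) :* (b :+ b :- a :- j) :+ (b :- a) :* (b :- a)) refl A B j′)
      (cong (λ s → (A - j′) * (s - j′) + (B - A) * (B - A)) (trans (cong (_- A) (sym a+c≡2b)) (solve 2 (λ a c → a :+ c :- a := c) refl A C))))

-- Moments of the number of isolated vertices

isolatedCount : ∀ {m n} → Vec (Subset m) n → ℚ
isolatedCount {n = n} F = ∑ (indices n) λ u → isolated u F

connections : ℕ → ℕ → ℕ → ℚ
connections n m k = ∑ (assignments n m k) (λ F → 𝟙 (connected? (intersection? F)))

module SecondMoment {n m k : ℕ} {r : ℚ} (2≤n : 2 ℕ.≤ n) (4k≤m : 4 ℕ.* k ℕ.≤ m) (mr≡1 : ι m * r ≡ 1ℚ) (0<r : 0ℚ < r) (r≤1 : r ≤ 1ℚ) where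

  private
    ik≤m : ∀ i j → i ℕ.+ j ≡ 4 → i ℕ.* k ℕ.≤ m
    ik≤m i j i+j≡4 = ℕ.≤-trans (ℕ.*-monoˡ-≤ k (ℕ.≤-trans (ℕ.m≤m+n i j) (ℕ.≤-reflexive i+j≡4))) 4k≤m

    k≤m : k ℕ.≤ m
    k≤m = ℕ.≤-trans (ℕ.≤-reflexive (sym (ℕ.*-identityˡ k))) (ik≤m 1 3 refl)

    2k≤m : 2 ℕ.* k ℕ.≤ m
    2k≤m = ik≤m 2 2 refl

    s : ℚ
    s = proj₁ (recip (0<binom k≤m))

    0≤s : 0ℚ ≤ s
    0≤s = <⇒≤ (proj₁ (proj₂ (recip (0<binom k≤m))))

    N : ℚ
    N = binom m k

    Ns≡1 : N * s ≡ 1ℚ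
    Ns≡1 = proj₂ (proj₂ (recip (0<binom k≤m)))

    0≤N^n : 0ℚ ≤ N ^ n
    0≤N^n = 0≤^ n (0≤binom m k)

    Ωⁿ = assignments n m k

  open Avoidance {m} {k} {r} mr≡1 (<⇒≤ 0<r) r≤1 k≤m using (avoidance; 0≤avoidance; ∑-isolation)

  -- The probability that two independent random k-sets are disjoint.
  p : ℚ
  p = binom (m ℕ.∸ k) k * s

  0≤p : 0ℚ ≤ p
  0≤p = 0≤*-pos (0≤binom (m ℕ.∸ k) k) 0≤s

  p≤1 : p ≤ 1ℚ
  p≤1 = ≤-trans (*-monoʳ 0≤s (binom-mono k (ℕ.m∸n≤m m k))) (≤-reflexive Ns≡1)

  private
    -- Negative correlation: missing both of two disjoint k-sets is at most as likely as it would be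
    -- for independent events. After multiplication by N² this is log-concavity at m - 2k, m - k, m.
    avoidance-2k : ∀ V → 2 ℕ.* k ℕ.≤ ∣ V ∣ → avoidance V ≤ p * p
    avoidance-2k V 2k≤V = begin
      binom (m ℕ.∸ ∣ V ∣) k * s ≤⟨ *-monoʳ 0≤s (binom-mono k (ℕ.∸-monoʳ-≤ m 2k≤V)) ⟩
      binom (m ℕ.∸ 2 ℕ.* k) k * s ≡⟨ sym (trans (cong (binom (m ℕ.∸ 2 ℕ.* k) k * s *_) Ns≡1) (*-identityʳ _)) ⟩
      binom (m ℕ.∸ 2 ℕ.* k) k * s * (N * s) ≡⟨ solve 3 (λ a s n → a :* s :* (n :* s) := a :* n :* (s :* s)) refl (binom (m ℕ.∸ 2 ℕ.* k) k) s N ⟩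
      binom (m ℕ.∸ 2 ℕ.* k) k * N * (s * s) ≤⟨ *-monoʳ (0≤*-pos 0≤s 0≤s) (binom-log-concave {m ℕ.∸ 2 ℕ.* k} {m ℕ.∸ k} {m} sum≡
        (ℕ.∸-monoʳ-≤ m (ℕ.m≤m+n k (k ℕ.+ 0))) (ℕ.m∸n≤m m k) k k≤) ⟩
      binom (m ℕ.∸ k) k * binom (m ℕ.∸ k) k * (s * s) ≡⟨ solve 2 (λ d s → d :* d :* (s :* s) := d :* s :* (d :* s)) refl (binom (m ℕ.∸ k) k) s ⟩
      p * p ∎
      where
      open ≤-Reasoning
      k≤ : k ℕ.≤ m ℕ.∸ 2 ℕ.* k
      k≤ = ℕ.≤-trans (ℕ.≤-reflexive (sym (ℕ.m+n∸n≡m k (2 ℕ.* k)))) (ℕ.∸-monoˡ-≤ (2 ℕ.* k) (ik≤m 3 1 refl))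
      sum≡ : ι (m ℕ.∸ 2 ℕ.* k) + ι m ≡ ι (m ℕ.∸ k) + ι (m ℕ.∸ k)
      sum≡ = trans (cong (_+ ι m) (trans (ι-∸ 2k≤m) (cong (λ u → ι m - u) (ι-* 2 k))))
        (trans (solve 2 (λ m k → m :- con (ι 2) :* k :+ m := m :- k :+ (m :- k)) refl (ι m) (ι k))
          (sym (cong₂ _+_ (ι-∸ k≤m) (ι-∸ k≤m))))

    ∑-Ωⁿ-const : ∀ u → ∑ Ωⁿ (λ _ → u) ≡ N ^ n * u
    ∑-Ωⁿ-const u = trans (∑-const Ωⁿ u) (cong (_* u) (length-assignments n m k))

  first-moment : ∀ (u : Fin n) → ∑ Ωⁿ (isolated u) ≡ N ^ n * p ^ (n ℕ.∸ 1)
  first-moment u = begin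
    ∑ Ωⁿ (isolated u) ≡⟨ ∑-cong Ωⁿ (λ F → sym (*-identityˡ (isolated u F))) ⟩
    ∑ Ωⁿ (λ F → 1ℚ * isolated u F) ≡⟨ ∑-isolation n ⁅ u ⁆ (λ _ → 1ℚ) ⟩
    ∑ Ωⁿ (λ F → 1ℚ * avoidance (⋃ ⊥ ⁅ u ⁆ F) ^ (n ℕ.∸ ∣ ⁅ u ⁆ ∣)) ≡⟨ ∑-cong-∈ Ωⁿ (λ {F} F∈ → trans (*-identityˡ _)
      (cong₂ (λ i j → (binom (m ℕ.∸ i) k * s) ^ (n ℕ.∸ j)) (size F∈) (∣⁅x⁆∣≡1 u))) ⟩
    ∑ Ωⁿ (λ _ → p ^ (n ℕ.∸ 1)) ≡⟨ ∑-Ωⁿ-const (p ^ (n ℕ.∸ 1)) ⟩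
    N ^ n * p ^ (n ℕ.∸ 1) ∎
    where
    open ≡-Reasoning
    size : ∀ {F} → F ∈ˡ Ωⁿ → ∣ ⋃ ⊥ ⁅ u ⁆ F ∣ ≡ k
    size {F} F∈ = trans (cong ∣_∣ (⋃-⁅⁆ u F)) (∈-subsetsOfSize (∈-vectors n (subsetsOfSize m k) F∈ u))

  joint-moment : ∀ {u w : Fin n} → u ≢ w → ∑ Ωⁿ (λ F → isolated u F * isolated w F) ≤ N ^ n * (p * p) ^ (n ℕ.∸ 2)
  joint-moment {u} {w} u≢w = begin
    ∑ Ωⁿ (λ F → isolated u F * isolated w F) ≤⟨ ∑-mono-∈ Ωⁿ (λ {F} F∈ → isolated-pair {F = F} F∈ u≢w) ⟩
    ∑ Ωⁿ (λ F → 𝟙 (2 ℕ.* k ℕ.≤? ∣ ⋃ ⊥ P F ∣) * isolation P F) ≡⟨ ∑-isolation n P (λ V → 𝟙 (2 ℕ.* k ℕ.≤? ∣ V ∣)) ⟩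
    ∑ Ωⁿ (λ F → 𝟙 (2 ℕ.* k ℕ.≤? ∣ ⋃ ⊥ P F ∣) * avoidance (⋃ ⊥ P F) ^ (n ℕ.∸ ∣ P ∣))
      ≤⟨ ∑-mono Ωⁿ (λ F → 𝟙*-≤ (2 ℕ.* k ℕ.≤? ∣ ⋃ ⊥ P F ∣) (0≤^ (n ℕ.∸ 2) 0≤pp) (bound (⋃ ⊥ P F))) ⟩
    ∑ Ωⁿ (λ _ → (p * p) ^ (n ℕ.∸ 2)) ≡⟨ ∑-Ωⁿ-const ((p * p) ^ (n ℕ.∸ 2)) ⟩
    N ^ n * (p * p) ^ (n ℕ.∸ 2) ∎
    where
    open ≤-Reasoning
    P = ⁅ u ⁆ ∪ ⁅ w ⁆
    P≤2 : ∣ P ∣ ℕ.≤ 2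
    P≤2 = ℕ.≤-trans (∣p∪q∣≤∣p∣+∣q∣ ⁅ u ⁆ ⁅ w ⁆) (ℕ.≤-reflexive (cong₂ ℕ._+_ (∣⁅x⁆∣≡1 u) (∣⁅x⁆∣≡1 w)))
    0≤pp : 0ℚ ≤ p * p
    0≤pp = 0≤*-pos 0≤p 0≤p
    bound : ∀ V → 2 ℕ.* k ℕ.≤ ∣ V ∣ → avoidance V ^ (n ℕ.∸ ∣ P ∣) ≤ (p * p) ^ (n ℕ.∸ 2)
    bound V 2k≤V = ≤-trans (^-mono (n ℕ.∸ ∣ P ∣) (0≤avoidance V) (avoidance-2k V 2k≤V))
      (^-anti 0≤pp (*-mono-≤ 0≤p 0≤p p≤1 p≤1) (ℕ.∸-monoʳ-≤ n P≤2))

  -- The mean of the count, and a bound for the mean number of ordered pairs of distinct isolated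
  -- vertices, with n² in place of n(n - 1).
  μ ν : ℚ
  μ = ι n * p ^ (n ℕ.∸ 1)
  ν = ι n * ι n * (p * p) ^ (n ℕ.∸ 2)

  ∑-isolatedCount : ∑ Ωⁿ isolatedCount ≡ N ^ n * μ
  ∑-isolatedCount = begin
    ∑ Ωⁿ isolatedCount ≡⟨ ∑-swap Ωⁿ (indices n) _ ⟩
    ∑ (indices n) (λ u → ∑ Ωⁿ (isolated u)) ≡⟨ trans (∑-cong (indices n) first-moment) (∑-indices-const n (N ^ n * p ^ (n ℕ.∸ 1))) ⟩
    ι n * (N ^ n * p ^ (n ℕ.∸ 1)) ≡⟨ solve 3 (λ n b p → n :* (b :* p) := b :* (n :* p)) refl (ι n) (N ^ n) (p ^ (n ℕ.∸ 1)) ⟩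
    N ^ n * μ ∎
    where open ≡-Reasoning

  ∑-isolatedCount² : ∑ Ωⁿ (λ F → isolatedCount F * isolatedCount F) ≤ N ^ n * (μ + ν)
  ∑-isolatedCount² = begin
    ∑ Ωⁿ (λ F → isolatedCount F * isolatedCount F) ≡⟨ ∑-cong Ωⁿ (λ F → trans (sym (∑-*ʳ (indices n) (λ u → isolated u F) (isolatedCount F)))
      (∑-cong (indices n) λ u → sym (∑-*ˡ (indices n) (isolated u F) (λ w → isolated w F)))) ⟩
    ∑ Ωⁿ (λ F → ∑ (indices n) (λ u → ∑ (indices n) (λ w → isolated u F * isolated w F)))
      ≡⟨ trans (∑-swap Ωⁿ (indices n) _) (∑-cong (indices n) λ u → ∑-swap Ωⁿ (indices n) _) ⟩
    ∑ (indices n) (λ u → ∑ (indices n) (λ w → ∑ Ωⁿ (λ F → isolated u F * isolated w F)))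
      ≤⟨ ∑-mono (indices n) (λ u → ∑-mono (indices n) (λ w → pair u w (u Fin.≟ w))) ⟩
    ∑ (indices n) (λ u → ∑ (indices n) (λ w → 𝟙 (u Fin.≟ w) * A + B)) ≡⟨ ∑-cong (indices n) inner ⟩
    ∑ (indices n) (λ u → A + ι n * B) ≡⟨ ∑-indices-const n (A + ι n * B) ⟩
    ι n * (A + ι n * B)
      ≡⟨ solve 4 (λ n b p q → n :* (b :* p :+ n :* (b :* q)) := b :* (n :* p :+ n :* n :* q)) refl (ι n) (N ^ n) (p ^ (n ℕ.∸ 1)) ((p * p) ^ (n ℕ.∸ 2)) ⟩
    N ^ n * (μ + ν) ∎
    where
    open ≤-Reasoning
    A = N ^ n * p ^ (n ℕ.∸ 1)
    B = N ^ n * (p * p) ^ (n ℕ.∸ 2)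
    0≤B : 0ℚ ≤ B
    0≤B = 0≤*-pos 0≤N^n (0≤^ (n ℕ.∸ 2) (0≤*-pos 0≤p 0≤p))
    idem : ∀ u F → isolated u F * isolated u F ≤ isolated u F
    idem u F with isolated-cases {m} u F
    ... | inj₁ (≡1 , _) = ≤-reflexive (trans (cong (_* isolated u F) ≡1) (*-identityˡ (isolated u F)))
    ... | inj₂ ≡0       = ≤-reflexive (trans (cong (_* isolated u F) ≡0) (trans (*-zeroˡ (isolated u F)) (sym ≡0)))
    pair : ∀ u w (u≟w : Dec (u ≡ w)) → ∑ Ωⁿ (λ F → isolated u F * isolated w F) ≤ 𝟙 u≟w * A + B
    pair u w (yes refl) = ≤-trans (∑-mono Ωⁿ (idem u)) (≤-trans (≤-reflexive (trans (first-moment u) (sym (*-identityˡ A)))) (a≤a+b 0≤B))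
    pair u w (no u≢w)   = ≤-trans (joint-moment u≢w) (≤-reflexive (sym (trans (cong (_+ B) (*-zeroˡ A)) (+-identityˡ B))))
    inner : ∀ u → ∑ (indices n) (λ w → 𝟙 (u Fin.≟ w) * A + B) ≡ A + ι n * B
    inner u = trans (∑-+ (indices n) _ _) (cong₂ _+_ (trans (∑-*ʳ (indices n) (λ w → 𝟙 (u Fin.≟ w)) A)
      (trans (cong (_* A) (∑-indices-≟ u)) (*-identityˡ A))) (∑-indices-const n B))

  -- A connected graph has no isolated vertex, so the count deviates from μ by exactly μ there. The
  -- right side bounds the sum of all squared deviations.
  chebyshev : connections n m k * (μ * μ) ≤ N ^ n * (μ + ν - μ * μ)
  chebyshev = begin
    connections n m k * (μ * μ) ≡⟨ sym (∑-*ʳ Ωⁿ _ (μ * μ)) ⟩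
    ∑ Ωⁿ (λ F → 𝟙 (connected? (intersection? F)) * (μ * μ)) ≤⟨ ∑-mono Ωⁿ (λ F → 𝟙*-≤ (connected? (intersection? F)) (≤-trans (0≤square (isolatedCount F - μ)) (≤-reflexive (square (isolatedCount F)))) (pointwise F)) ⟩
    ∑ Ωⁿ (λ F → isolatedCount F * isolatedCount F + ((- (ι 2 * μ)) * isolatedCount F + μ * μ))
      ≡⟨ trans (∑-+ Ωⁿ _ _) (cong (∑ Ωⁿ (λ F → isolatedCount F * isolatedCount F) +_) (trans (∑-+ Ωⁿ _ _)
           (cong₂ _+_ (trans (∑-*ˡ Ωⁿ (- (ι 2 * μ)) isolatedCount) (cong ((- (ι 2 * μ)) *_) ∑-isolatedCount)) (∑-Ωⁿ-const (μ * μ))))) ⟩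
    ∑ Ωⁿ (λ F → isolatedCount F * isolatedCount F) + ((- (ι 2 * μ)) * (N ^ n * μ) + N ^ n * (μ * μ)) ≤⟨ +-monoˡ-≤ _ ∑-isolatedCount² ⟩
    N ^ n * (μ + ν) + ((- (ι 2 * μ)) * (N ^ n * μ) + N ^ n * (μ * μ))
      ≡⟨ solve 3 (λ b μ ν → b :* (μ :+ ν) :+ ((:- (con (ι 2) :* μ)) :* (b :* μ) :+ b :* (μ :* μ)) := b :* (μ :+ ν :- μ :* μ)) refl (N ^ n) μ ν ⟩
    N ^ n * (μ + ν - μ * μ) ∎
    where
    open ≤-Reasoning
    square : ∀ i → (i - μ) * (i - μ) ≡ i * i + ((- (ι 2 * μ)) * i + μ * μ)
    square i = solve 2 (λ i μ → (i :- μ) :* (i :- μ) := i :* i :+ ((:- (con (ι 2) :* μ)) :* i :+ μ :* μ)) refl i μ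
    pointwise : ∀ F → Connected (Intersection F) → μ * μ ≤ isolatedCount F * isolatedCount F + ((- (ι 2 * μ)) * isolatedCount F + μ * μ)
    pointwise F conn = ≤-reflexive (sym (trans (cong (λ i → i * i + ((- (ι 2 * μ)) * i + μ * μ)) count≡0)
      (solve 1 (λ μ → con 0ℚ :* con 0ℚ :+ ((:- (con (ι 2) :* μ)) :* con 0ℚ :+ μ :* μ) := μ :* μ) refl μ)))
      where
      count≡0 : isolatedCount F ≡ 0ℚ
      count≡0 = trans (∑-cong (indices n) (connected⇒¬isolated 2≤n F conn)) (∑-0 (indices n))

  -- Since μ² = νp², the variance is at most μ + ν(1 - p²). The first term is small against μ²
  -- because μ is large, the second because p is close to 1.
  connections-≤ : ∀ {δ} → 0ℚ < p → 1ℚ ≤ δ * μ → 1ℚ - p * p ≤ δ * (p * p) → connections n m k ≤ N ^ n * (ι 2 * δ)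
  connections-≤ {δ} 0<p 1≤δμ 1-pp≤ = *-cancelʳ-≤ 0<μμ (≤-trans chebyshev (≤-trans (*-monoˡ 0≤N^n bound) (≤-reflexive (sym (*-assoc (N ^ n) (ι 2 * δ) (μ * μ))))))
    where
    open ≤-Reasoning
    0<μ : 0ℚ < μ
    0<μ = 0<*-pos (ι-mono-< {0} {n} (ℕ.≤-trans (s≤s z≤n) 2≤n)) (0<^ (n ℕ.∸ 1) 0<p)
    0<μμ : 0ℚ < μ * μ
    0<μμ = 0<*-pos 0<μ 0<μ
    0≤ν : 0ℚ ≤ ν
    0≤ν = 0≤*-pos (0≤*-pos (0≤ι n) (0≤ι n)) (0≤^ (n ℕ.∸ 2) (0≤*-pos 0≤p 0≤p))
    μμ≡ : μ * μ ≡ ν * (p * p)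
    μμ≡ = begin-equality
      ι n * p ^ (n ℕ.∸ 1) * (ι n * p ^ (n ℕ.∸ 1)) ≡⟨ cong (λ i → ι n * p ^ i * (ι n * p ^ i)) (ℕ.+-∸-assoc 1 2≤n) ⟩
      ι n * (p * P) * (ι n * (p * P)) ≡⟨ solve 3 (λ n p q → n :* (p :* q) :* (n :* (p :* q)) := n :* n :* (q :* q) :* (p :* p)) refl (ι n) p P ⟩
      ι n * ι n * (P * P) * (p * p) ≡⟨ cong (λ i → ι n * ι n * i * (p * p)) (sym (^-distrib-* p p (n ℕ.∸ 2))) ⟩
      ν * (p * p) ∎
      where
      P = p ^ (n ℕ.∸ 2)
    bound : μ + ν - μ * μ ≤ ι 2 * δ * (μ * μ)
    bound = begin
      μ + ν - μ * μ ≡⟨ trans (cong (λ i → μ + ν - i) μμ≡) (solve 3 (λ μ ν q → μ :+ ν :- ν :* q := con 1ℚ :* μ :+ ν :* (con 1ℚ :- q)) refl μ ν (p * p)) ⟩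
      1ℚ * μ + ν * (1ℚ - p * p) ≤⟨ +-mono-≤ (*-monoʳ (<⇒≤ 0<μ) 1≤δμ) (*-monoˡ 0≤ν 1-pp≤) ⟩
      δ * μ * μ + ν * (δ * (p * p)) ≡⟨ cong (δ * μ * μ +_) (trans (solve 3 (λ ν δ q → ν :* (δ :* q) := δ :* (ν :* q)) refl ν δ (p * p)) (cong (δ *_) (sym μμ≡))) ⟩
      δ * μ * μ + δ * (μ * μ) ≡⟨ solve 2 (λ δ μ → δ :* μ :* μ :+ δ :* (μ :* μ) := con (ι 2) :* δ :* (μ :* μ)) refl δ μ ⟩
      ι 2 * δ * (μ * μ) ∎

-- Choice of the parameters for disconnectivity

-- With v = (1 + 1/(m − 2k))^(−k²), a vertex is isolated with probability at
-- least v^(n−1), and n v^(n+a) ≥ 1 says that this is at least about n^(−c).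
module _ {c δ : ℚ} (0<c : 0ℚ < c) (c<1 : c < 1ℚ) (0<δ : 0ℚ < δ) (δ≤1 : δ ≤ 1ℚ) where

  private
    0<1-c : 0ℚ < 1ℚ - c
    0<1-c = ≤-<-trans (≤-reflexive (sym (+-inverseʳ c))) (+-monoˡ-< (- c) c<1)

    c⁻ : ℚ
    c⁻ = proj₁ (recip 0<1-c)

    δ⁻ : ℚ
    δ⁻ = proj₁ (recip 0<δ)

    -- The first bound gives c(1 + 1/q) ≤ 1 - 1/q, which leaves room for a ≤ n/q additional vertices
    -- and for m - 2k in place of m. The second gives 16 ≤ δq, used to make 1 - p² small.
    q₁ q₂ : ∃ λ q → _
    q₁ = archimedean (ι 2 * c⁻)
    q₂ = archimedean (ι 16 * δ⁻)

    q : ℕ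
    q = suc (proj₁ q₁ ℕ.+ proj₁ q₂)

    2≤[1-c]q : ι 2 ≤ (1ℚ - c) * ι q
    2≤[1-c]q = archimedean-* q (proj₂ (proj₂ (recip 0<1-c))) (<⇒≤ 0<1-c)
      (≤-trans (proj₂ q₁) (ι-mono-≤ (ℕ.≤-trans (ℕ.m≤m+n (proj₁ q₁) (proj₁ q₂)) (ℕ.n≤1+n (proj₁ q₁ ℕ.+ proj₁ q₂)))))

    16≤δq : ι 16 ≤ δ * ι q
    16≤δq = archimedean-* q (proj₂ (proj₂ (recip 0<δ))) (<⇒≤ 0<δ)
      (≤-trans (proj₂ q₂) (ι-mono-≤ (ℕ.≤-trans (ℕ.m≤n+m (proj₁ q₂) (proj₁ q₁)) (ℕ.n≤1+n (proj₁ q₁ ℕ.+ proj₁ q₂)))))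

    16≤q : 16 ℕ.≤ q
    16≤q = ι-cancel-≤ (≤-trans 16≤δq (≤-trans (*-monoʳ (0≤ι q) δ≤1) (≤-reflexive (*-identityˡ (ι q)))))

    K₀ : ∃ λ K → δ⁻ ≤ ι K
    K₀ = archimedean δ⁻

    K : ℕ
    K = proj₁ K₀

    1≤δK : 1ℚ ≤ δ * ι K
    1≤δK = ≤-trans (≤-reflexive (sym (proj₂ (proj₂ (recip 0<δ))))) (*-monoˡ (<⇒≤ 0<δ) (proj₂ K₀))

    -- `N₁` serves the bound qk² ≤ m, and `N₂` serves K ≤ n v^n, hence μ ≥ 1/δ.
    N₁ N₂ : ℕ
    N₁ = 2 ℕ.* (q ℕ.* q)
    N₂ = proj₁ (archimedean (ι K ^ suc (2 ℕ.* q)))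

    N₀ : ℕ
    N₀ = N₁ ℕ.+ suc N₂

    K^<n : ∀ {n} → N₀ ℕ.≤ n → ι K ^ suc (2 ℕ.* q) < ι n
    K^<n N₀≤n = ≤-<-trans (proj₂ (archimedean (ι K ^ suc (2 ℕ.* q)))) (ι-mono-< (ℕ.≤-trans (ℕ.m≤n+m (suc N₂) N₁) N₀≤n))

  module _ {n m k : ℕ} (N₀≤n : N₀ ℕ.≤ n) (2≤k : 2 ℕ.≤ k) (k≤m : k ℕ.≤ m)
    {l : ℚ} (0<l : 0ℚ < l) (exp<n : exp l ᶜ< ι n) (k²n<cml : ι (k ℕ.^ 2 ℕ.* n) < c * (ι m * l)) where

    private
      0≤l = <⇒≤ 0<l

      2qq≤n : 2 ℕ.* (q ℕ.* q) ℕ.≤ n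
      2qq≤n = ℕ.≤-trans (ℕ.m≤m+n N₁ (suc N₂)) N₀≤n

      q≤n : q ℕ.≤ n
      q≤n = ℕ.≤-trans (ℕ.m≤m*n q q) (ℕ.≤-trans (ℕ.m≤m+n (q ℕ.* q) (q ℕ.* q ℕ.+ 0)) 2qq≤n)

      2≤n : 2 ℕ.≤ n
      2≤n = ℕ.≤-trans (ℕ.≤-trans (s≤s (s≤s z≤n)) 16≤q) q≤n

      0<n : 0ℚ < ι n
      0<n = ι-mono-< {0} {n} (ℕ.≤-trans (s≤s z≤n) 2≤n)

      1≤m : 1 ℕ.≤ m
      1≤m = ℕ.≤-trans (s≤s z≤n) (ℕ.≤-trans 2≤k k≤m)

      0<m : 0ℚ < ι m
      0<m = ι-mono-< {0} {m} 1≤m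

      r : ℚ
      r = proj₁ (recip 0<m)

      0<r : 0ℚ < r
      0<r = proj₁ (proj₂ (recip 0<m))

      0≤r = <⇒≤ 0<r

      mr≡1 : ι m * r ≡ 1ℚ
      mr≡1 = proj₂ (proj₂ (recip 0<m))

      r≤1 : r ≤ 1ℚ
      r≤1 = ≤-trans (≤-trans (≤-reflexive (sym (*-identityˡ r))) (*-monoʳ 0≤r (ι-mono-≤ {1} {m} 1≤m))) (≤-reflexive mr≡1)

      A k² : ℚ
      k² = ι (k ℕ.^ 2)
      A = ι (k ℕ.^ 2 ℕ.* n)

      0≤k² : 0ℚ ≤ k²
      0≤k² = 0≤ι (k ℕ.^ 2)

      A≤ml : A ≤ ι m * l
      A≤ml = ≤-trans (<⇒≤ k²n<cml) (≤-trans (*-monoʳ (0≤*-pos (0≤ι m) 0≤l) (<⇒≤ c<1)) (≤-reflexive (*-identityˡ (ι m * l))))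

      -- The quadratic term of the exponential series suffices: l²/2 ≤ exp l ≤ n. Together with k²n
      -- ≤ ml it shows that k²/m is of order at most n^(-1/2).
      l²≤2n : l * l ≤ ι 2 * ι n
      l²≤2n = begin
        l * l ≤⟨ ≤-by (ι 2 + ι 2 * l) (0≤+ (0≤ι 2) (0≤*-pos (0≤ι 2) 0≤l))
          (solve 1 (λ l → con (ι 2) :* (con 0ℚ :+ con 1ℚ :* con 1ℚ :+ l :* con 1ℚ :* con 1ℚ :+ l :* (l :* con 1ℚ) :* con ½) :=
            l :* l :+ (con (ι 2) :+ con (ι 2) :* l)) refl l) ⟩
        ι 2 * expSum 3 l ≤⟨ *-monoˡ (0≤ι 2) (exp<⇒ {n} {l} 0≤l exp<n 3) ⟩
        ι 2 * ι n ∎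
        where open ≤-Reasoning

      k²r : ℚ
      k²r = k² * r

      0≤k²r : 0ℚ ≤ k²r
      0≤k²r = 0≤*-pos 0≤k² 0≤r

      k²rn≤l : k²r * ι n ≤ l
      k²rn≤l = begin
        k² * r * ι n ≡⟨ trans (solve 3 (λ k r n → k :* r :* n := k :* n :* r) refl k² r (ι n)) (cong (_* r) (sym (ι-* (k ℕ.^ 2) n))) ⟩
        A * r ≤⟨ *-monoʳ 0≤r A≤ml ⟩
        ι m * l * r ≡⟨ trans (solve 3 (λ m l r → m :* l :* r := l :* (m :* r)) refl (ι m) l r) (trans (cong (l *_) mr≡1) (*-identityʳ l)) ⟩
        l ∎
        where open ≤-Reasoning

      [k²r]²n≤2 : k²r * k²r * ι n ≤ ι 2
      [k²r]²n≤2 = *-cancelʳ-≤ 0<n (begin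
        k²r * k²r * ι n * ι n ≡⟨ solve 2 (λ s n → s :* s :* n :* n := s :* n :* (s :* n)) refl k²r (ι n) ⟩
        k²r * ι n * (k²r * ι n) ≤⟨ *-mono-≤ 0≤k²rn 0≤k²rn k²rn≤l k²rn≤l ⟩
        l * l ≤⟨ l²≤2n ⟩
        ι 2 * ι n ∎)
        where
        open ≤-Reasoning
        0≤k²rn : 0ℚ ≤ k²r * ι n
        0≤k²rn = 0≤*-pos 0≤k²r (0≤ι n)

      qk²r≤1 : ι q * k²r ≤ 1ℚ
      qk²r≤1 = ^-cancel-≤ 1 0≤1 (*-cancelˡ-≤ (ι-mono-< {0} {2} (s≤s z≤n)) (begin
        ι 2 * (ι q * k²r * (ι q * k²r * 1ℚ)) ≡⟨ solve 2 (λ q s → con (ι 2) :* (q :* s :* (q :* s :* con 1ℚ)) := s :* s :* (con (ι 2) :* (q :* q))) refl (ι q) k²r ⟩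
        k²r * k²r * (ι 2 * (ι q * ι q)) ≡⟨ cong (k²r * k²r *_) (trans (cong (ι 2 *_) (sym (ι-* q q))) (sym (ι-* 2 (q ℕ.* q)))) ⟩
        k²r * k²r * ι (2 ℕ.* (q ℕ.* q)) ≤⟨ *-monoˡ (0≤*-pos 0≤k²r 0≤k²r) (ι-mono-≤ 2qq≤n) ⟩
        k²r * k²r * ι n ≤⟨ [k²r]²n≤2 ⟩
        ι 2 * 1ℚ ^ 2 ∎))
        where open ≤-Reasoning

      qk²≤m : q ℕ.* k ℕ.^ 2 ℕ.≤ m
      qk²≤m = ι-cancel-≤ (*-cancelʳ-≤ 0<r (begin
        ι (q ℕ.* k ℕ.^ 2) * r ≡⟨ trans (cong (_* r) (ι-* q (k ℕ.^ 2))) (*-assoc (ι q) k² r) ⟩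
        ι q * k²r ≤⟨ qk²r≤1 ⟩
        1ℚ ≡⟨ sym mr≡1 ⟩
        ι m * r ∎))
        where open ≤-Reasoning

      2k≤k² : 2 ℕ.* k ℕ.≤ k ℕ.^ 2
      2k≤k² = ℕ.≤-trans (ℕ.*-monoˡ-≤ k 2≤k) (ℕ.≤-reflexive (cong (k ℕ.*_) (sym (ℕ.*-identityʳ k))))

      q2k≤m : q ℕ.* (2 ℕ.* k) ℕ.≤ m
      q2k≤m = ℕ.≤-trans (ℕ.*-monoʳ-≤ q 2k≤k²) qk²≤m

      4k≤m : 4 ℕ.* k ℕ.≤ m
      4k≤m = ℕ.≤-trans (ℕ.≤-reflexive (arith k)) (ℕ.≤-trans (ℕ.*-monoˡ-≤ (2 ℕ.* k) (ℕ.≤-trans (s≤s (s≤s z≤n)) 16≤q)) q2k≤m)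
        where
        arith : ∀ k → 4 ℕ.* k ≡ 2 ℕ.* (2 ℕ.* k)
        arith = ℕ-Ring.solve-∀

      2k≤m : 2 ℕ.* k ℕ.≤ m
      2k≤m = ℕ.≤-trans (ℕ.*-monoˡ-≤ k {2} {4} (s≤s (s≤s z≤n))) 4k≤m

      M : ℕ
      M = m ℕ.∸ 2 ℕ.* k

      M≡ : ι M ≡ ι m - ι 2 * ι k
      M≡ = trans (ι-∸ 2k≤m) (cong (λ s → ι m - s) (ι-* 2 k))

      m≤2M : ι m ≤ ι 2 * ι M
      m≤2M = ≤-by (ι m - ι 4 * ι k) (≤⇒0≤- (≤-trans (≤-reflexive (sym (ι-* 4 k))) (ι-mono-≤ 4k≤m)))
        (trans (cong (ι 2 *_) M≡) (solve 2 (λ m k → con (ι 2) :* (m :- con (ι 2) :* k) := m :+ (m :- con (ι 4) :* k)) refl (ι m) (ι k)))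

      0<M : 0ℚ < ι M
      0<M = *-cancelˡ-< (0≤ι 2) (<-≤-trans (≤-<-trans (≤-reflexive (*-zeroʳ (ι 2))) 0<m) m≤2M)

      t : ℚ
      t = proj₁ (recip 0<M)

      0≤t : 0ℚ ≤ t
      0≤t = <⇒≤ (proj₁ (proj₂ (recip 0<M)))

      Mt≡1 : ι M * t ≡ 1ℚ
      Mt≡1 = proj₂ (proj₂ (recip 0<M))

      t≤2r : t ≤ ι 2 * r
      t≤2r = begin
        t ≡⟨ sym (trans (cong (t *_) mr≡1) (*-identityʳ t)) ⟩
        t * (ι m * r) ≤⟨ *-monoˡ 0≤t (*-monoʳ 0≤r m≤2M) ⟩
        t * (ι 2 * ι M * r) ≡⟨ solve 3 (λ t m r → t :* (con (ι 2) :* m :* r) := con (ι 2) :* r :* (m :* t)) refl t (ι M) r ⟩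
        ι 2 * r * (ι M * t) ≡⟨ trans (cong (ι 2 * r *_) Mt≡1) (*-identityʳ (ι 2 * r)) ⟩
        ι 2 * r ∎
        where open ≤-Reasoning

      0<1+t : 0ℚ < 1ℚ + t
      0<1+t = <-≤-trans 0<1 (a≤a+b 0≤t)

      s : ℚ
      s = proj₁ (recip 0<1+t)

      0<s : 0ℚ < s
      0<s = proj₁ (proj₂ (recip 0<1+t))

      0≤s = <⇒≤ 0<s

      [1+t]s≡1 : (1ℚ + t) * s ≡ 1ℚ
      [1+t]s≡1 = proj₂ (proj₂ (recip 0<1+t))

      s≤1 : s ≤ 1ℚ
      s≤1 = ≤-trans (≤-by (t * s) (0≤*-pos 0≤t 0≤s) (solve 2 (λ t s → (con 1ℚ :+ t) :* s := s :+ t :* s) refl t s)) (≤-reflexive [1+t]s≡1)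

      [1+t]^s^≡1 : ∀ i → (1ℚ + t) ^ i * s ^ i ≡ 1ℚ
      [1+t]^s^≡1 i = trans (sym (^-distrib-* (1ℚ + t) s i)) (trans (cong (_^ i) [1+t]s≡1) (1^ i))

      v : ℚ
      v = s ^ (k ℕ.^ 2)

      0<v : 0ℚ < v
      0<v = 0<^ (k ℕ.^ 2) 0<s

      0≤v = <⇒≤ 0<v

      v≤1 : v ≤ 1ℚ
      v≤1 = ^≤1 (k ℕ.^ 2) 0≤s s≤1

      a : ℕ
      a = n ℕ./ q

      aq≤n : a ℕ.* q ℕ.≤ n
      aq≤n = m/n*n≤m n q

      1≤a : 1 ℕ.≤ a
      1≤a = ℕ.≤-trans (ℕ.≤-reflexive (sym (m*n/n≡m 1 q))) (/-monoˡ-≤ q (ℕ.≤-trans (ℕ.≤-reflexive (ℕ.*-identityˡ q)) q≤n))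

      n≤2qa : n ℕ.≤ 2 ℕ.* q ℕ.* a
      n≤2qa = n≤2q[n/q] n q 1≤a

      W : ℕ
      W = k ℕ.^ 2 ℕ.* (n ℕ.+ a)

      -- Here c < 1 is spent: k²(n + a) ≤ (1 + 1/q)k²n ≤ (1 + 1/q)cml ≤ (1 - 1/q)ml ≤ (m - 2k)l, the
      -- last step by 2kq ≤ k²q ≤ m.
      W≤Ml : ι W ≤ ι M * l
      W≤Ml = *-cancelˡ-≤ (ι-mono-< {0} {q} (s≤s z≤n)) (begin
        ι q * ι W ≡⟨ trans (sym (ι-* q W)) (cong ι (arith q (k ℕ.^ 2) n a)) ⟩
        ι (q ℕ.* (k ℕ.^ 2 ℕ.* n) ℕ.+ k ℕ.^ 2 ℕ.* (a ℕ.* q)) ≤⟨ ι-mono-≤ (ℕ.+-monoʳ-≤ (q ℕ.* (k ℕ.^ 2 ℕ.* n)) (ℕ.*-monoʳ-≤ (k ℕ.^ 2) aq≤n)) ⟩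
        ι (q ℕ.* (k ℕ.^ 2 ℕ.* n) ℕ.+ k ℕ.^ 2 ℕ.* n) ≡⟨ trans (ι-+ (q ℕ.* (k ℕ.^ 2 ℕ.* n)) (k ℕ.^ 2 ℕ.* n)) (cong (_+ A) (ι-* q (k ℕ.^ 2 ℕ.* n))) ⟩
        ι q * A + A ≡⟨ solve 2 (λ q a → q :* a :+ a := (q :+ con 1ℚ) :* a) refl (ι q) A ⟩
        (ι q + 1ℚ) * A ≤⟨ *-monoˡ (0≤+ (0≤ι q) 0≤1) (<⇒≤ k²n<cml) ⟩
        (ι q + 1ℚ) * (c * (ι m * l)) ≡⟨ sym (*-assoc (ι q + 1ℚ) c (ι m * l)) ⟩
        (ι q + 1ℚ) * c * (ι m * l) ≤⟨ *-monoʳ (0≤*-pos (0≤ι m) 0≤l) [q+1]c≤q-1 ⟩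
        (ι q - 1ℚ) * (ι m * l) ≡⟨ solve 3 (λ q m l → (q :- con 1ℚ) :* (m :* l) := (q :* m :- m) :* l) refl (ι q) (ι m) l ⟩
        (ι q * ι m - ι m) * l ≤⟨ *-monoʳ 0≤l (+-monoʳ-≤ (ι q * ι m) (neg-antimono-≤ (≤-trans (≤-reflexive
          (trans (cong (ι q *_) (sym (ι-* 2 k))) (sym (ι-* q (2 ℕ.* k))))) (ι-mono-≤ q2k≤m)))) ⟩
        (ι q * ι m - ι q * (ι 2 * ι k)) * l ≡⟨ trans (solve 4 (λ q m k l → (q :* m :- q :* (con (ι 2) :* k)) :* l := q :* ((m :- con (ι 2) :* k) :* l)) refl (ι q) (ι m) (ι k) l)
          (cong (λ i → ι q * (i * l)) (sym M≡)) ⟩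
        ι q * (ι M * l) ∎)
        where
        open ≤-Reasoning
        arith : ∀ q k n a → q ℕ.* (k ℕ.* (n ℕ.+ a)) ≡ q ℕ.* (k ℕ.* n) ℕ.+ k ℕ.* (a ℕ.* q)
        arith = ℕ-Ring.solve-∀
        [q+1]c≤q-1 : (ι q + 1ℚ) * c ≤ ι q - 1ℚ
        [q+1]c≤q-1 = ≤-by ((1ℚ - c) * ι q - ι 2 + (1ℚ - c)) (0≤+ (≤⇒0≤- 2≤[1-c]q) (<⇒≤ 0<1-c))
          (solve 2 (λ q c → q :- con 1ℚ := (q :+ con 1ℚ) :* c :+ ((con 1ℚ :- c) :* q :- con (ι 2) :+ (con 1ℚ :- c))) refl (ι q) c)

      1≤nv^ : 1ℚ ≤ ι n * v ^ (n ℕ.+ a)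
      1≤nv^ = begin
        1ℚ ≡⟨ sym ([1+t]^s^≡1 W) ⟩
        (1ℚ + t) ^ W * s ^ W ≤⟨ *-monoʳ (0≤^ W 0≤s) ([1+t]^W≤n {n} {l} {t} 0≤l exp<n 0≤t W Wt≤l) ⟩
        ι n * s ^ W ≡⟨ cong (ι n *_) (^-* s (k ℕ.^ 2) (n ℕ.+ a)) ⟩
        ι n * v ^ (n ℕ.+ a) ∎
        where
        open ≤-Reasoning
        Wt≤l : ι W * t ≤ l
        Wt≤l = ≤-trans (*-monoʳ 0≤t W≤Ml) (≤-reflexive (trans (solve 3 (λ m l t → m :* l :* t := l :* (m :* t)) refl (ι M) l t) (trans (cong (l *_) Mt≡1) (*-identityʳ l))))

      module S = SecondMoment {n} {m} {k} {r} 2≤n 4k≤m mr≡1 0<r r≤1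

      ψ : ℚ
      ψ = s ^ k

      0≤ψ : 0ℚ ≤ ψ
      0≤ψ = 0≤^ k 0≤s

      -- (m - j)/(m - k - j) = 1 + k/(m - k - j) ≤ 1 + k/(m - 2k) ≤ (1 + t)^k. The denominators are
      -- smallest at j = k, which explains M = m - 2k.
      ψ-step : ∀ {j} → j ℕ.≤ k → ψ * (ι m - ι j) ≤ ι (m ℕ.∸ k) - ι j
      ψ-step {j} j≤k = begin
        ψ * (ι m - ι j) ≤⟨ *-monoˡ 0≤ψ m-j≤ ⟩
        ψ * ((1ℚ + ι k * t) * B) ≡⟨ sym (*-assoc ψ (1ℚ + ι k * t) B) ⟩
        ψ * (1ℚ + ι k * t) * B ≤⟨ *-monoʳ 0≤B ψ[1+kt]≤1 ⟩
        1ℚ * B ≡⟨ *-identityˡ B ⟩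
        B ∎
        where
        open ≤-Reasoning
        B = ι (m ℕ.∸ k) - ι j
        B≡ : B ≡ ι m - ι k - ι j
        B≡ = cong (_- ι j) (ι-∸ k≤m)
        M≤B : ι M ≤ B
        M≤B = ≤-by (ι k - ι j) (≤⇒0≤- (ι-mono-≤ j≤k)) (trans B≡ (trans
          (solve 3 (λ m k j → m :- k :- j := m :- con (ι 2) :* k :+ (k :- j)) refl (ι m) (ι k) (ι j)) (cong (_+ (ι k - ι j)) (sym M≡))))
        0≤B : 0ℚ ≤ B
        0≤B = ≤-trans (0≤ι M) M≤B
        ψ[1+kt]≤1 : ψ * (1ℚ + ι k * t) ≤ 1ℚ
        ψ[1+kt]≤1 = ≤-trans (*-monoˡ 0≤ψ (bernoulli k (<⇒≤ 0<1+t))) (≤-reflexive (trans (*-comm ψ _) ([1+t]^s^≡1 k)))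
        m-j≤ : ι m - ι j ≤ (1ℚ + ι k * t) * B
        m-j≤ = ≤-by (ι k * (B * t - 1ℚ)) (0≤*-pos (0≤ι k) (≤⇒0≤- (≤-trans (≤-reflexive (sym Mt≡1)) (*-monoʳ 0≤t M≤B))))
          (trans (solve 3 (λ k t b → (con 1ℚ :+ k :* t) :* b := b :+ k :+ k :* (b :* t :- con 1ℚ)) refl (ι k) t B)
            (cong (_+ ι k * (B * t - 1ℚ)) (trans (cong (_+ ι k) B≡) (solve 3 (λ m k j → m :- k :- j :+ k := m :- j) refl (ι m) (ι k) (ι j)))))

      binom-ψ : ∀ j → j ℕ.≤ k → ψ ^ j * binom m j ≤ binom (m ℕ.∸ k) j
      binom-ψ zero    _   = ≤-reflexive (trans (*-identityˡ (binom m 0)) (trans (binom-0 m) (sym (binom-0 (m ℕ.∸ k)))))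
      binom-ψ (suc j) j<k = *-cancelˡ-≤ (ι-mono-< {0} {suc j} (s≤s z≤n)) (begin
        ι (suc j) * (ψ ^ suc j * binom m (suc j)) ≡⟨ trans (solve 3 (λ i p b → i :* (p :* b) := p :* (i :* b)) refl (ι (suc j)) (ψ ^ suc j) (binom m (suc j)))
          (cong (ψ ^ suc j *_) (binom-absorb m j)) ⟩
        ψ ^ suc j * ((ι m - ι j) * binom m j) ≡⟨ solve 4 (λ p x d b → p :* x :* (d :* b) := p :* d :* (x :* b)) refl ψ (ψ ^ j) (ι m - ι j) (binom m j) ⟩
        ψ * (ι m - ι j) * (ψ ^ j * binom m j) ≤⟨ *-mono-≤ (0≤*-pos 0≤ψ (≤⇒0≤- (ι-mono-≤ (ℕ.≤-trans (ℕ.<⇒≤ j<k) k≤m))))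
          (0≤*-pos (0≤^ j 0≤ψ) (0≤binom m j)) (ψ-step (ℕ.<⇒≤ j<k)) (binom-ψ j (ℕ.<⇒≤ j<k)) ⟩
        (ι (m ℕ.∸ k) - ι j) * binom (m ℕ.∸ k) j ≡⟨ sym (binom-absorb (m ℕ.∸ k) j) ⟩
        ι (suc j) * binom (m ℕ.∸ k) (suc j) ∎)
        where open ≤-Reasoning

      v≤p : v ≤ S.p
      v≤p = begin
        v ≡⟨ trans (cong (λ i → s ^ (k ℕ.* i)) (ℕ.*-identityʳ k)) (^-* s k k) ⟩
        ψ ^ k ≡⟨ sym (trans (cong (ψ ^ k *_) Ns≡1) (*-identityʳ (ψ ^ k))) ⟩
        ψ ^ k * (binom m k * N⁻) ≡⟨ sym (*-assoc (ψ ^ k) (binom m k) N⁻) ⟩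
        ψ ^ k * binom m k * N⁻ ≤⟨ *-monoʳ (<⇒≤ (proj₁ (proj₂ (recip (0<binom k≤m))))) (binom-ψ k ℕ.≤-refl) ⟩
        S.p ∎
        where
        open ≤-Reasoning
        N⁻ = proj₁ (recip (0<binom k≤m))
        Ns≡1 : binom m k * N⁻ ≡ 1ℚ
        Ns≡1 = proj₂ (proj₂ (recip (0<binom k≤m)))

      0<p : 0ℚ < S.p
      0<p = <-≤-trans 0<v v≤p

      -- If w = n v^n were less than K, raising 1 ≤ w v^a to the power 2q
      -- would bound n by K^(2q+1).
      w : ℚ
      w = ι n * v ^ n

      K≤w : ι K ≤ w
      K≤w = ≮⇒≥ λ w<K → <-irrefl refl (<-≤-trans (K^<n N₀≤n) (begin
        ι n ≡⟨ sym (*-identityʳ (ι n)) ⟩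
        ι n * 1ℚ ≡⟨ cong (ι n *_) (sym (1^ (2 ℕ.* q))) ⟩
        ι n * 1ℚ ^ (2 ℕ.* q) ≤⟨ *-monoˡ (0≤ι n) (^-mono (2 ℕ.* q) 0≤1 (begin
          1ℚ ≤⟨ 1≤nv^ ⟩
          ι n * v ^ (n ℕ.+ a) ≡⟨ trans (cong (ι n *_) (^-+ v n a)) (sym (*-assoc (ι n) (v ^ n) (v ^ a))) ⟩
          w * v ^ a ≤⟨ *-monoʳ (0≤^ a 0≤v) (<⇒≤ w<K) ⟩
          ι K * v ^ a ∎)) ⟩
        ι n * (ι K * v ^ a) ^ (2 ℕ.* q) ≡⟨ cong (ι n *_) (trans (^-distrib-* (ι K) (v ^ a) (2 ℕ.* q)) (cong (ι K ^ (2 ℕ.* q) *_) (sym (^-* v a (2 ℕ.* q))))) ⟩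
        ι n * (ι K ^ (2 ℕ.* q) * v ^ (a ℕ.* (2 ℕ.* q)))
          ≤⟨ *-monoˡ (0≤ι n) (*-monoˡ (0≤^ (2 ℕ.* q) (0≤ι K)) (^-anti {v} {n} {a ℕ.* (2 ℕ.* q)} 0≤v v≤1 (ℕ.≤-trans n≤2qa (ℕ.≤-reflexive (ℕ.*-comm (2 ℕ.* q) a))))) ⟩
        ι n * (ι K ^ (2 ℕ.* q) * v ^ n) ≡⟨ solve 3 (λ n k v → n :* (k :* v) := n :* v :* k) refl (ι n) (ι K ^ (2 ℕ.* q)) (v ^ n) ⟩
        w * ι K ^ (2 ℕ.* q) ≤⟨ *-monoʳ (0≤^ (2 ℕ.* q) (0≤ι K)) (<⇒≤ w<K) ⟩
        ι K ^ suc (2 ℕ.* q) ∎))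
        where open ≤-Reasoning

      1≤δμ : 1ℚ ≤ δ * S.μ
      1≤δμ = begin
        1ℚ ≤⟨ 1≤δK ⟩
        δ * ι K ≤⟨ *-monoˡ (<⇒≤ 0<δ) K≤w ⟩
        δ * (ι n * v ^ n) ≤⟨ *-monoˡ (<⇒≤ 0<δ) (*-monoˡ (0≤ι n) (≤-trans (^-anti 0≤v v≤1 (ℕ.m∸n≤m n 1)) (^-mono (n ℕ.∸ 1) 0≤v v≤p))) ⟩
        δ * S.μ ∎
        where open ≤-Reasoning

      -- From p ≥ v ≥ 1 - h with h = k²/(m - 2k) ≤ 2/q follow 1 - p² ≤ 4/q and p² ≥ 1/4; hence the
      -- constant 16 in the choice of q.
      1-pp≤ : 1ℚ - S.p * S.p ≤ δ * (S.p * S.p)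
      1-pp≤ = *-cancelˡ-≤ (ι-mono-< {0} {q} (s≤s z≤n)) (begin
        ι q * (1ℚ - S.p * S.p) ≤⟨ *-monoˡ (0≤ι q) 1-pp≤2h ⟩
        ι q * (ι 2 * h) ≤⟨ q2h≤4 ⟩
        ι 4 ≡⟨ refl ⟩
        ι 16 * (½ * ½) ≤⟨ *-mono-≤ (0≤ι 16) (0≤*-pos 0≤½ 0≤½) 16≤δq ¼≤pp ⟩
        δ * ι q * (S.p * S.p) ≡⟨ solve 3 (λ d q p → d :* q :* p := q :* (d :* p)) refl δ (ι q) (S.p * S.p) ⟩
        ι q * (δ * (S.p * S.p)) ∎)
        where
        open ≤-Reasoning
        h = k² * t
        0≤h : 0ℚ ≤ h
        0≤h = 0≤*-pos 0≤k² 0≤t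
        q2h≤4 : ι q * (ι 2 * h) ≤ ι 4
        q2h≤4 = begin
          ι q * (ι 2 * (k² * t)) ≤⟨ *-monoˡ (0≤ι q) (*-monoˡ (0≤ι 2) (*-monoˡ 0≤k² t≤2r)) ⟩
          ι q * (ι 2 * (k² * (ι 2 * r))) ≡⟨ solve 3 (λ q k r → q :* (con (ι 2) :* (k :* (con (ι 2) :* r))) := con (ι 4) :* (q :* (k :* r))) refl (ι q) k² r ⟩
          ι 4 * (ι q * k²r) ≤⟨ *-monoˡ (0≤ι 4) qk²r≤1 ⟩
          ι 4 * 1ℚ ≡⟨ *-identityʳ (ι 4) ⟩
          ι 4 ∎
        8h≤1 : ι 8 * h ≤ 1ℚ
        8h≤1 = *-cancelˡ-≤ (ι-mono-< {0} {4} (s≤s z≤n)) (begin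
          ι 4 * (ι 8 * h) ≡⟨ solve 1 (λ h → con (ι 4) :* (con (ι 8) :* h) := con (ι 16) :* (con (ι 2) :* h)) refl h ⟩
          ι 16 * (ι 2 * h) ≤⟨ *-monoʳ (0≤*-pos (0≤ι 2) 0≤h) (ι-mono-≤ 16≤q) ⟩
          ι q * (ι 2 * h) ≤⟨ q2h≤4 ⟩
          ι 4 * 1ℚ ∎)
        h≤1 : h ≤ 1ℚ
        h≤1 = ≤-trans (≤-by (ι 7 * h) (0≤*-pos (0≤ι 7) 0≤h) (solve 1 (λ h → con (ι 8) :* h := h :+ con (ι 7) :* h) refl h)) 8h≤1
        1-t≤s : 1ℚ - t ≤ s
        1-t≤s = *-cancelˡ-≤ 0<1+t (≤-trans (≤-by (t * t) (0≤*-pos 0≤t 0≤t) (trans [1+t]s≡1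
          (solve 1 (λ t → con 1ℚ := (con 1ℚ :+ t) :* (con 1ℚ :- t) :+ t :* t) refl t))) ≤-refl)
        1-h≤v : 1ℚ - h ≤ v
        1-h≤v = begin
          1ℚ - k² * t ≤⟨ +-monoʳ-≤ 1ℚ (neg-antimono-≤ (*-monoˡ 0≤k² 1-s≤t)) ⟩
          1ℚ - k² * (1ℚ - s) ≤⟨ bernoulli⁻ (k ℕ.^ 2) (a-b≤a 0≤s) ⟩
          (1ℚ - (1ℚ - s)) ^ (k ℕ.^ 2) ≡⟨ cong (_^ (k ℕ.^ 2)) (solve 1 (λ s → con 1ℚ :- (con 1ℚ :- s) := s) refl s) ⟩
          v ∎
          where
          1-s≤t : 1ℚ - s ≤ t
          1-s≤t = ≤-by (s - (1ℚ - t)) (≤⇒0≤- 1-t≤s) (solve 2 (λ s t → t := con 1ℚ :- s :+ (s :- (con 1ℚ :- t))) refl s t)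
        pp≥ : (1ℚ - h) * (1ℚ - h) ≤ S.p * S.p
        pp≥ = *-mono-≤ (≤⇒0≤- h≤1) (≤⇒0≤- h≤1) (≤-trans 1-h≤v v≤p) (≤-trans 1-h≤v v≤p)
        1-pp≤2h : 1ℚ - S.p * S.p ≤ ι 2 * h
        1-pp≤2h = ≤-by (S.p * S.p - (1ℚ - h) * (1ℚ - h) + h * h) (0≤+ (≤⇒0≤- pp≥) (0≤*-pos 0≤h 0≤h))
          (solve 2 (λ h p → con (ι 2) :* h := con 1ℚ :- p :+ (p :- (con 1ℚ :- h) :* (con 1ℚ :- h) :+ h :* h)) refl h (S.p * S.p))
        ¼≤pp : ½ * ½ ≤ S.p * S.p
        ¼≤pp = ≤-trans (≤-by (ι 3 * (½ * ½) * (1ℚ - ι 8 * h) + ι 4 * h + h * h)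
            (0≤+ (0≤+ (0≤*-pos (0≤*-pos (0≤ι 3) (0≤*-pos 0≤½ 0≤½)) (≤⇒0≤- 8h≤1)) (0≤*-pos (0≤ι 4) 0≤h)) (0≤*-pos 0≤h 0≤h))
            (solve 1 (λ h → (con 1ℚ :- h) :* (con 1ℚ :- h) := con (½ * ½) :+ (con (ι 3 * (½ * ½)) :* (con 1ℚ :- con (ι 8) :* h) :+ con (ι 4) :* h :+ h :* h)) refl h)) pp≥

    sparse-connections-≤ : connections n m k ≤ binom m k ^ n * (ι 2 * δ)
    sparse-connections-≤ = S.connections-≤ {δ} 0<p 1≤δμ 1-pp≤

  connections-≤ : Eventually λ n → ∀ m k → 2 ℕ.≤ k → k ℕ.≤ m → (k ℕ.^ 2 ℕ.* n) ÷ m · log n ᶜ< c →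
    connections n m k ≤ binom m k ^ n * (ι 2 * δ)
  connections-≤ = N₀ , λ n N₀≤n m k 2≤k k≤m (l′ , (l , exp<n , l′<ml) , 0≤l′ , k²n<cl′) →
    -- The witness l′ of the quotient's upper part is nonnegative and below ml, which forces l > 0.
    sparse-connections-≤ N₀≤n 2≤k k≤m {l} (0<l {m} {l} (≤-<-trans 0≤l′ l′<ml)) exp<n (<-trans k²n<cl′ (*-monoˡ-< 0<c l′<ml))
    where
    0<l : ∀ {m l} → 0ℚ < ι m * l → 0ℚ < l
    0<l {m} {l} 0<ml = *-cancelˡ-< (0≤ι m) (≤-<-trans (≤-reflexive (*-zeroʳ (ι m))) 0<ml)

-- The two limits

private
  0<length-assignments : ∀ {n m k} → k ℕ.≤ m → 0ℚ < ι (length (assignments n m k))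
  0<length-assignments {n} {m} {k} k≤m = <-≤-trans (0<^ n (0<binom k≤m)) (≤-reflexive (sym (length-assignments n m k)))

  -- A bound c < 1 on the upper limit comes without a sign. Raising it to 1/2 if necessary makes it
  -- positive, so that inequalities can be multiplied by it.
  raise : ∀ {c} → c < 1ℚ → ∃ λ c′ → 0ℚ < c′ × c′ < 1ℚ × c ≤ c′
  raise {c} c<1 with ≤-total c ½
  ... | inj₁ c≤½ = ½ , *<* (ℤ.+<+ (s≤s z≤n)) , *<* (ℤ.+<+ (s≤s (s≤s z≤n))) , c≤½
  ... | inj₂ ½≤c = c , <-≤-trans (*<* (ℤ.+<+ (s≤s z≤n))) ½≤c , c<1 , ≤-refl

  𝟙-¬¬ : ∀ {P : Set} (P? : Dec P) → 𝟙 (¬? (¬? P?)) ≡ 𝟙 P?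
  𝟙-¬¬ P? = 𝟙-⇔ (¬? (¬? P?)) P? (decidable-stable P?) λ p ¬p → ¬p p

  eventually-map₃ : {P Q R S : ℕ → Set} → (∀ n → P n → Q n → R n → S n) → Eventually P → Eventually Q → Eventually R → Eventually S
  eventually-map₃ f (N₁ , p) (N₂ , q) (N₃ , r) = N₁ ℕ.+ (N₂ ℕ.+ N₃) , λ n N≤n →
    f n (p n (ℕ.≤-trans (ℕ.m≤m+n N₁ (N₂ ℕ.+ N₃)) N≤n))
      (q n (ℕ.≤-trans (ℕ.≤-trans (ℕ.m≤m+n N₂ N₃) (ℕ.m≤n+m (N₂ ℕ.+ N₃) N₁)) N≤n))
      (r n (ℕ.≤-trans (ℕ.≤-trans (ℕ.m≤n+m N₃ N₂) (ℕ.m≤n+m (N₂ ℕ.+ N₃) N₁)) N≤n))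

÷-monoʳ : ∀ {a x p q} → p ≤ q → a ÷ x ᶜ< p → a ÷ x ᶜ< q
÷-monoʳ p≤q (l , l<x , 0≤l , a<pl) = l , l<x , 0≤l , <-≤-trans a<pl (*-monoʳ 0≤l p≤q)

connectivity : (k m : ℕ → ℕ) → (∀ n → 2 ℕ.≤ k n) → Eventually (λ n → k n ℕ.≤ m n) →
  1ℚ <liminf (λ n → (k n ℕ.^ 2 ℕ.* n) ÷ m n · log n) → (λ n → ℙ[G n , m n , k n ]connected) ⟶ 1ℚ
connectivity k m 2≤k k≤m (c , 1<c , above) η 0<η = eventually-map₃ (λ n bound k≤m above →
  probability-near-1 (λ F → connected? (intersection? F)) (assignments n (m n) (k n)) (0<length-assignments {n} k≤m)
    (≤-trans (bound (m n) (k n) (2≤k n) above)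
      (≤-reflexive (cong (_* (ι 2 * δ + (ι 2 * δ + (δ + δ)))) (sym (length-assignments n (m n) (k n)))))) 6δ<η)
  (disconnections-≤ 1<c 0<δ 2δ≤1) k≤m above
  where
  δ = proj₁ (small-fraction 0<η)
  0<δ = proj₁ (proj₂ (small-fraction 0<η))
  2δ≤1 = proj₁ (proj₂ (proj₂ (small-fraction 0<η)))
  6δ<η = proj₂ (proj₂ (proj₂ (small-fraction 0<η)))

disconnectivity : (k m : ℕ → ℕ) → (∀ n → 2 ℕ.≤ k n) → Eventually (λ n → k n ℕ.≤ m n) →
  limsup (λ n → (k n ℕ.^ 2 ℕ.* n) ÷ m n · log n) < 1ℚ → (λ n → ℙ[G n , m n , k n ]disconnected) ⟶ 1ℚ
disconnectivity k m 2≤k k≤m (c , c<1 , below) η 0<η = eventually-map₃ (λ n bound k≤m below →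
  probability-near-1 (λ F → ¬? (connected? (intersection? F))) (assignments n (m n) (k n)) (0<length-assignments {n} k≤m)
    (≤-trans (≤-reflexive (∑-cong (assignments n (m n) (k n)) λ F → 𝟙-¬¬ (connected? (intersection? F))))
      (≤-trans (bound (m n) (k n) (2≤k n) k≤m (÷-monoʳ {k n ℕ.^ 2 ℕ.* n} {m n · log n} c≤c′ below))
        (≤-reflexive (cong (_* (ι 2 * δ)) (sym (length-assignments n (m n) (k n))))))) 2δ<η)
  (connections-≤ (proj₁ (proj₂ (raise c<1))) (proj₁ (proj₂ (proj₂ (raise c<1)))) 0<δ δ≤1) k≤m below
  where
  δ = proj₁ (small-fraction 0<η)
  0<δ = proj₁ (proj₂ (small-fraction 0<η))
  2δ≤1 = proj₁ (proj₂ (proj₂ (small-fraction 0<η)))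
  0≤2δ : 0ℚ ≤ ι 2 * δ
  0≤2δ = 0≤*-pos (0≤ι 2) (<⇒≤ 0<δ)
  2δ<η = ≤-<-trans (a≤a+b (0≤+ 0≤2δ (0≤+ (<⇒≤ 0<δ) (<⇒≤ 0<δ)))) (proj₂ (proj₂ (proj₂ (small-fraction 0<η))))
  δ≤1 = ≤-trans (≤-by δ (<⇒≤ 0<δ) (solve 1 (λ d → con (ι 2) :* d := d :+ d) refl δ)) 2δ≤1
  c≤c′ = proj₂ (proj₂ (proj₂ (raise c<1)))

theorem1 : (α : ℝ) → 0ℚ <ᶜ ℝ.cut α →
    (k m : ℕ → ℕ) →
    (∀ n → 2 ℕ.≤ k n) →
    (∀ n → IsFloor (m n) (n ^ʳ ℝ.cut α)) →
    Eventually (λ n → k n ℕ.≤ m n) →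
    (1ℚ <liminf (λ n → (k n ℕ.^ 2 ℕ.* n) ÷ m n · log n) →
    (λ n → ℙ[G n , m n , k n ]connected) ⟶ 1ℚ)
    ×
    (limsup (λ n → (k n ℕ.^ 2 ℕ.* n) ÷ m n · log n) < 1ℚ →
    (λ n → ℙ[G n , m n , k n ]disconnected) ⟶ 1ℚ)
theorem1 α 0<α k m 2≤k floor-n^α k≤m = connectivity k m 2≤k k≤m , disconnectivity k m 2≤k k≤m
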